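{- Let $G$ be a tree with $n\ge k\ge1$ vertices and maximum degree $\Delta$, and let $P^*$ be a longest path of $G$. Then $h^r_k(G) = (n-k)+\sum_{e\in E} d^k_{P^*}(e)$, and a spanning restricted transition walk of this length can be computed in time $O(n\cdot k\cdot\Delta)$.
   Context: All graphs are finite, simple, undirected. A configuration of $k$ agents is a $k$-tuple of pairwise distinct vertices of $G$ whose induced subgraph is connected (identified with its vertex set when convenient). Configurations $(v_1,\dots,v_k)$, $(v'_1,\dots,v'_k)$ are adjacent if for every $i$ either $v_i=v'_i$ or $(v_i,v'_i)\in E$. A restricted transition walk is a sequence of configurations $\mathcal C_0,\dots,\mathcal C_l$ such that consecutive configurations are adjacent and $\mathcal C_{t+1}$ contains exactly one vertex not in $\mathcal C_t$; it is spanning if every vertex lies in some $\mathcal C_t$; its length is $l$. $h^r_k(G)$ is the minimum length of a spanning restricted transition walk. For a tree $G$, a path $P$ and $k\ge1$, define $d^k_P(e)\in\{0,1\}$ for every edge $e$: $d^k_P(e)=0$ if $e$ lies on $P$; otherwise write $e=(u,v)$ with $u$ closer to $P$ than $v$, let $T_P(e)$ be the component of $G-e$ containing $v$, rooted at $v$, and set $d^k_P(e)=1$ if $T_P(e)$ has height at least $k-1$ (equivalently, some vertex of $T_P(e)$ has distance at least $k$ from $u$), and $d^k_P(e)=0$ otherwise. -}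

module Defs where

open import Level using (0ℓ)
open import Data.Bool using (if_then_else_)
open import Data.Nat using (ℕ; zero; suc; _+_; _*_; _∸_; _≤_; _<_; _≟_; _≤?_)
open import Data.Nat.Properties using (_<?_; anyUpTo?; ≰⇒>; ≤-reflexive; +-monoˡ-<; m+[n∸m]≡n; ≤-trans)
open import Data.Nat.Induction using (<-rec)
open import Data.Fin using (Fin; zero; suc; toℕ; inject₁)
open import Data.Fin.Properties using (any?; pigeonhole; toℕ≤pred[n]) renaming (_≟_ to _≟ᶠ_; _<?_ to _<ᶠ?_)
open import Data.List using (List; []; _∷_; _++_; length; map; filter; take; takeWhile; upTo; allFin; tabulate; concat; cartesianProduct)
open import Data.Nat.ListAction using (sum)
open import Data.List.Extrema.Nat using (max; min)
open import Data.List.Membership.Propositional using (_∈_)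
open import Data.List.Relation.Unary.Linked using (Linked)
open import Data.List.Relation.Unary.Unique.Propositional using (Unique)
open import Data.List.Relation.Binary.Infix.Heterogeneous using (Infix)
open import Data.List.Relation.Binary.Infix.Heterogeneous.Properties using (infix?)
open import Data.Product using (∃; ∃!; _×_; _,_)
open import Data.Sum using (_⊎_; inj₁; inj₂)
open import Function using (_∘_)
open import Function.Bundles using (_⇔_)
open import Function.Definitions using (Injective)
open import Relation.Binary using (Rel; Symmetric; Irreflexive; Decidable)
open import Relation.Binary.PropositionalEquality using (_≡_; _≢_; refl; sym; cong; subst)
open import Relation.Nullary using (¬_; Dec; yes; no; does)
open import Relation.Nullary.Decidable using (map′; _×-dec_; _⊎-dec_; ¬?)

record Graph (n : ℕ) : Set₁ where
  field
    E      : Rel (Fin n) 0ℓ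
    E?     : Decidable E
    symE   : Symmetric E
    irrefl : Irreflexive _≡_ E

open Graph public

data Walk {n : ℕ} (G : Graph n) : Fin n → Fin n → ℕ → Set where
  []  : ∀ {u} → Walk G u u 0
  _∷_ : ∀ {u w v m} → E G u w → Walk G w v m → Walk G u v (suc m)

Reachable : ∀ {n} → Graph n → Fin n → Fin n → Set
Reachable G u v = ∃ λ m → Walk G u v m

Connected : ∀ {n} → Graph n → Set
Connected G = ∀ u v → Reachable G u v

IsCycle : ∀ {n} → Graph n → Fin n → List (Fin n) → Set
IsCycle G v vs = 2 ≤ length vs × Unique (v ∷ vs) × Linked (E G) (v ∷ vs ++ v ∷ [])

Acyclic : ∀ {n} → Graph n → Set
Acyclic G = ∀ v vs → ¬ IsCycle G v vs

IsTree : ∀ {n} → Graph n → Set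
IsTree G = Connected G × Acyclic G

IsPath : ∀ {n} → Graph n → List (Fin n) → Set
IsPath G P = P ≢ [] × Unique P × Linked (E G) P

IsLongestPath : ∀ {n} → Graph n → List (Fin n) → Set
IsLongestPath G P = IsPath G P × (∀ Q → IsPath G Q → length Q ≤ length P)

degree : ∀ {n} → Graph n → Fin n → ℕ
degree {n} G v = length (filter (E? G v) (allFin n))

maxDegree : ∀ {n} → Graph n → ℕ
maxDegree {n} G = max 0 (map (degree G) (allFin n))

-- Each edge {u , v} is listed once, as the pair with u < v.
edges : ∀ {n} → Graph n → List (Fin n × Fin n)
edges {n} G = filter (λ (u , v) → (u <ᶠ? v) ×-dec E? G u v) (cartesianProduct (allFin n) (allFin n))

_−_ : ∀ {n} → Graph n → Fin n × Fin n → Graph n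
_−_ {n} G (a , b) = record
  { E      = λ x y → E G x y × ¬ Same x y
  ; E?     = λ x y → E? G x y ×-dec ¬? (same? x y)
  ; symE   = λ (e , ¬s) → symE G e , (λ s → ¬s (flip s))
  ; irrefl = λ eq (e , _) → irrefl G eq e
  }
  where
  Same : Fin n → Fin n → Set
  Same x y = (x ≡ a × y ≡ b) ⊎ (x ≡ b × y ≡ a)

  same? : ∀ x y → Dec (Same x y)
  same? x y = ((x ≟ᶠ a) ×-dec (y ≟ᶠ b)) ⊎-dec ((x ≟ᶠ b) ×-dec (y ≟ᶠ a))

  flip : ∀ {x y} → Same y x → Same x y
  flip (inj₁ (p , q)) = inj₂ (q , p)
  flip (inj₂ (p , q)) = inj₁ (q , p)

-- For injective c this is the subgraph induced on the image of c.
induced : ∀ {n k} → Graph n → (Fin k → Fin n) → Graph k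
induced G c = record
  { E      = λ i j → E G (c i) (c j)
  ; E?     = λ i j → E? G (c i) (c j)
  ; symE   = symE G
  ; irrefl = λ eq → irrefl G (cong c eq)
  }

walk? : ∀ {n} (G : Graph n) u v m → Dec (Walk G u v m)
walk? G u v zero    = map′ (λ { refl → [] }) (λ { [] → refl }) (u ≟ᶠ v)
walk? G u v (suc m) = map′ (λ (_ , e , w) → e ∷ w) (λ { (e ∷ w) → _ , e , w })
                           (any? λ x → E? G u x ×-dec walk? G x v m)

module _ {n : ℕ} (G : Graph n) where

  private
    at : ∀ {u v m} → Walk G u v m → Fin (suc m) → Fin n
    at {u} w       zero    = u
    at     (_ ∷ w) (suc i) = at w i

    prefix : ∀ {u v m} (w : Walk G u v m) i → Walk G u (at w i) (toℕ i)
    prefix w       zero    = []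
    prefix (e ∷ w) (suc i) = e ∷ prefix w i

    suffix : ∀ {u v m} (w : Walk G u v m) i → Walk G (at w i) v (m ∸ toℕ i)
    suffix w       zero    = w
    suffix (_ ∷ w) (suc i) = suffix w i

    join : ∀ {u x v a b} → Walk G u x a → Walk G x v b → Walk G u v (a + b)
    join []       w′ = w′
    join (e ∷ w) w′ = e ∷ join w w′

  shorten : ∀ {u v} m → Walk G u v m → ∃ λ m′ → m′ < n × Walk G u v m′
  shorten {u} {v} = <-rec (λ m → Walk G u v m → ∃ λ m′ → m′ < n × Walk G u v m′) step
    where
    step : ∀ m → (∀ {i} → i < m → Walk G u v i → ∃ λ m′ → m′ < n × Walk G u v m′) →
           Walk G u v m → ∃ λ m′ → m′ < n × Walk G u v m′
    step m rec w with suc m ≤? n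
    ... | yes m<n = m , m<n , w
    ... | no  m≮n with pigeonhole (≰⇒> m≮n) (at w)
    ...   | i , j , i<j , eq = rec shorter (join (prefix w i) (subst (λ x → Walk G x v _) (sym eq) (suffix w j)))
      where
      shorter : toℕ i + (m ∸ toℕ j) < m
      shorter = ≤-trans (+-monoˡ-< (m ∸ toℕ j) i<j) (≤-reflexive (m+[n∸m]≡n (toℕ≤pred[n] j)))

  reachable? : ∀ u v → Dec (Reachable G u v)
  reachable? u v = map′ (λ (m , _ , w) → m , w) (λ (m , w) → shorten m w) (anyUpTo? (walk? G u v) n)

-- The least length of a walk from u to v; it is below n when v is
-- reachable from u, and the value is n when it is not.
dist : ∀ {n} → Graph n → Fin n → Fin n → ℕ
dist {n} G u v = length (takeWhile (λ m → ¬? (walk? G u v m)) (upTo n))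

distToPath : ∀ {n} → Graph n → List (Fin n) → Fin n → ℕ
distToPath {n} G P u = min n (map (dist G u) P)

component : ∀ {n} → Graph n → Fin n → List (Fin n)
component {n} G v = filter (reachable? G v) (allFin n)

height : ∀ {n} → Graph n → Fin n → ℕ
height G v = max 0 (map (dist G v) (component G v))

OnPath : ∀ {n} → List (Fin n) → Fin n × Fin n → Set
OnPath P (u , v) = Infix _≡_ (u ∷ v ∷ []) P ⊎ Infix _≡_ (v ∷ u ∷ []) P

onPath? : ∀ {n} (P : List (Fin n)) e → Dec (OnPath P e)
onPath? P (u , v) = infix? _≟ᶠ_ (u ∷ v ∷ []) P ⊎-dec infix? _≟ᶠ_ (v ∷ u ∷ []) P

-- In a tree the endpoints of an edge off P have different distances to P.
farEnd : ∀ {n} → Graph n → List (Fin n) → Fin n × Fin n → Fin n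
farEnd G P (u , v) = if does (distToPath G P u <? distToPath G P v) then v else u

d : ∀ {n} → Graph n → ℕ → List (Fin n) → Fin n × Fin n → ℕ
d G k P e =
  if does (onPath? P e) then 0
  else if does (k ∸ 1 ≤? height (G − e) (farEnd G P e)) then 1 else 0

walkLength : ∀ {n} → Graph n → ℕ → List (Fin n) → ℕ
walkLength {n} G k P = (n ∸ k) + sum (map (d G k P) (edges G))

IsConfiguration : ∀ {n k} → Graph n → (Fin k → Fin n) → Set
IsConfiguration G c = Injective _≡_ _≡_ c × Connected (induced G c)

Adjacent : ∀ {n k} → Graph n → (Fin k → Fin n) → (Fin k → Fin n) → Set
Adjacent G c c′ = ∀ i → c i ≡ c′ i ⊎ E G (c i) (c′ i)

_∈ᶜ_ : ∀ {n k} → Fin n → (Fin k → Fin n) → Set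
x ∈ᶜ c = ∃ λ i → c i ≡ x

record IsSpanningRestrictedWalk {n : ℕ} (G : Graph n) (k l : ℕ) (C : Fin (suc l) → Fin k → Fin n) : Set where
  field
    configuration : ∀ t → IsConfiguration G (C t)
    adjacent      : ∀ (t : Fin l) → Adjacent G (C (inject₁ t)) (C (suc t))
    restricted    : ∀ (t : Fin l) → ∃! _≡_ λ x → x ∈ᶜ C (suc t) × ¬ (x ∈ᶜ C (inject₁ t))
    spanning      : ∀ x → ∃ λ t → x ∈ᶜ C t

-- h^r_k(G) = l
h^r[_,_]≡_ : ∀ {n} → ℕ → Graph n → ℕ → Set
h^r[ k , G ]≡ l =
  (∃ λ C → IsSpanningRestrictedWalk G k l C) ×
  (∀ l′ C → IsSpanningRestrictedWalk G k l′ C → l ≤ l′)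

-- Model of computation: structured programs for a unit-cost RAM with
-- addition and truncated subtraction.  A program mentions only finitely
-- many registers and arrays and its expressions have bounded size, so
-- charging one step per executed command or test agrees, up to a constant
-- factor depending on the program, with counting RAM instructions.

infixl 7 _⊕_ _⊖_
infix  5 _≔_ _[_]≔_
infixr 4 _⨾_

data Expr : Set where
  lit      : ℕ → Expr
  reg      : ℕ → Expr
  arr      : ℕ → Expr → Expr
  _⊕_ _⊖_ : Expr → Expr → Expr

data Cmd : Set where
  skip   : Cmd
  _≔_    : ℕ → Expr → Cmd
  _[_]≔_ : ℕ → Expr → Expr → Cmd
  _⨾_    : Cmd → Cmd → Cmd
  cond   : Expr → Cmd → Cmd → Cmd
  while  : Expr → Cmd → Cmd

record State : Set where
  constructor ⟪_,_⟫
  field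
    regs : ℕ → ℕ
    arrs : ℕ → ℕ → ℕ

open State public

update : {A : Set} → (ℕ → A) → ℕ → A → ℕ → A
update f x a y = if does (x ≟ y) then a else f y

⟦_⟧ : Expr → State → ℕ
⟦ lit m ⟧   σ = m
⟦ reg x ⟧   σ = regs σ x
⟦ arr a e ⟧ σ = arrs σ a (⟦ e ⟧ σ)
⟦ e ⊕ f ⟧   σ = ⟦ e ⟧ σ + ⟦ f ⟧ σ
⟦ e ⊖ f ⟧   σ = ⟦ e ⟧ σ ∸ ⟦ f ⟧ σ

-- ⟨ p , σ ⟩⇓⟨ τ , s ⟩ : started in σ, p halts in τ after s steps.
-- A test succeeds when its value is nonzero.
data ⟨_,_⟩⇓⟨_,_⟩ : Cmd → State → State → ℕ → Set where
  ⇓skip   : ∀ {σ} → ⟨ skip , σ ⟩⇓⟨ σ , 1 ⟩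
  ⇓assign : ∀ {σ x e} →
            ⟨ x ≔ e , σ ⟩⇓⟨ ⟪ update (regs σ) x (⟦ e ⟧ σ) , arrs σ ⟫ , 1 ⟩
  ⇓store  : ∀ {σ a e f} →
            ⟨ a [ e ]≔ f , σ ⟩⇓⟨ ⟪ regs σ , update (arrs σ) a (update (arrs σ a) (⟦ e ⟧ σ) (⟦ f ⟧ σ)) ⟫ , 1 ⟩
  ⇓seq    : ∀ {σ ρ τ p q s t} → ⟨ p , σ ⟩⇓⟨ ρ , s ⟩ → ⟨ q , ρ ⟩⇓⟨ τ , t ⟩ →
            ⟨ p ⨾ q , σ ⟩⇓⟨ τ , s + t ⟩
  ⇓then   : ∀ {σ τ e p q s} → ⟦ e ⟧ σ ≢ 0 → ⟨ p , σ ⟩⇓⟨ τ , s ⟩ →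
            ⟨ cond e p q , σ ⟩⇓⟨ τ , suc s ⟩
  ⇓else   : ∀ {σ τ e p q s} → ⟦ e ⟧ σ ≡ 0 → ⟨ q , σ ⟩⇓⟨ τ , s ⟩ →
            ⟨ cond e p q , σ ⟩⇓⟨ τ , suc s ⟩
  ⇓done   : ∀ {σ e p} → ⟦ e ⟧ σ ≡ 0 → ⟨ while e p , σ ⟩⇓⟨ σ , 1 ⟩
  ⇓loop   : ∀ {σ ρ τ e p s t} → ⟦ e ⟧ σ ≢ 0 → ⟨ p , σ ⟩⇓⟨ ρ , s ⟩ → ⟨ while e p , ρ ⟩⇓⟨ τ , t ⟩ →
            ⟨ while e p , σ ⟩⇓⟨ τ , suc (s + t) ⟩

-- The neighbours of a vertex may be listed in any order.
IsAdjacencyLists : ∀ {n} → Graph n → (Fin n → List (Fin n)) → Set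
IsAdjacencyLists G adj = ∀ v → Unique (adj v) × (∀ w → w ∈ adj v ⇔ E G v w)

-- Contents of a zero-initialised array into which a list is loaded.
load : List ℕ → ℕ → ℕ
load []       _       = 0
load (x ∷ xs) zero    = x
load (x ∷ xs) (suc i) = load xs i

-- Register 0 holds n and register 1 holds k.  Array 1 holds the
-- concatenated adjacency lists; that of v occupies the positions from
-- (array 0)[v] up to, but excluding, (array 0)[v + 1].
-- All other registers and cells are 0.
input : ∀ {n} → ℕ → (Fin n → List (Fin n)) → State
input {n} k adj = ⟪ load (n ∷ k ∷ []) , arrays ⟫
  where
  offsets : List ℕ
  offsets = map (λ v → sum (take v (tabulate (length ∘ adj)))) (upTo (suc n))

  arrays : ℕ → ℕ → ℕ
  arrays 0 = load offsets
  arrays 1 = load (map toℕ (concat (tabulate adj)))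
  arrays _ = λ _ → 0

-- The walk is written out in full: register 2 holds its length, and
-- array 2 its configurations C₀ , … , C_l one after another.
Outputs : ∀ {n k l} → State → (Fin (suc l) → Fin k → Fin n) → Set
Outputs {k = k} {l} τ C =
  regs τ 2 ≡ l × (∀ t i → arrs τ 2 (toℕ t * k + toℕ i) ≡ toℕ (C t i))

{-# OPTIONS --safe #-}
module Submission where

open import Defs
open import Data.Bool using (true; false; if_then_else_)
open import Data.Empty using (⊥; ⊥-elim)
open import Data.Fin using (Fin; zero; suc; toℕ; fromℕ; fromℕ<; inject₁)
open import Data.Fin.Properties using (any?; injective⇒≤; toℕ-injective; toℕ<n; toℕ-fromℕ<; fromℕ<-injective; toℕ-inject₁) renaming (_≟_ to _≟ᶠ_)
open import Data.List using (List; []; _∷_; _++_; length; map; filter; take; takeWhile; upTo; applyUpTo; allFin; tabulate; concat; cartesianProduct; lookup)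
open import Data.List.Extrema.Nat using (max; v≤max⁺; max<v⁺; min[xs]<min[ys]⁺; xs≤max)
open import Data.List.Membership.Propositional using (_∈_; _∉_; find)
open import Data.List.Membership.Propositional.Properties using (∈-filter⁺; ∈-filter⁻; ∈-cartesianProduct⁺; ∈-allFin; ∈-upTo⁺; ∈-upTo⁻; ∈-lookup; ∈-map⁻; ∈-++⁺ˡ; ∈-++⁺ʳ; ∈-++⁻; ∈-tabulate⁺)
open import Data.List.Properties using (length-map; length-upTo; length-++; length-tabulate)
open import Data.List.Relation.Binary.Infix.Heterogeneous using (Infix; here; there)
open import Data.List.Relation.Binary.Prefix.Heterogeneous using ([]; _∷_)
open import Data.List.Relation.Unary.All as All using (All; []; _∷_)
open import Data.List.Relation.Unary.All.Properties using (¬Any⇒All¬; map⁺; map⁻)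
open import Data.List.Relation.Unary.AllPairs using ([]; _∷_)
open import Data.List.Relation.Unary.Any as Any using (Any; here; there)
import Data.List.Relation.Unary.Any.Properties as Anyₚ
open import Data.List.Relation.Unary.Linked using (Linked; []; [-]; _∷_)
open import Data.List.Relation.Unary.Unique.Propositional using (Unique)
import Data.List.Relation.Unary.Unique.Propositional.Properties as Uniqueₚ
open import Data.Nat using (ℕ; zero; suc; _+_; _*_; _∸_; _⊓_; _≤_; _<_; z≤n; s≤s; _≤?_; _≟_)
open import Data.Nat.ListAction using (sum)
open import Data.Nat.Properties hiding (_≟_; _≤?_)
open import Data.Nat.Tactic.RingSolver using (solve-∀)
open import Data.Product using (∃; ∃₂; ∃!; _×_; _,_; proj₁; proj₂)
open import Data.Sum using (_⊎_; inj₁; inj₂; swap)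
open import Data.Sum.Properties using (inj₁-injective; inj₂-injective)
open import Function using (_∘_; id; case_of_; mk⇔)
open import Function.Bundles using (Equivalence)
open import Relation.Binary.Definitions using (tri<; tri≈; tri>)
open import Relation.Binary.PropositionalEquality using (_≡_; _≢_; refl; sym; trans; cong; cong₂; subst; subst₂)
open import Relation.Nullary using (¬_; Dec; yes; no; does; proof; ofʸ; ofⁿ; contradiction)
open import Relation.Nullary.Decidable using (¬?; _×-dec_; _⊎-dec_)
open import Relation.Unary using (Pred; Decidable)

-- Call an edge bideep if from either end one can walk k edges starting across it.  For a longest path P
-- with ends r and z, d(e) = 1 exactly for the bideep edges off P, and no path contains more bideep edges
-- than P does: the bideep edges of a path span at most |P| - 2(k - 1) edges, since the path can be prolonged
-- by k - 1 edges beyond its first and its last bideep edge.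
--
-- Lower bound.  Let x and y be the first and the last position of one agent.  A bideep edge pq with x and y
-- on the side of p forces all agents beyond q at some time, after which p is entered again while that agent
-- stands beyond q.  These re-entries and the first entries of the n - k vertices not occupied initially
-- happen in different steps.
--
-- Upper bound.  Two breadth-first searches find r and z.  Rooting the tree at z, let a head traverse it in
-- post-order starting from the leaf r.  Whenever the head moves to an unoccupied vertex w, evict the vertex
-- that was finished first among the occupied ones, or, if no finished vertex is occupied, the topmost occupied
-- ancestor of the head; the agents on the path from the evicted vertex to w move one step along it.  On its
-- way back from u to its parent p the head finds p unoccupied only if p was evicted, hence only if it had been
-- k edges below p; so the returns that cost a step use distinct bideep edges off the path from r to z.

-- `d` examines an edge from one end and depends on `P`; `BiDeep` is symmetric and mentions no path.
-- Only in that form can the count off `P` be compared with the count off an arbitrary pair of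
-- vertices. The comparison, `offBideep-minimal`, is used twice: an agent may start and stop
-- anywhere, and the program finds a diametral pair of its own, unrelated to the given `P`. The
-- steps of the program are never counted exactly; an upper bound for its walk and the lower bound
-- for all walks force equality. The eviction rule serves two ends. Completion order puts children
-- before parents, so the evicted vertex is a leaf of the occupied set and connectedness survives.
-- An active vertex is evicted only when all `k` agents stand on one chain above the new vertex, and
-- this makes the way down from it deep. For the running time, there are at most nΔ + n rounds after
-- the searches, so a round must cost O(k). Therefore flags and marks are increasing stamps that are
-- never cleared, and pointers towards the head are maintained by one store per head move.

-- Distances as lengths of shortest walks

module _ {p} {P : Pred ℕ p} (P? : Decidable P) where

  takeWhile-fails : ∀ (f : ℕ → ℕ) m i → i < length (takeWhile (λ j → ¬? (P? j)) (applyUpTo f m)) → ¬ P (f i)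
  takeWhile-fails f (suc m) i i<t with P? (f 0)
  takeWhile-fails f (suc m) zero    i<t       | no ¬p = ¬p
  takeWhile-fails f (suc m) (suc i) (s≤s i<t) | no ¬p = takeWhile-fails (f ∘ suc) m i i<t

  takeWhile-stops : ∀ (f : ℕ → ℕ) m i → i < m → P (f i) → P (f (length (takeWhile (λ j → ¬? (P? j)) (applyUpTo f m))))
  takeWhile-stops f (suc m) i i<m pi with does (P? (f 0)) | proof (P? (f 0))
  takeWhile-stops f (suc m) i       i<m       pi | true  | ofʸ p  = p
  takeWhile-stops f (suc m) zero    i<m       pi | false | ofⁿ ¬p = contradiction pi ¬p
  takeWhile-stops f (suc m) (suc i) (s≤s i<m) pi | false | ofⁿ ¬p = takeWhile-stops (f ∘ suc) m i i<m pi

module _ {n : ℕ} (G : Graph n) where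

  dist-walk : ∀ {u v} → Reachable G u v → Walk G u v (dist G u v)
  dist-walk {u} {v} (m , w) with m′ , m′<n , w′ ← shorten G m w =
    takeWhile-stops (walk? G u v) id n m′ m′<n w′

  dist-min : ∀ {u v m} → Walk G u v m → dist G u v ≤ m
  dist-min {u} {v} {m} w = ≮⇒≥ λ m<d → takeWhile-fails (walk? G u v) id n m m<d w

  dist<n : ∀ {u v} → Reachable G u v → dist G u v < n
  dist<n (m , w) with m′ , m′<n , w′ ← shorten G m w = ≤-<-trans (dist-min w′) m′<n

  walk-++ : ∀ {u v w a b} → Walk G u v a → Walk G v w b → Walk G u w (a + b)
  walk-++ []       q = q
  walk-++ (e ∷ p) q = e ∷ walk-++ p q

  walk-snoc : ∀ {u v w m} → Walk G u v m → E G v w → Walk G u w (suc m)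
  walk-snoc []       e = e ∷ []
  walk-snoc (f ∷ p) e = f ∷ walk-snoc p e

  walk-reverse : ∀ {u v m} → Walk G u v m → Walk G v u m
  walk-reverse []       = []
  walk-reverse (e ∷ p) = walk-snoc (walk-reverse p) (symE G e)

-- Non-backtracking walks in acyclic graphs

-- Only neighbours two apart are compared, so a list can be extended at the front by a local check.
-- In an acyclic graph this already forces all entries to be distinct.
data NonBacktracking {n} (G : Graph n) : List (Fin n) → Set where
  [-]    : ∀ {a} → NonBacktracking G (a ∷ [])
  edge   : ∀ {a b} → E G a b → NonBacktracking G (a ∷ b ∷ [])
  _,_∷ⁿ_ : ∀ {a b c xs} → E G a b → a ≢ c → NonBacktracking G (b ∷ c ∷ xs) → NonBacktracking G (a ∷ b ∷ c ∷ xs)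

module _ {n : ℕ} (G : Graph n) where

  nonBacktracking⇒linked : ∀ {xs} → NonBacktracking G xs → Linked (E G) xs
  nonBacktracking⇒linked [-]            = [-]
  nonBacktracking⇒linked (edge e)       = e ∷ [-]
  nonBacktracking⇒linked (e , _ ∷ⁿ nb) = e ∷ nonBacktracking⇒linked nb

  nonBacktracking-tail : ∀ {x y xs} → NonBacktracking G (x ∷ y ∷ xs) → NonBacktracking G (y ∷ xs)
  nonBacktracking-tail (edge _)       = [-]
  nonBacktracking-tail (_ , _ ∷ⁿ nb) = nb

  linked-prefix : ∀ {x} (y : Fin n) ys {zs} → Linked (E G) (y ∷ ys ++ x ∷ zs) → Linked (E G) (y ∷ ys ++ x ∷ [])
  linked-prefix y []       (e ∷ _) = e ∷ [-]
  linked-prefix y (a ∷ ys) (e ∷ l) = e ∷ linked-prefix a ys l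

  ∈-split : ∀ {x : Fin n} {xs} → x ∈ xs → ∃₂ λ ys zs → xs ≡ ys ++ x ∷ zs
  ∈-split (here refl) = [] , _ , refl
  ∈-split (there {x = a} x∈) with ys , zs , refl ← ∈-split x∈ = a ∷ ys , zs , refl

  -- Rotates `x` to the front, the shape in which `IsCycle` lists a cycle starting at `x`.
  unique-prefix : ∀ (x : Fin n) ys {zs} → Unique (ys ++ x ∷ zs) → Unique (x ∷ ys)
  unique-prefix x []       _        = [] ∷ []
  unique-prefix x (y ∷ ys) (p ∷ u) with q ∷ u′ ← unique-prefix x ys u =
    ((λ x≡y → ++-∷ ys p (sym x≡y)) ∷ q) ∷ (front ys p ∷ u′)
    where
    ++-∷ : ∀ ys {x zs} → All (y ≢_) (ys ++ x ∷ zs) → y ≢ x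
    ++-∷ []       (h ∷ _) = h
    ++-∷ (_ ∷ ys) (_ ∷ t) = ++-∷ ys t

    front : ∀ ys {zs} → All (y ≢_) (ys ++ zs) → All (y ≢_) ys
    front []       _       = []
    front (_ ∷ ys) (h ∷ t) = h ∷ front ys t

  -- The first return of a non-backtracking walk to its start would close a cycle.
  nonBacktracking⇒unique : Acyclic G → ∀ {xs} → NonBacktracking G xs → Unique xs
  nonBacktracking⇒unique acyclic [-] = [] ∷ []
  nonBacktracking⇒unique acyclic {x ∷ y ∷ xs} nb = extend (nonBacktracking⇒unique acyclic {y ∷ xs} (nonBacktracking-tail nb))
    where
    no-return : ∀ {xs} → Unique xs → NonBacktracking G (x ∷ xs) → ∀ ys {zs} → xs ≡ ys ++ x ∷ zs → ⊥
    -- With nothing before the return there would be a loop, with one vertex an immediate reversal;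
    -- any longer stretch is a cycle.
    no-return u nb []                refl with nonBacktracking⇒linked nb
    ... | e ∷ _ = irrefl G refl e
    no-return u (_ , x≢ ∷ⁿ _) (a ∷ [])         refl = x≢ refl
    no-return u nb            (a ∷ b ∷ ys) refl =
      acyclic x (a ∷ b ∷ ys)
        (s≤s (s≤s z≤n) , unique-prefix x (a ∷ b ∷ ys) u , linked-prefix x (a ∷ b ∷ ys) (nonBacktracking⇒linked nb))

    extend : Unique (y ∷ xs) → Unique (x ∷ y ∷ xs)
    extend u = All.tabulate fresh ∷ u
      where
      fresh : ∀ {v} → v ∈ y ∷ xs → x ≢ v
      fresh v∈ refl with ys , zs , eq ← ∈-split v∈ = no-return u nb ys eq

-- Metric geometry of a tree

module Metric {n : ℕ} (G : Graph n) (tree : IsTree G) where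

  abstract
    -- Sealed: beyond `geodesic`, `δ-min`, `δ<n` and the bridge `δ≡dist`, nothing about the
    -- computation of distances is used.
    δ : Fin n → Fin n → ℕ
    δ = dist G

    δ≡dist : ∀ u v → δ u v ≡ dist G u v
    δ≡dist u v = refl

    geodesic : ∀ u v → Walk G u v (δ u v)
    geodesic u v = dist-walk G (proj₁ tree u v)

    δ-min : ∀ {u v m} → Walk G u v m → δ u v ≤ m
    δ-min = dist-min G

    δ<n : ∀ u v → δ u v < n
    δ<n u v = dist<n G (proj₁ tree u v)

  δ-refl : ∀ u → δ u u ≡ 0
  δ-refl u = n≤0⇒n≡0 (δ-min [])

  δ≡0⇒≡ : ∀ {u v} → δ u v ≡ 0 → u ≡ v
  δ≡0⇒≡ {u} {v} eq with δ u v | geodesic u v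
  δ≡0⇒≡ refl | _ | [] = refl

  δ-sym : ∀ u v → δ u v ≡ δ v u
  δ-sym u v = ≤-antisym (δ-min (walk-reverse G (geodesic v u))) (δ-min (walk-reverse G (geodesic u v)))

  δ-triangle : ∀ u v w → δ u w ≤ δ u v + δ v w
  δ-triangle u v w = δ-min (walk-++ G (geodesic u v) (geodesic v w))

  δ-step : ∀ {a b} h → E G a b → δ a h ≤ suc (δ b h)
  δ-step {b = b} h e = δ-min (e ∷ geodesic b h)

  E⇒δ≡1 : ∀ {a b} → E G a b → δ a b ≡ 1
  E⇒δ≡1 {a} {b} e with δ a b in eq
  ... | zero        = contradiction e (irrefl G (δ≡0⇒≡ eq))
  ... | suc zero    = refl
  ... | suc (suc m) with s≤s () ← subst (_≤ 1) eq (δ-min (e ∷ []))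

  private
    firstStep : ∀ {u v m} → Walk G u v m → Fin n
    firstStep {u} []        = u
    firstStep (_∷_ {w = w} _ _) = w

  abstract
    -- The neighbour of v towards h; par h h = h is a junk value.
    par : Fin n → Fin n → Fin n
    par h v = firstStep (geodesic v h)

    par-self : ∀ h → par h h ≡ h
    par-self h = go (geodesic h h) (δ-refl h)
      where
      go : ∀ {v m} (w : Walk G v h m) → m ≡ 0 → firstStep w ≡ v
      go [] _ = refl

    par-correct : ∀ h v → v ≢ h → E G v (par h v) × δ v h ≡ suc (δ (par h v) h)
    par-correct h v v≢h = go (geodesic v h) refl
      where
      go : ∀ {m} (w : Walk G v h m) → m ≡ δ v h → E G v (firstStep w) × δ v h ≡ suc (δ (firstStep w) h)
      go []      _  = contradiction refl v≢h
      go (e ∷ w) eq = e , ≤-antisym (δ-step h e) (≤-trans (s≤s (δ-min w)) (≤-reflexive eq))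

  E-par : ∀ {h v} → v ≢ h → E G v (par h v)
  E-par v≢h = proj₁ (par-correct _ _ v≢h)

  δ-par : ∀ {h v} → v ≢ h → δ v h ≡ suc (δ (par h v) h)
  δ-par v≢h = proj₂ (par-correct _ _ v≢h)

  E⇒≢ : ∀ {a b} → E G a b → a ≢ b
  E⇒≢ e a≡b = irrefl G a≡b e

  private
    Descent : Fin n → Fin n → Set
    Descent h b = ∃ λ xs → h ∈ b ∷ xs × NonBacktracking G (b ∷ xs) × All (λ c → δ c h < δ b h) xs

    -- Iterating `par h` lowers the distance to `h` at every step, so the list cannot turn back.
    descent : ∀ h b m → δ b h ≡ m → Descent h b
    descent h b zero    eq with refl ← δ≡0⇒≡ eq = [] , here refl , [-] , []
    descent h b (suc m) eq with b ≟ᶠ h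
    ... | yes refl = [] , here refl , [-] , []
    ... | no b≢h with descent h (par h b) m (suc-injective (trans (sym (δ-par b≢h)) eq))
    ... | xs , h∈ , nb , lower = par h b ∷ xs , there h∈ , extend nb lower , below ∷ All.map (λ l → <-trans l below) lower
      where
      below : δ (par h b) h < δ b h
      below = ≤-reflexive (sym (δ-par b≢h))

      extend : ∀ {xs} → NonBacktracking G (par h b ∷ xs) → All (λ c → δ c h < δ (par h b) h) xs → NonBacktracking G (b ∷ par h b ∷ xs)
      extend {[]}     _  _       = edge (E-par b≢h)
      extend {c ∷ xs} nb (l ∷ _) = E-par b≢h , (λ { refl → <-asym l below }) ∷ⁿ nb

    -- A non-backtracking list can be continued backwards to h; if it also contains h, it repeats h.
    no-loop : ∀ h m a b xs → δ a h ≡ m → δ a h ≤ δ b h → h ∈ b ∷ xs → NonBacktracking G (a ∷ b ∷ xs) → ⊥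
    no-loop h m a b xs eq a≤b h∈ nb with a ≟ᶠ h
    no-loop h m a b xs eq a≤b h∈ nb | yes refl with p ∷ _ ← nonBacktracking⇒unique G (proj₂ tree) nb = All.lookup p h∈ refl
    no-loop h zero a b xs eq a≤b h∈ nb | no a≢h = a≢h (δ≡0⇒≡ eq)
    no-loop h (suc m) a b xs eq a≤b h∈ nb | no a≢h =
      no-loop h m (par h a) a (b ∷ xs) (suc-injective (trans (sym (δ-par a≢h)) eq)) (<⇒≤ below) (there h∈)
        (symE G (E-par a≢h) , (λ { refl → <⇒≱ below a≤b }) ∷ⁿ nb)
      where
      below : δ (par h a) h < δ a h
      below = ≤-reflexive (sym (δ-par a≢h))

  -- A second neighbour `a` of `v` closer to `h` would yield the non-backtracking list `a`, `v`,
  -- `par h v`, and so on down to `h`, whose first vertex is closer to `h` than its second;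
  -- `no-loop` excludes it.
  par-unique : ∀ {h v a} → E G v a → δ v h ≡ suc (δ a h) → a ≡ par h v
  par-unique {h} {v} {a} e eq with a ≟ᶠ par h v
  ... | yes a≡p = a≡p
  ... | no a≢p with v ≟ᶠ h
  ...   | yes refl with () ← trans (sym (δ-refl v)) eq
  ...   | no v≢h with descent h (par h v) _ refl
  ...     | xs , h∈ , nb , lower = ⊥-elim (no-loop h _ a v (par h v ∷ xs) refl (<⇒≤ (≤-reflexive (sym eq))) (there h∈)
                                     (symE G e , a≢p ∷ⁿ extend nb lower))
    where
    extend : ∀ {xs} → NonBacktracking G (par h v ∷ xs) → All (λ c → δ c h < δ (par h v) h) xs → NonBacktracking G (v ∷ par h v ∷ xs)
    extend {[]}     _  _       = edge (E-par v≢h)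
    extend {c ∷ xs} nb (l ∷ _) = E-par v≢h , (λ { refl → <⇒≱ l (≤-trans (n≤1+n _) (≤-reflexive (sym (δ-par v≢h)))) }) ∷ⁿ nb

  private
    -- Trees are bipartite: if `a` and `b` were equally far from `h`, then `a` put before the
    -- descent from `b` would still be non-backtracking, against `no-loop`.
    E⇒δ≢ : ∀ {a b} h → E G a b → δ a h ≢ δ b h
    E⇒δ≢ {a} {b} h e eq with descent h b _ refl
    ... | xs , h∈ , nb , lower = no-loop h _ a b xs refl (≤-reflexive eq) h∈ (extend nb lower)
      where
      extend : ∀ {xs} → NonBacktracking G (b ∷ xs) → All (λ c → δ c h < δ b h) xs → NonBacktracking G (a ∷ b ∷ xs)
      extend {[]}     _  _       = edge e
      extend {c ∷ xs} nb (l ∷ _) = e , (λ { refl → <-irrefl eq l }) ∷ⁿ nb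

  -- w lies on the v-side of the edge pv.
  Side : Fin n → Fin n → Fin n → Set
  Side p v w = δ p w ≡ suc (δ v w)

  side-total : ∀ {p v} → E G p v → ∀ w → Side p v w ⊎ Side v p w
  side-total {p} {v} e w with <-cmp (δ p w) (δ v w)
  ... | tri< l _ _ = inj₂ (≤-antisym (δ-step w (symE G e)) l)
  ... | tri≈ _ q _ = contradiction q (E⇒δ≢ w e)
  ... | tri> _ _ g = inj₁ (≤-antisym (δ-step w e) g)

  side-asym : ∀ {p v w} → Side p v w → ¬ Side v p w
  side-asym {p} {v} {w} s t = <-asym (≤-reflexive (sym s)) (≤-reflexive (sym t))

  side-self : ∀ {p v} → E G p v → Side p v v
  side-self {p} {v} e = trans (E⇒δ≡1 e) (cong suc (sym (δ-refl v)))

  side-par : ∀ {h v} → v ≢ h → Side v (par h v) h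
  side-par = δ-par

  -- An edge ab from the v-side of pv to its p-side is pv itself: otherwise the step
  -- from a towards v would be b, which is farther from v.
  side-cross : ∀ {p v a b} → E G p v → E G a b → Side p v a → Side v p b → a ≡ v × b ≡ p
  side-cross {p} {v} {a} {b} pv ab sa sb with a ≟ᶠ v
  ... | yes refl = refl , δ≡0⇒≡ (trans (δ-sym b p) (suc-injective (trans (sym sb) (trans (δ-sym v b) (E⇒δ≡1 (symE G ab))))))
  ... | no a≢v = ⊥-elim (m≢2+m _ (subst (λ x → δ x v ≡ suc (suc (δ c v))) b≡c farther))
    where
    m≢2+m : ∀ m → m ≢ suc (suc m)
    m≢2+m zero    ()
    m≢2+m (suc m) eq = m≢2+m m (suc-injective eq)

    c : Fin n
    c = par v a

    pa≤ : δ a p ≤ suc (δ b p)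
    pa≤ = δ-step p ab

    vb≤ : δ b v ≤ suc (δ a v)
    vb≤ = δ-step v (symE G ab)

    a-p : δ a p ≡ suc (δ a v)
    a-p = trans (δ-sym a p) (trans sa (cong suc (δ-sym v a)))

    b-v : δ b v ≡ suc (δ b p)
    b-v = trans (δ-sym b v) (trans sb (cong suc (δ-sym p b)))

    bp≡av : δ b p ≡ δ a v
    bp≡av = ≤-antisym (≤-pred (≤-trans (≤-reflexive (sym b-v)) vb≤)) (≤-pred (≤-trans (≤-reflexive (sym a-p)) pa≤))

    c-p : δ a p ≡ suc (δ c p)
    c-p = ≤-antisym (δ-step p (E-par a≢v))
      (≤-trans (s≤s (≤-trans (δ-triangle c v p) (≤-trans (≤-reflexive (cong (δ c v +_) (E⇒δ≡1 (symE G pv))))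
        (≤-reflexive (trans (+-comm (δ c v) 1) (sym (δ-par a≢v))))))) (≤-reflexive (sym a-p)))

    b≡c : b ≡ c
    b≡c = trans (par-unique ab (trans a-p (cong suc (sym bp≡av)))) (sym (par-unique (E-par a≢v) c-p))

    farther : δ b v ≡ suc (suc (δ c v))
    farther = trans b-v (cong suc (trans bp≡av (δ-par a≢v)))

  -- Any walk from `a` to `b` changes sides somewhere, and by `side-cross` it does so along the edge
  -- from `v` to `p`.
  side-through : ∀ {p v a b} → E G p v → Side p v a → Side v p b → δ a b ≡ δ a v + suc (δ p b)
  side-through {p} {v} {a} {b} pv sa sb = ≤-antisym upper (lower (geodesic a b) sa)
    where
    upper : δ a b ≤ δ a v + suc (δ p b)
    upper = ≤-trans (δ-triangle a v b) (+-monoʳ-≤ (δ a v) (≤-reflexive sb))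

    lower : ∀ {a m} → Walk G a b m → Side p v a → δ a v + suc (δ p b) ≤ m
    lower []      sa = ⊥-elim (side-asym sa sb)
    lower {a} (_∷_ {w = a′} e w) sa with side-total pv a′
    ... | inj₁ sa′ = ≤-trans (+-monoˡ-≤ _ (δ-step v e)) (s≤s (lower w sa′))
    ... | inj₂ sp with refl , refl ← side-cross pv e sa sp rewrite δ-refl v = s≤s (δ-min w)

  -- The first edge from `v` towards `u` also separates `v` from `w`, unless it is the edge `uw`
  -- itself. Hence a move of the head along `uw` leaves the direction towards it unchanged
  -- everywhere except at `u` and `w`.
  par-reroot : ∀ {u w v} → E G u w → v ≢ u → v ≢ w → par w v ≡ par u v
  par-reroot {u} {w} {v} uw v≢u v≢w with side-total (E-par v≢u) w
  ... | inj₁ s = sym (par-unique (E-par v≢u) s)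
  ... | inj₂ s = contradiction (sym (proj₂ (side-cross (E-par v≢u) uw (side-par v≢u) s))) v≢w

  par-adjacent : ∀ {u w} → E G u w → par w u ≡ w
  par-adjacent e = sym (par-unique e (side-self e))

  -- The median of three vertices of a tree: walk from `x` towards `y` for as long as this also
  -- approaches `a`.
  median : ∀ x y a → ∃ λ t → δ x y ≡ δ x t + δ t y × δ a x ≡ δ a t + δ t x × δ a y ≡ δ a t + δ t y
  median x y a = go (δ x y) x refl
    where
    go : ∀ m x → δ x y ≡ m → ∃ λ t → δ x y ≡ δ x t + δ t y × δ a x ≡ δ a t + δ t x × δ a y ≡ δ a t + δ t y
    here-is : ∀ x → δ a y ≡ δ a x + δ x y → ∃ λ t → δ x y ≡ δ x t + δ t y × δ a x ≡ δ a t + δ t x × δ a y ≡ δ a t + δ t y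
    here-is x eq = x , cong (_+ δ x y) (sym (δ-refl x)) , trans (sym (+-identityʳ _)) (cong (δ a x +_) (sym (δ-refl x))) , eq
    go zero    x eq with refl ← δ≡0⇒≡ eq = here-is x (trans (sym (+-identityʳ _)) (cong (δ a x +_) (sym (δ-refl x))))
    go (suc m) x eq with x ≟ᶠ y
    ... | yes refl = here-is x (trans (sym (+-identityʳ _)) (cong (δ a x +_) (sym (δ-refl x))))
    ... | no x≢y with side-total (E-par x≢y) a
    ...   | inj₂ s = here-is x (trans (side-through (symE G (E-par x≢y)) s (side-par x≢y)) (cong (δ a x +_) (sym (δ-par x≢y))))
    ...   | inj₁ s with t , p , q , r ← go m (par y x) (suc-injective (trans (sym (δ-par x≢y)) eq)) =
      t , trans (δ-par x≢y) (trans (cong suc p) (cong (_+ δ t y) (sym xt))) , trans ax (trans (cong suc q) (trans (sym (+-suc _ _)) (cong (δ a t +_) tx))) , r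
      where
      c : Fin n
      c = par y x
      ax : δ a x ≡ suc (δ a c)
      ax = trans (δ-sym a x) (trans s (cong suc (δ-sym c a)))
      xt : δ x t ≡ suc (δ c t)
      xt = ≤-antisym (δ-step t (E-par x≢y))
             (+-cancelʳ-≤ (δ t y) _ _ (≤-trans (≤-reflexive (trans (cong suc (sym p)) (sym (δ-par x≢y)))) (δ-triangle x t y)))
      tx : suc (δ t c) ≡ δ t x
      tx = trans (cong suc (δ-sym t c)) (trans (sym xt) (δ-sym x t))

  -- Unless `t` is an end, `x` and `y` lie in different components of the tree without `t`, and `a`
  -- cannot be in both.
  between-branch : ∀ {x y t} → δ x y ≡ δ x t + δ t y → ∀ a → δ a x ≡ δ a t + δ t x ⊎ δ a y ≡ δ a t + δ t y
  between-branch {x} {y} {t} xty a with x ≟ᶠ t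
  ... | yes refl = inj₁ (trans (sym (+-identityʳ _)) (cong (δ a t +_) (sym (δ-refl t))))
  ... | no x≢t with t ≟ᶠ x
  ...   | yes refl = contradiction refl x≢t
  ...   | no t≢x with side-total (E-par t≢x) a
  ...     | inj₂ s = inj₁ (trans (side-through (symE G (E-par t≢x)) s (side-par t≢x)) (cong (δ a t +_) (sym (δ-par t≢x))))
  ...     | inj₁ s with side-total (E-par t≢x) y
  ...       | inj₂ sy = inj₂ (trans (trans (side-through (E-par t≢x) s sy) (+-suc _ _))
                 (cong (_+ δ t y) (sym (trans (δ-sym a t) (trans s (cong suc (δ-sym _ a)))))))
  ...       | inj₁ sy = contradiction (≤-trans (≤-reflexive (sym xty)) (δ-triangle x c y)) (<⇒≱ shorter)
    where
    c : Fin n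
    c = par x t
    shorter : δ x c + δ c y < δ x t + δ t y
    shorter = +-mono-<-≤ (≤-reflexive (trans (cong suc (δ-sym x c)) (trans (sym (δ-par t≢x)) (δ-sym t x))))
                         (≤-trans (n≤1+n _) (≤-reflexive (sym sy)))

  -- Correctness of the double search. Let `t` be the median of `x`, `y` and `a`. Since `z` is
  -- farthest from `a`, it is at least as far from `t` as `x` and `y` are. By `between-branch` the
  -- path from `z` to `x` or to `y` passes through `t`, so exchanging the other end for `z` does not
  -- shorten the path, and `r` is farthest from `z`.
  farthest-diametral : ∀ {a z r} → (∀ v → δ a v ≤ δ a z) → (∀ v → δ z v ≤ δ z r) → ∀ x y → δ x y ≤ δ r z
  farthest-diametral {a} {z} {r} far-a far-z x y with t , xty , atx , aty ← median x y a = case between-branch xty z of λ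
    { (inj₁ ztx) → bound (begin
        δ x y           ≡⟨ xty ⟩
        δ x t + δ t y   ≤⟨ +-mono-≤ (≤-reflexive (δ-sym x t)) (ty≤tz aty) ⟩
        δ t x + δ t z   ≡⟨ trans (+-comm (δ t x) _) (cong (_+ δ t x) (δ-sym t z)) ⟩
        δ z t + δ t x   ≡⟨ sym ztx ⟩
        δ z x           ∎)
    ; (inj₂ zty) → bound (begin
        δ x y           ≡⟨ xty ⟩
        δ x t + δ t y   ≤⟨ +-monoˡ-≤ _ (≤-trans (≤-reflexive (δ-sym x t)) (ty≤tz atx)) ⟩
        δ t z + δ t y   ≡⟨ cong (_+ δ t y) (δ-sym t z) ⟩
        δ z t + δ t y   ≡⟨ sym zty ⟩
        δ z y           ∎) }
    where
    open ≤-Reasoning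
    ty≤tz : ∀ {y t} → δ a y ≡ δ a t + δ t y → δ t y ≤ δ t z
    ty≤tz {y} {t} eq = +-cancelˡ-≤ (δ a t) _ _ (≤-trans (≤-reflexive (sym eq)) (≤-trans (far-a y) (δ-triangle a t z)))
    bound : ∀ {m v} → m ≤ δ z v → m ≤ δ r z
    bound {v = v} p = ≤-trans p (≤-trans (far-z v) (≤-reflexive (δ-sym z r)))

-- Ancestors in the rooted tree

module Rooted {n : ℕ} (G : Graph n) (tree : IsTree G) (z : Fin n) where

  open Metric G tree

  dep : Fin n → ℕ
  dep v = δ v z

  parent : Fin n → Fin n
  parent = par z

  -- The chain climbs from the descendant. The guard `u ≢ z` keeps out the junk value
  -- `parent z = z`.
  data Anc (v : Fin n) : Fin n → Set where
    self  : Anc v v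
    below : ∀ {u} → u ≢ z → Anc v (parent u) → Anc v u

  dep-parent : ∀ {v} → v ≢ z → dep v ≡ suc (dep (parent v))
  dep-parent = δ-par

  parent≢ : ∀ {v} → v ≢ z → parent v ≢ v
  parent≢ v≢z = E⇒≢ (symE G (E-par v≢z))

  dep-suc⇒≢root : ∀ {v m} → dep v ≡ suc m → v ≢ z
  dep-suc⇒≢root eq refl = contradiction (trans (sym (δ-refl z)) eq) λ ()

  child : ∀ {v w} → E G v w → w ≢ parent v → w ≢ z × parent w ≡ v
  child {v} {w} e w≢ with side-total e z
  ... | inj₁ s = contradiction (par-unique e s) w≢
  ... | inj₂ s = dep-suc⇒≢root s , sym (par-unique (symE G e) s)

  edge-parent : ∀ {v w} → E G v w → (v ≢ z × parent v ≡ w) ⊎ (w ≢ z × parent w ≡ v)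
  edge-parent {v} {w} e with side-total e z
  ... | inj₁ s = inj₁ (dep-suc⇒≢root s , sym (par-unique e s))
  ... | inj₂ s = inj₂ (dep-suc⇒≢root s , sym (par-unique (symE G e) s))

  anc-up : ∀ {v u} → Anc v u → v ≢ u → Anc v (parent u)
  anc-up self        v≢u = contradiction refl v≢u
  anc-up (below _ a) _   = a

  anc-dep : ∀ {v u} → Anc v u → dep v ≤ dep u
  anc-dep self          = ≤-refl
  anc-dep (below u≢z a) = ≤-trans (anc-dep a) (≤-trans (n≤1+n _) (≤-reflexive (sym (dep-parent u≢z))))

  anc-dep< : ∀ {v u} → Anc v u → v ≢ u → dep v < dep u
  anc-dep< self          v≢u = contradiction refl v≢u
  anc-dep< (below u≢z a) _   = ≤-trans (s≤s (anc-dep a)) (≤-reflexive (sym (dep-parent u≢z)))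

  anc-antisym : ∀ {v u} → Anc v u → dep u ≤ dep v → v ≡ u
  anc-antisym {v} {u} a d≤ with v ≟ᶠ u
  ... | yes eq = eq
  ... | no v≢u = contradiction d≤ (<⇒≱ (anc-dep< a v≢u))

  anc-parent : ∀ {v u} → v ≢ z → Anc v u → Anc (parent v) u
  anc-parent v≢z self        = below v≢z self
  anc-parent v≢z (below q a) = below q (anc-parent v≢z a)

  anc-unique : ∀ {u v w} → Anc u w → Anc v w → dep u ≡ dep v → u ≡ v
  anc-unique self        b           eq = sym (anc-antisym b (≤-reflexive eq))
  anc-unique (below q a) self        eq = anc-antisym (below q a) (≤-reflexive (sym eq))
  anc-unique (below _ a) (below _ b) eq = anc-unique a b eq

  anc-trans : ∀ {u v w} → Anc u v → Anc v w → Anc u w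
  anc-trans a self        = a
  anc-trans a (below q b) = below q (anc-trans a b)

  anc-linear : ∀ {u v w} → Anc u w → Anc v w → dep u ≤ dep v → Anc u v
  anc-linear a           self        _  = a
  anc-linear (below _ a) (below _ b) d≤ = anc-linear a b d≤
  anc-linear self        (below q b) d≤ = subst (Anc _) (sym (anc-antisym (below q b) d≤)) self

  -- The subtree below `v` is the `v`-side of the edge to its parent. Together with `side⇒anc` this
  -- translates between the order and the metric.
  anc⇒side : ∀ {v u} → v ≢ z → Anc v u → Side (parent v) v u
  anc⇒side v≢z self = side-self (symE G (E-par v≢z))
  anc⇒side {v} {u} v≢z (below u≢z a) with side-total (symE G (E-par v≢z)) u
  ... | inj₁ s = s
  ... | inj₂ s with side-cross (symE G (E-par v≢z)) (symE G (E-par u≢z)) (anc⇒side v≢z a) s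
  ... | pu≡v , u≡pv = contradiction (anc-dep a)
    (<⇒≱ (≤-trans (≤-reflexive (sym (dep-parent u≢z)))
      (≤-trans (≤-reflexive (cong dep u≡pv)) (≤-trans (n≤1+n _) (≤-reflexive (sym (dep-parent v≢z)))))))

  side⇒anc : ∀ {v u} → v ≢ z → Side (parent v) v u → Anc v u
  side⇒anc {v} {u} v≢z = go (dep u) u refl
    where
    go : ∀ m u → dep u ≡ m → Side (parent v) v u → Anc v u
    go m u eq s with u ≟ᶠ v | u ≟ᶠ z
    ... | yes refl | _        = self
    ... | no _     | yes refl = ⊥-elim (side-asym s (side-par v≢z))
    go zero u eq s    | no u≢v | no u≢z = contradiction (δ≡0⇒≡ eq) u≢z
    go (suc m) u eq s | no u≢v | no u≢z with side-total (symE G (E-par v≢z)) (parent u)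
    ... | inj₁ s′ = below u≢z (go m (parent u) (suc-injective (trans (sym (dep-parent u≢z)) eq)) s′)
    ... | inj₂ s′ = contradiction (proj₁ (side-cross (symE G (E-par v≢z)) (E-par u≢z) s s′)) u≢v

  anc-root : ∀ u → Anc z u
  anc-root u = go (dep u) u refl
    where
    go : ∀ m u → dep u ≡ m → Anc z u
    go zero u eq with refl ← δ≡0⇒≡ eq = self
    go (suc m) u eq = below u≢z (go m (parent u) (suc-injective (trans (sym (dep-parent u≢z)) eq)))
      where
      u≢z : u ≢ z
      u≢z = dep-suc⇒≢root eq

  anc-step : ∀ {v w} → Anc v w → v ≢ w → par w v ≢ z × parent (par w v) ≡ v × Anc (par w v) w
  anc-step self v≢w = contradiction refl v≢w
  anc-step {v} {w} (below w≢z a) v≢w with v ≟ᶠ parent w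
  ... | yes refl rewrite par-adjacent (symE G (E-par w≢z)) = w≢z , refl , self
  ... | no v≢pw with anc-step a v≢pw
  ... | c≢z , pc≡v , c-anc rewrite par-reroot (symE G (E-par w≢z)) v≢pw v≢w = c≢z , pc≡v , below w≢z c-anc

  anc-step-dep : ∀ {v w} → Anc v w → v ≢ w → dep (par w v) ≡ suc (dep v)
  anc-step-dep a v≢w with c≢z , pc≡v , _ ← anc-step a v≢w = trans (dep-parent c≢z) (cong (suc ∘ dep) pc≡v)

-- Separating, deep and bideep edges

module Separation {n : ℕ} (G : Graph n) (tree : IsTree G) where

  open Metric G tree

  -- The edge uv separates x from y.
  Sep : Fin n → Fin n → Fin n → Fin n → Set
  Sep x y u v = (Side v u x × Side u v y) ⊎ (Side u v x × Side v u y)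

  sep? : ∀ x y u v → Dec (Sep x y u v)
  sep? x y u v = (δ v x ≟ suc (δ u x) ×-dec δ u y ≟ suc (δ v y)) ⊎-dec (δ u x ≟ suc (δ v x) ×-dec δ v y ≟ suc (δ u y))

  ¬sep⇒same-side : ∀ {x y u v} → E G u v → ¬ Sep x y u v → (Side u v x × Side u v y) ⊎ (Side v u x × Side v u y)
  ¬sep⇒same-side {x} {y} e ¬s with side-total e x | side-total e y
  ... | inj₁ a | inj₁ b = inj₁ (a , b)
  ... | inj₂ a | inj₂ b = inj₂ (a , b)
  ... | inj₁ a | inj₂ b = contradiction (inj₂ (a , b)) ¬s
  ... | inj₂ a | inj₁ b = contradiction (inj₁ (a , b)) ¬s

  Diametral : Fin n → Fin n → Set
  Diametral r z = ∀ x y → δ x y ≤ δ r z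

  module _ (κ : ℕ) where

    -- With κ = k - 1: the v-side of the edge pv contains a vertex at distance at least k from p.
    Deep : Fin n → Fin n → Set
    Deep p v = ∃ λ w → Side p v w × κ ≤ δ v w

    BiDeep : Fin n → Fin n → Set
    BiDeep u v = Deep u v × Deep v u

    bideep? : ∀ u v → Dec (BiDeep u v)
    bideep? u v = deep? u v ×-dec deep? v u
      where
      deep? : ∀ p v → Dec (Deep p v)
      deep? p v = any? λ w → δ p w ≟ suc (δ v w) ×-dec κ ≤? δ v w

    -- Replacing the part of the diametral path on the way from `o` to `r` by the way through `f` to
    -- `w` cannot produce a distance above `δ r z`, so `r` is farther from `o` than `w` is from `f`.
    -- Thus the one-sided depth tested by `d` implies depth from both ends.
    deep-opposite : ∀ {r z o f} → Diametral r z → E G o f → Side f o r → Side f o z → Deep o f → Deep f o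
    deep-opposite {r} {z} {o} {f} diam e sr sz (w , sw , κ≤) = r , sr , ≤-trans κ≤ (<⇒≤ fw<or)
      where
      open ≤-Reasoning
      fw<or : δ f w < δ o r
      fw<or = +-cancelʳ-≤ (δ o z) _ _ (begin
        suc (δ f w) + δ o z ≡⟨ trans (sym (+-suc (δ f w) _)) (cong (_+ suc (δ o z)) (δ-sym f w)) ⟩
        δ w f + suc (δ o z) ≡⟨ sym (side-through e sw sz) ⟩
        δ w z               ≤⟨ diam w z ⟩
        δ r z               ≤⟨ δ-triangle r o z ⟩
        δ r o + δ o z       ≡⟨ cong (_+ δ o z) (δ-sym r o) ⟩
        δ o r + δ o z       ∎)

-- Counting with duplicate-free lists

module _ {A : Set} where

  lookup-injective : ∀ {xs : List A} → Unique xs → ∀ i j → lookup xs i ≡ lookup xs j → i ≡ j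
  lookup-injective (_ ∷ _) zero    zero    _  = refl
  lookup-injective (p ∷ _) zero    (suc j) eq = contradiction eq (All.lookup p (∈-lookup j))
  lookup-injective (p ∷ _) (suc i) zero    eq = contradiction (sym eq) (All.lookup p (∈-lookup i))
  lookup-injective (_ ∷ u) (suc i) (suc j) eq = cong suc (lookup-injective u i j eq)

  unique⊆⇒length≤ : ∀ {xs ys : List A} → Unique xs → (∀ {x} → x ∈ xs → x ∈ ys) → length xs ≤ length ys
  unique⊆⇒length≤ {xs} {ys} u sub = injective⇒≤ {f = λ i → Any.index (sub (∈-lookup i))} λ {i} {j} eq →
    lookup-injective u i j (trans (Anyₚ.lookup-index (sub (∈-lookup i)))
      (trans (cong (lookup ys) eq) (sym (Anyₚ.lookup-index (sub (∈-lookup j))))))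

  module _ {p} {P : Pred A p} (P? : Decidable P) where

    sum-indicator : ∀ (f : A → ℕ) xs → (∀ {x} → x ∈ xs → (P x → f x ≡ 1) × (¬ P x → f x ≡ 0)) →
                    sum (map f xs) ≡ length (filter P? xs)
    sum-indicator f []       h = refl
    sum-indicator f (x ∷ xs) h with does (P? x) | proof (P? x)
    ... | true  | ofʸ px = cong₂ _+_ (proj₁ (h (here refl)) px) (sum-indicator f xs (h ∘ there))
    ... | false | ofⁿ ¬p = cong₂ _+_ (proj₂ (h (here refl)) ¬p) (sum-indicator f xs (h ∘ there))

    length-filter-split : ∀ {q} {Q : Pred A q} (Q? : Decidable Q) xs →
      length (filter (λ x → P? x ×-dec Q? x) xs) + length (filter (λ x → P? x ×-dec ¬? (Q? x)) xs) ≡ length (filter P? xs)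
    length-filter-split Q? []       = refl
    length-filter-split Q? (x ∷ xs) with does (P? x) | does (Q? x)
    ... | true  | true  = cong suc (length-filter-split Q? xs)
    ... | true  | false = trans (+-suc _ _) (cong suc (length-filter-split Q? xs))
    ... | false | true  = length-filter-split Q? xs
    ... | false | false = length-filter-split Q? xs

  unique-map-on : ∀ {B : Set} (f : A → B) {xs} → (∀ {x y} → x ∈ xs → y ∈ xs → f x ≡ f y → x ≡ y) → Unique xs → Unique (map f xs)
  unique-map-on f inj []       = []
  unique-map-on f {x ∷ xs} inj (p ∷ u) = All.tabulate fresh ∷ unique-map-on f (λ a b → inj (there a) (there b)) u
    where
    fresh : ∀ {b} → b ∈ map f xs → f x ≢ b
    fresh b∈ eq with y , y∈ , refl ← ∈-map⁻ f b∈ = All.lookup p y∈ (inj (here refl) (there y∈) eq)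

minimum : ∀ (x : ℕ) xs → ∃ λ m → m ∈ x ∷ xs × (∀ {a} → a ∈ x ∷ xs → m ≤ a)
minimum x [] = x , here refl , λ { (here refl) → ≤-refl }
minimum x (y ∷ ys) with minimum y ys
... | m , m∈ , low with ≤-total x m
...   | inj₁ x≤m = x , here refl , λ { (here refl) → ≤-refl ; (there a∈) → ≤-trans x≤m (low a∈) }
...   | inj₂ m≤x = m , there m∈ , λ { (here refl) → m≤x ; (there a∈) → low a∈ }

-- Subtracting the minimum maps the entries injectively to numbers below `K`.
unique-window : ∀ {xs K} → Unique xs → (∀ {a b} → a ∈ xs → b ∈ xs → a < b + K) → length xs ≤ K
unique-window {[]}     _ _ = z≤n
unique-window {x ∷ xs} {K} u close with m , m∈ , low ← minimum x xs =
  subst₂ _≤_ (length-map (_∸ m) (x ∷ xs)) (length-upTo K)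
    (unique⊆⇒length≤ (unique-map-on (_∸ m) (λ a∈ b∈ eq → ∸-cancelʳ-≡ (low a∈) (low b∈) eq) u) λ c∈ →
      case ∈-map⁻ (_∸ m) c∈ of λ { (a , a∈ , refl) → ∈-upTo⁺ (+-cancelˡ-< m _ _ (subst (_< m + K) (sym (m+[n∸m]≡n (low a∈))) (close a∈ m∈))) })

-- Unordered edges and their listed orientation

module Edges {n : ℕ} (G : Graph n) where

  edges-unique : Unique (edges G)
  edges-unique = Uniqueₚ.filter⁺ _ (Uniqueₚ.cartesianProduct⁺ (Uniqueₚ.allFin⁺ n) (Uniqueₚ.allFin⁺ n))

  ∈-edges⁻ : ∀ {u v} → (u , v) ∈ edges G → toℕ u < toℕ v × E G u v
  ∈-edges⁻ e∈ = proj₂ (∈-filter⁻ _ {xs = cartesianProduct (allFin n) (allFin n)} e∈)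

  orient : Fin n → Fin n → Fin n × Fin n
  orient u v = if does (toℕ u ≤? toℕ v) then (u , v) else (v , u)

  orient-cases : ∀ u v → orient u v ≡ (u , v) ⊎ orient u v ≡ (v , u)
  orient-cases u v with does (toℕ u ≤? toℕ v)
  ... | true  = inj₁ refl
  ... | false = inj₂ refl

  orient-∈ : ∀ {u v} → E G u v → orient u v ∈ edges G
  orient-∈ {u} {v} e with does (toℕ u ≤? toℕ v) | proof (toℕ u ≤? toℕ v)
  ... | true  | ofʸ u≤v = ∈-filter⁺ _ (∈-cartesianProduct⁺ (∈-allFin u) (∈-allFin v))
                            (≤∧≢⇒< u≤v (λ eq → irrefl G (toℕ-injective eq) e) , e)
  ... | false | ofⁿ u≰v = ∈-filter⁺ _ (∈-cartesianProduct⁺ (∈-allFin v) (∈-allFin u)) (≰⇒> u≰v , symE G e)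

  Ends : Fin n → Fin n → Fin n × Fin n → Set
  Ends p q (u , v) = (p ≡ u × q ≡ v) ⊎ (p ≡ v × q ≡ u)

  ends-unique : ∀ {p q e e′} → e ∈ edges G → e′ ∈ edges G → Ends p q e → Ends p q e′ → e ≡ e′
  ends-unique e∈ e∈′ (inj₁ (refl , refl)) (inj₁ (refl , refl)) = refl
  ends-unique e∈ e∈′ (inj₁ (refl , refl)) (inj₂ (refl , refl)) = contradiction (proj₁ (∈-edges⁻ e∈)) (<-asym (proj₁ (∈-edges⁻ e∈′)))
  ends-unique e∈ e∈′ (inj₂ (refl , refl)) (inj₁ (refl , refl)) = contradiction (proj₁ (∈-edges⁻ e∈)) (<-asym (proj₁ (∈-edges⁻ e∈′)))
  ends-unique e∈ e∈′ (inj₂ (refl , refl)) (inj₂ (refl , refl)) = refl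

-- Bideep edges on and off the path between two vertices

module Comparison {n : ℕ} (G : Graph n) (tree : IsTree G) (κ : ℕ) where

  open Metric G tree
  open Separation G tree
  open Edges G

  BD : Fin n × Fin n → Set
  BD (u , v) = BiDeep κ u v

  bd? : ∀ e → Dec (BD e)
  bd? (u , v) = bideep? κ u v

  sepE? : ∀ x y (e : Fin n × Fin n) → Dec (Sep x y (proj₁ e) (proj₂ e))
  sepE? x y (u , v) = sep? x y u v

  onBideep offBideep : Fin n → Fin n → List (Fin n × Fin n)
  onBideep  x y = filter (λ e → bd? e ×-dec sepE? x y e) (edges G)
  offBideep x y = filter (λ e → bd? e ×-dec ¬? (sepE? x y e)) (edges G)

  private
    -- The edges separating x from y, numbered along the path from x to y.
    position : Fin n → Fin n × Fin n → ℕ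
    position x (u , v) = δ u x ⊓ δ v x

    -- The edge read in the direction of travel from `x` to `y`: `a` is the end nearer to `x`, and
    -- `b` is the next vertex.
    record Forward (x y : Fin n) (e : Fin n × Fin n) : Set where
      constructor fwd
      field
        {a b} : Fin n
        ends : Ends a b e
        adj  : E G a b
        bd   : BiDeep κ a b
        sx   : Side b a x
        sy   : Side a b y

      a≢y : a ≢ y
      a≢y eq = contradiction (trans (sym (δ-refl y)) (subst (λ c → δ c y ≡ suc (δ b y)) eq sy)) λ ()

      b≡par : b ≡ par y a
      b≡par = par-unique adj sy

      anc : Rooted.Anc G tree y a x
      anc = Rooted.side⇒anc G tree y a≢y (subst (λ c → Side c a x) b≡par sx)

      total : δ x y ≡ δ a x + δ a y
      total = trans (side-through (symE G adj) sx sy) (cong₂ _+_ (δ-sym x a) (sym sy))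

    open Forward

    forward : ∀ {x y e} → E G (proj₁ e) (proj₂ e) → BD e → Sep x y (proj₁ e) (proj₂ e) → Forward x y e
    forward e bd        (inj₁ (s , t)) = fwd (inj₁ (refl , refl)) e bd s t
    forward e (d₁ , d₂) (inj₂ (s , t)) = fwd (inj₂ (refl , refl)) (symE G e) (d₂ , d₁) s t

    position-forward : ∀ {x y e} (f : Forward x y e) → position x e ≡ δ (a f) x
    position-forward {x} f with ends f
    ... | inj₁ (p , q) = trans (cong₂ (λ u v → δ u x ⊓ δ v x) (sym p) (sym q)) (m≤n⇒m⊓n≡m (≤-trans (n≤1+n _) (≤-reflexive (sym (sx f)))))
    ... | inj₂ (p , q) = trans (cong₂ (λ u v → δ u x ⊓ δ v x) (sym q) (sym p)) (m≥n⇒m⊓n≡n (≤-trans (n≤1+n _) (≤-reflexive (sym (sx f)))))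

    forward-unique : ∀ {x y e e′} (f : Forward x y e) (f′ : Forward x y e′) → position x e ≡ position x e′ → a f ≡ a f′ × b f ≡ b f′
    forward-unique {x} {y} f f′ eq = a≡ , trans (b≡par f) (trans (cong (par y) a≡) (sym (b≡par f′)))
      where
      ax≡ : δ (a f) x ≡ δ (a f′) x
      ax≡ = trans (sym (position-forward f)) (trans eq (position-forward f′))
      a≡ : a f ≡ a f′
      a≡ = Rooted.anc-unique G tree y (anc f) (anc f′)
             (+-cancelˡ-≡ (δ (a f) x) _ _ (trans (sym (total f)) (trans (total f′) (cong (_+ _) (sym ax≡)))))

    ∈-on : ∀ {x y e} → e ∈ onBideep x y → e ∈ edges G × Forward x y e
    ∈-on e∈ with e∈′ , bd , s ← ∈-filter⁻ _ {xs = edges G} e∈ = e∈′ , forward (proj₂ (∈-edges⁻ e∈′)) bd s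

    -- Prolong the stretch from `e` to `e′` at both ends by the depth witnesses `wa` and `wb`, each
    -- at least `κ` away. The distance from `wa` to `wb` is at most `δ r z`. Adding `position x e`
    -- on the right avoids a truncated difference of positions.
    window : ∀ {r z x y e e′} → Diametral r z → Forward x y e → Forward x y e′ →
             position x e ≤ position x e′ → κ + κ + suc (position x e′) ≤ δ r z + position x e
    window {r} {z} {x} {y} diam f f′ le with wa , swa , κ≤a ← proj₂ (bd f) | wb , swb , κ≤b ← proj₁ (bd f′) = begin
      κ + κ + suc (position _ _)                ≡⟨ cong (λ m → κ + κ + suc m) (position-forward f′) ⟩
      κ + κ + suc (δ (a f′) x)                  ≤⟨ +-monoˡ-≤ _ (+-mono-≤ κ≤a κ≤b) ⟩
      δ (a f) wa + δ (b f′) wb + suc (δ (a f′) x) ≡⟨ shuffle (δ (a f) wa) (δ (b f′) wb) (δ (a f′) x) ⟩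
      δ (a f) wa + (δ (a f′) x + suc (δ (b f′) wb)) ≡⟨ cong (δ (a f) wa +_) (trans (cong (_+ _) (δ-sym (a f′) x)) (sym (side-through (symE G (adj f′)) (sx f′) swb))) ⟩
      δ (a f) wa + δ x wb                       ≤⟨ +-monoʳ-≤ (δ (a f) wa) (≤-trans (δ-triangle x (a f) wb) (≤-reflexive (+-comm (δ x (a f)) _))) ⟩
      δ (a f) wa + (δ (a f) wb + δ x (a f))     ≡⟨ sym (+-assoc (δ (a f) wa) _ _) ⟩
      δ (a f) wa + δ (a f) wb + δ x (a f)       ≡⟨ cong (_+ δ x (a f)) (cong₂ _+_ (δ-sym (a f) wa) wb-side) ⟩
      δ wa (a f) + suc (δ (b f) wb) + δ x (a f) ≡⟨ cong (_+ δ x (a f)) (sym (side-through (symE G (adj f)) swa wb-side)) ⟩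
      δ wa wb + δ x (a f)                       ≤⟨ +-mono-≤ (diam wa wb) (≤-reflexive (trans (δ-sym x (a f)) (sym (position-forward f)))) ⟩
      δ r z + position _ _                      ∎
      where
      open ≤-Reasoning
      shuffle : ∀ i j m → i + j + suc m ≡ i + (m + suc j)
      shuffle i j m = trans (+-assoc i j (suc m)) (cong (i +_) (trans (+-suc j m) (trans (cong suc (+-comm j m)) (sym (+-suc m j)))))

      -- wb lies beyond the edge of f′, which comes after the edge of f.
      wb-side : Side (a f) (b f) wb
      wb-side with side-total (adj f) wb
      ... | inj₁ s = s
      ... | inj₂ s = ⊥-elim (side-asym swb (subst (λ c → Side c (a f′) wb) (sym (b≡par f′)) (Y.anc⇒side (a≢y f′) (Y.anc-trans later
                       (Y.side⇒anc (a≢y f) (subst (λ c → Side c (a f) wb) (b≡par f) s))))))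
        where
        module Y = Rooted G tree y
        later : Y.Anc (a f′) (a f)
        later = Y.anc-linear (anc f′) (anc f) (+-cancelˡ-≤ (δ (a f) x) _ _ (begin
          δ (a f) x + δ (a f′) y  ≡⟨ cong (_+ _) (sym (position-forward f)) ⟩
          position _ _ + δ (a f′) y  ≤⟨ +-monoˡ-≤ _ le ⟩
          position _ _ + δ (a f′) y ≡⟨ cong (_+ _) (position-forward f′) ⟩
          δ (a f′) x + δ (a f′) y ≡⟨ sym (total f′) ⟩
          δ x y                   ≡⟨ total f ⟩
          δ (a f) x + δ (a f) y   ∎))

  onBideep-upper : ∀ {r z} → Diametral r z → ∀ x y → length (onBideep x y) ≤ δ r z ∸ (κ + κ)
  onBideep-upper {r} {z} diam x y = subst (_≤ δ r z ∸ (κ + κ)) (length-map (position x) (onBideep x y)) (unique-window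
    (unique-map-on (position x) injective (Uniqueₚ.filter⁺ _ edges-unique))
    (λ p∈ q∈ → case (∈-map⁻ (position x) p∈ , ∈-map⁻ (position x) q∈) of λ { ((e′ , e′∈ , refl) , (e , e∈ , refl)) → close (proj₂ (∈-on e∈)) (proj₂ (∈-on e′∈)) }))
    where
    injective : ∀ {e e′} → e ∈ onBideep x y → e′ ∈ onBideep x y → position x e ≡ position x e′ → e ≡ e′
    injective e∈ e∈′ eq with p , f ← ∈-on e∈ | p′ , f′ ← ∈-on e∈′ with a≡ , b≡ ← forward-unique f f′ eq =
      ends-unique p p′ (subst₂ (λ u v → Ends u v _) a≡ b≡ (ends f)) (ends f′)

    close : ∀ {e e′} → Forward x y e → Forward x y e′ → position x e′ < position x e + (δ r z ∸ (κ + κ))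
    close {e} {e′} f f′ with ≤-total (position x e) (position x e′)
    ... | inj₁ le = +-cancelˡ-≤ (κ + κ) _ _ (≤-trans w (≤-reflexive (trans (+-comm (δ r z) _) (trans (cong (position x e +_) (sym (m+[n∸m]≡n 2κ≤)))
                      (trans (sym (+-assoc (position x e) _ _)) (trans (cong (_+ (δ r z ∸ (κ + κ))) (+-comm (position x e) (κ + κ))) (+-assoc (κ + κ) _ _)))))))
      where
      w : κ + κ + suc (position x e′) ≤ δ r z + position x e
      w = window diam f f′ le
      2κ≤ : κ + κ ≤ δ r z
      2κ≤ = +-cancelʳ-≤ (position x e) _ _ (≤-trans (+-monoʳ-≤ (κ + κ) (≤-trans le (n≤1+n _))) w)
    ... | inj₂ ge with m≤n⇒m<n∨m≡n ge
    ...   | inj₁ lt = ≤-trans lt (m≤m+n _ _)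
    -- For equal positions the window must have positive width, that is `κ + κ < δ r z`; `window`
    -- for these two edges gives it.
    ...   | inj₂ eq = subst (_< _) (sym eq) (m<m+n _ (m<n⇒0<n∸m (+-cancelʳ-≤ (position x e) _ _ (≤-trans (≤-reflexive (trans (sym (+-suc (κ + κ) _)) (cong (λ m → κ + κ + suc m) (sym eq)))) (window diam f f′ (≤-reflexive (sym eq)))))))

  -- The ends `r` and `z` themselves witness depth, so at most the first and the last `κ` edges of
  -- their path fail to be bideep; `edgeAt` enumerates the others.
  onBideep-lower : ∀ r z → δ r z ∸ (κ + κ) ≤ length (onBideep r z)
  onBideep-lower r z = subst (_≤ length (onBideep r z)) (trans (length-map edgeAt (upTo K)) (length-upTo K))
    (unique⊆⇒length≤ (unique-map-on edgeAt (λ i∈ j∈ → injective (∈-upTo⁻ i∈) (∈-upTo⁻ j∈)) (Uniqueₚ.upTo⁺ K))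
      λ e∈ → case ∈-map⁻ edgeAt e∈ of λ { (i , i∈ , refl) → member (∈-upTo⁻ i∈) })
    where
    module Z = Rooted G tree z

    K : ℕ
    K = δ r z ∸ (κ + κ)

    climb : ℕ → Fin n
    climb zero    = r
    climb (suc j) = par z (climb j)

    climb-dep : ∀ j → j ≤ δ r z → j + Z.dep (climb j) ≡ δ r z
    climb≢z : ∀ j → j < δ r z → climb j ≢ z
    climb-dep zero    _ = refl
    climb-dep (suc j) j< = trans (sym (+-suc j _)) (trans (cong (j +_) (sym (Z.dep-parent (climb≢z j j<)))) (climb-dep j (<⇒≤ j<)))
    climb≢z j j< eq = <-irrefl (trans (sym (+-identityʳ j)) (trans (cong (j +_) (trans (sym (δ-refl z)) (cong (λ v → δ v z) (sym eq)))) (climb-dep j (<⇒≤ j<)))) j<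

    climb-anc : ∀ j → j ≤ δ r z → Z.Anc (climb j) r
    climb-anc zero    _  = Z.self
    climb-anc (suc j) j< = Z.anc-parent (climb≢z j j<) (climb-anc j (<⇒≤ j<))

    edgeAt : ℕ → Fin n × Fin n
    edgeAt i = orient (climb (κ + i)) (climb (suc (κ + i)))

    module _ {i : ℕ} (i<K : i < K) where

      far : κ + suc (κ + i) ≤ δ r z
      far = begin
        κ + suc (κ + i)            ≡⟨ trans (cong (κ +_) (sym (+-suc κ i))) (sym (+-assoc κ κ _)) ⟩
        κ + κ + suc i              ≤⟨ +-monoʳ-≤ (κ + κ) i<K ⟩
        κ + κ + (δ r z ∸ (κ + κ))  ≡⟨ m+[n∸m]≡n (<⇒≤ (m<n∸m⇒ {o = κ + κ} i<K)) ⟩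
        δ r z                      ∎
        where
        open ≤-Reasoning
        m<n∸m⇒ : ∀ {m n o} → m < n ∸ o → o < n
        m<n∸m⇒ {m} {n} {o} lt = m∸n≢0⇒n<m (λ eq → contradiction (subst (m <_) eq lt) λ ())

      a< : κ + i < δ r z
      a< = ≤-trans (m≤n+m _ κ) far

      near-end : climb (κ + i) ≢ z
      near-end = climb≢z (κ + i) a<

      s-r : Side (climb (suc (κ + i))) (climb (κ + i)) r
      s-r = Z.anc⇒side near-end (climb-anc (κ + i) (<⇒≤ a<))

      at-r : δ (climb (κ + i)) r ≡ κ + i
      at-r = +-cancelʳ-≡ (Z.dep (climb (κ + i))) _ _ (trans (cong (_+ Z.dep (climb (κ + i))) (δ-sym (climb (κ + i)) r))
        (trans (sym (trans (side-through (symE G (E-par near-end)) s-r (side-par near-end)) (cong (δ r (climb (κ + i)) +_) (sym (δ-par near-end))))) (sym (climb-dep (κ + i) (<⇒≤ a<)))))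

      at-z : κ ≤ δ (climb (suc (κ + i))) z
      at-z = +-cancelˡ-≤ (suc (κ + i)) _ _ (≤-trans (≤-reflexive (+-comm _ κ)) (≤-trans far (≤-reflexive (sym (climb-dep (suc (κ + i)) a<)))))

      bideep : BiDeep κ (climb (κ + i)) (climb (suc (κ + i)))
      bideep = (z , side-par near-end , at-z) , (r , s-r , ≤-trans (m≤m+n κ i) (≤-reflexive (sym at-r)))

      member : edgeAt i ∈ onBideep r z
      member = ∈-filter⁺ _ (orient-∈ (E-par near-end)) (good (orient-cases (climb (κ + i)) (climb (suc (κ + i)))))
        where
        good : ∀ {e} → e ≡ (climb (κ + i) , climb (suc (κ + i))) ⊎ e ≡ (climb (suc (κ + i)) , climb (κ + i)) → BD e × Sep r z (proj₁ e) (proj₂ e)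
        good (inj₁ refl) = bideep , inj₁ (s-r , side-par near-end)
        good (inj₂ refl) = (proj₂ bideep , proj₁ bideep) , inj₂ (s-r , side-par near-end)

      at-position : position r (edgeAt i) ≡ κ + i
      at-position = trans (by (orient-cases (climb (κ + i)) (climb (suc (κ + i))))) at-r
        where
        low : δ (climb (κ + i)) r ≤ δ (climb (suc (κ + i))) r
        low = ≤-trans (n≤1+n _) (≤-reflexive (sym s-r))
        by : ∀ {e} → e ≡ (climb (κ + i) , climb (suc (κ + i))) ⊎ e ≡ (climb (suc (κ + i)) , climb (κ + i)) → position r e ≡ δ (climb (κ + i)) r
        by (inj₁ refl) = m≤n⇒m⊓n≡m low
        by (inj₂ refl) = m≥n⇒m⊓n≡n low

    injective : ∀ {i j} → i < K → j < K → edgeAt i ≡ edgeAt j → i ≡ j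
    injective i< j< eq = +-cancelˡ-≡ κ _ _ (trans (sym (at-position i<)) (trans (cong (position r) eq) (at-position j<)))

  -- The total number of bideep edges does not depend on the pair. A diametral pair has the most of
  -- them on its path, hence the fewest off it.
  offBideep-minimal : ∀ {r z} → Diametral r z → ∀ x y → length (offBideep r z) ≤ length (offBideep x y)
  offBideep-minimal {r} {z} diam x y = +-cancelˡ-≤ (length (onBideep x y)) _ _ (begin
    length (onBideep x y) + length (offBideep r z) ≤⟨ +-monoˡ-≤ _ (≤-trans (onBideep-upper diam x y) (onBideep-lower r z)) ⟩
    length (onBideep r z) + length (offBideep r z) ≡⟨ length-filter-split bd? (sepE? r z) (edges G) ⟩
    length (filter bd? (edges G))                  ≡⟨ sym (length-filter-split bd? (sepE? x y) (edges G)) ⟩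
    length (onBideep x y) + length (offBideep x y) ∎)
    where open ≤-Reasoning

-- The sum of `d` as a number of bideep edges

lastOf : ∀ {A : Set} → A → List A → A
lastOf x []       = x
lastOf x (y ∷ ys) = lastOf y ys

lastOf-∈ : ∀ {A : Set} (x : A) xs → lastOf x xs ∈ x ∷ xs
lastOf-∈ x []       = here refl
lastOf-∈ x (y ∷ ys) = there (lastOf-∈ y ys)

≤max⇒ : ∀ {m} xs → suc m ≤ max 0 xs → Any (suc m ≤_) xs
≤max⇒ {m} xs le with Any.any? (suc m ≤?_) xs
... | yes a = a
... | no ¬a = contradiction le (<⇒≱ (max<v⁺ (s≤s z≤n) (All.map ≰⇒> (¬Any⇒All¬ xs ¬a))))

if-yes : ∀ {A B : Set} (a? : Dec A) {x y : B} → A → (if does a? then x else y) ≡ x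
if-yes (yes _) _ = refl
if-yes (no ¬a) a = contradiction a ¬a

if-no : ∀ {A B : Set} (a? : Dec A) {x y : B} → ¬ A → (if does a? then x else y) ≡ y
if-no (yes a) ¬a = contradiction a ¬a
if-no (no _)  _  = refl

nested-if : ∀ {A B C : Set} (a? : Dec A) (b? : Dec B) → (A → ¬ C) → (¬ A → (B → C) × (C → B)) →
            (C → (if does a? then 0 else if does b? then 1 else 0) ≡ 1) × (¬ C → (if does a? then 0 else if does b? then 1 else 0) ≡ 0)
nested-if (yes a) _       no-C _   = (λ c → contradiction c (no-C a)) , (λ _ → refl)
nested-if (no ¬a) (yes b) _    iff = (λ _ → refl) , (λ ¬c → contradiction (proj₁ (iff ¬a) b) ¬c)
nested-if (no ¬a) (no ¬b) _    iff = (λ c → contradiction (proj₂ (iff ¬a) c) ¬b) , (λ _ → refl)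

module LongestPaths {n : ℕ} (G : Graph n) (tree : IsTree G) where

  open Metric G tree
  open Separation G tree

  infix⇒∈ : ∀ {u v : Fin n} {xs} → Infix _≡_ (u ∷ v ∷ []) xs → u ∈ xs × v ∈ xs
  infix⇒∈ (here (refl ∷ refl ∷ [])) = here refl , there (here refl)
  infix⇒∈ (there i) with a , b ← infix⇒∈ i = there a , there b

  stay-on-side : ∀ {p v a ys} → E G p v → Linked (E G) (a ∷ ys) → Side p v a → ¬ Infix _≡_ (v ∷ p ∷ []) (a ∷ ys) → All (Side p v) (a ∷ ys)
  stay-on-side {ys = []}     e l       s ¬i = s ∷ []
  stay-on-side {ys = b ∷ ys} e (f ∷ l) s ¬i with side-total e b
  ... | inj₁ t = s ∷ stay-on-side e l t (¬i ∘ there)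
  ... | inj₂ t with refl , refl ← side-cross e f s t = contradiction (here (refl ∷ refl ∷ [])) ¬i

  infix⇒sides : ∀ {u v a ys} → Unique (a ∷ ys) → Linked (E G) (a ∷ ys) → Infix _≡_ (u ∷ v ∷ []) (a ∷ ys) →
                E G u v × Side v u a × Side u v (lastOf a ys)
  infix⇒sides {u} {v} (fresh ∷ un) (e ∷ l) (here (refl ∷ refl ∷ [])) =
    e , side-self (symE G e) , All.lookup (stay-on-side e l (side-self e) λ i → All.lookup fresh (proj₂ (infix⇒∈ i)) refl) (lastOf-∈ _ _)
  infix⇒sides {u} {v} {a} {b ∷ ys} (fresh ∷ un) (e ∷ l) (there i) with uv , s , t ← infix⇒sides un l i | side-total uv a
  ... | inj₂ s′ = uv , s′ , t
  ... | inj₁ s′ with refl , refl ← side-cross uv e s′ s = contradiction refl (All.lookup fresh (proj₂ (infix⇒∈ i)))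
  infix⇒sides _ [-] (here (_ ∷ ()))
  infix⇒sides _ [-] (there (here ()))

  -- Every path of a tree is a geodesic: after its first edge it never comes back to the side of
  -- `a`.
  path-length : ∀ a ys → Unique (a ∷ ys) → Linked (E G) (a ∷ ys) → length ys ≡ δ a (lastOf a ys)
  path-length a []       _            _       = sym (δ-refl a)
  path-length a (b ∷ ys) (fresh ∷ un) (e ∷ l) = trans (cong suc (path-length b ys un l))
    (sym (All.lookup (stay-on-side e l (side-self e) λ i → All.lookup fresh (proj₂ (infix⇒∈ i)) refl) (lastOf-∈ b ys)))

  geodesic-path : ∀ y m x → δ x y ≡ m → ∃ λ xs → Unique (x ∷ xs) × Linked (E G) (x ∷ xs) × length xs ≡ m × All (λ v → δ v y < m) xs
  geodesic-path y zero    x eq = [] , [] ∷ [] , [-] , refl , []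
  geodesic-path y (suc m) x eq with x ≟ᶠ y
  ... | yes refl = contradiction (trans (sym (δ-refl x)) eq) λ ()
  ... | no x≢y with geodesic-path y m (par y x) (suc-injective (trans (sym (δ-par x≢y)) eq))
  ... | xs , un , l , len , close = par y x ∷ xs , All.map (λ lt x≡v → <-irrefl (trans (cong (λ w → δ w y) (sym x≡v)) eq) lt) close′ ∷ un , E-par x≢y ∷ l , cong suc len , close′
    where
    close′ : All (λ v → δ v y < suc m) (par y x ∷ xs)
    close′ = ≤-reflexive (trans (sym (δ-par x≢y)) eq) ∷ All.map (λ lt → ≤-trans lt (n≤1+n m)) close

  longest⇒diametral : ∀ {r ys} → IsLongestPath G (r ∷ ys) → Diametral r (lastOf r ys)
  longest⇒diametral {r} {ys} ((_ , un , l) , longest) x y with geodesic-path y (δ x y) x refl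
  ... | xs , un′ , l′ , len , _ = subst₂ _≤_ len (path-length r ys un l) (≤-pred (longest (x ∷ xs) ((λ ()) , un′ , l′)))

  -- `H` stands for the tree without the edge between `o` and `f`. Only these three properties of it
  -- matter, so one argument serves both orientations of the removed edge.
  module _ {H : Graph n} {o f : Fin n} (oe : E G o f)
           (sub : ∀ {x y} → E H x y → E G x y)
           (cut : ∀ {x y} → E H x y → ¬ (x ≡ f × y ≡ o))
           (keep : ∀ {x y} → E G x y → Side o f x → Side o f y → E H x y) where

    private
      walk-side : ∀ {x w m} → Walk H x w m → Side o f x → Side o f w
      walk-side []                  s = s
      walk-side (_∷_ {w = y} e w) s with side-total oe y
      ... | inj₁ t = walk-side w t
      ... | inj₂ t = contradiction (side-cross oe (sub e) s t) (cut e)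

      walk-sub : ∀ {x w m} → Walk H x w m → Walk G x w m
      walk-sub []      = []
      walk-sub (e ∷ w) = sub e ∷ walk-sub w

      side-walk : ∀ m w → δ w f ≡ m → Side o f w → Walk H w f m
      side-walk zero    w eq s with refl ← δ≡0⇒≡ eq = []
      side-walk (suc m) w eq s with w ≟ᶠ f
      ... | yes refl = contradiction (trans (sym (δ-refl w)) eq) λ ()
      ... | no w≢f with side-total oe (par f w)
      ... | inj₁ t = keep (E-par w≢f) s t ∷ side-walk m (par f w) (suc-injective (trans (sym (δ-par w≢f)) eq)) t
      ... | inj₂ t = contradiction (proj₁ (side-cross oe (E-par w≢f) s t)) w≢f

      walk-from : ∀ {w} → Side o f w → Walk H f w (δ f w)
      walk-from {w} s = subst (Walk H f w) (δ-sym w f) (walk-reverse H (side-walk _ w refl s))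

    height⇒deep : ∀ {κ} → κ ≤ height H f → Deep κ o f
    -- As a maximum with default 0, `height` supplies no witness for `κ = 0`; `f` itself serves.
    height⇒deep {zero}  _  = f , side-self oe , z≤n
    height⇒deep {suc κ} le with Anyₚ.map⁻ (≤max⇒ (map (dist H f) (component H f)) le)
    ... | far with w , w∈ , κ≤ ← find far with _ , reach@(_ , wk) ← ∈-filter⁻ (reachable? H f) {xs = allFin n} w∈ =
      w , walk-side wk (side-self oe) , ≤-trans κ≤ (dist-min H (walk-from (walk-side wk (side-self oe))))

    deep⇒height : ∀ {κ} → Deep κ o f → κ ≤ height H f
    deep⇒height (w , s , κ≤) = v≤max⁺ 0 _ (inj₂ (Anyₚ.map⁺ (Any.map (λ { refl → ≤-trans κ≤ (δ-min (walk-sub (dist-walk H reach))) }) w∈)))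
      where
      reach : Reachable H f w
      reach = _ , walk-from s
      w∈ : w ∈ component H f
      w∈ = ∈-filter⁺ (reachable? H f) (∈-allFin w) reach

  -- Every vertex of `P` is nearer to `o` than to `f`. The default `n` of the minimum cannot
  -- interfere, since `r` lies on `P` at distance below `n`.
  distToPath-side : ∀ {o f r P} → r ∈ P → All (Side f o) P → distToPath G P o < distToPath G P f
  distToPath-side {o} {f} {r} {P} r∈ sides = min[xs]<min[ys]⁺ n (map (dist G o) P)
    (inj₂ (Anyₚ.map⁺ (Any.map (λ { refl → subst (_< n) (δ≡dist o r) (δ<n o r) }) r∈)))
    (map⁺ (All.tabulate (inj₂ ∘ closer)))
    where
    closer : ∀ {q} → q ∈ P → Any (_< dist G f q) (map (dist G o) P)
    closer {q} q∈ = Anyₚ.map⁺ (Any.map (λ { refl → subst₂ _<_ (δ≡dist o q) (δ≡dist f q) (≤-reflexive (sym (All.lookup sides q∈))) }) q∈)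

  private
    module Counting {κ : ℕ} {P : List (Fin n)} {r z : Fin n} (r∈ : r ∈ P) (z∈ : z ∈ P) (diametral : Diametral r z)
      (onPath⇒sep : ∀ {u v} → OnPath P (u , v) → Sep r z u v)
      (offPath⇒side : ∀ {u v} → E G u v → ¬ OnPath P (u , v) → Side u v r → All (Side u v) P) where

      Counted : Fin n × Fin n → Set
      Counted (u , v) = BiDeep κ u v × ¬ Sep r z u v

      far-height : ∀ {e f} → farEnd G P e ≡ f → κ ≤ height (G − e) (farEnd G P e) → κ ≤ height (G − e) f
      far-height {e} eq = subst (λ x → κ ≤ height (G − e) x) eq

      far-height′ : ∀ {e f} → farEnd G P e ≡ f → κ ≤ height (G − e) f → κ ≤ height (G − e) (farEnd G P e)
      far-height′ {e} eq = subst (λ x → κ ≤ height (G − e) x) (sym eq)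

      -- `r` and `z` lie on the same side of an edge off `P`, and `farEnd` picks the end on the
      -- other side. Depth there is what `d` tests; depth in the opposite direction then comes from
      -- `deep-opposite`.
      deep⇔counted : ∀ {u v} → E G u v → ¬ OnPath P (u , v) →
                     (κ ≤ height (G − (u , v)) (farEnd G P (u , v)) → Counted (u , v)) × (Counted (u , v) → κ ≤ height (G − (u , v)) (farEnd G P (u , v)))
      deep⇔counted {u} {v} e off with side-total e r
      ... | inj₂ s =
        (λ h → let dp = height⇒deep e proj₁ cut keep (far-height far h) in (dp , deep-opposite κ diametral e s sz dp) , λ sp → side-asym sz (opp sp)) ,
        (λ c → far-height′ far (deep⇒height e proj₁ cut keep (proj₁ (proj₁ c))))
        where
        sides : All (Side v u) P
        sides = offPath⇒side (symE G e) (off ∘ swap) s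
        far : farEnd G P (u , v) ≡ v
        far = if-yes (distToPath G P u <? distToPath G P v) (distToPath-side r∈ sides)
        sz : Side v u z
        sz = All.lookup sides z∈
        opp : Sep r z u v → Side u v z
        opp (inj₁ (_ , t)) = t
        opp (inj₂ (t , _)) = ⊥-elim (side-asym s t)
        cut : ∀ {x y} → E (G − (u , v)) x y → ¬ (x ≡ v × y ≡ u)
        cut h q = proj₂ h (inj₂ q)
        keep : ∀ {x y} → E G x y → Side u v x → Side u v y → E (G − (u , v)) x y
        keep h sx sy = h , λ { (inj₁ (refl , refl)) → side-asym sx (side-self (symE G e)) ; (inj₂ (refl , refl)) → side-asym sy (side-self (symE G e)) }
      ... | inj₁ s =
        (λ h → let dp = height⇒deep (symE G e) proj₁ cut keep (far-height far h) in (deep-opposite κ diametral (symE G e) s sz dp , dp) , λ sp → side-asym sz (opp sp)) ,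
        (λ c → far-height′ far (deep⇒height (symE G e) proj₁ cut keep (proj₂ (proj₁ c))))
        where
        sides : All (Side u v) P
        sides = offPath⇒side e off s
        far : farEnd G P (u , v) ≡ u
        far = if-no (distToPath G P u <? distToPath G P v) (<-asym (distToPath-side r∈ sides))
        sz : Side u v z
        sz = All.lookup sides z∈
        opp : Sep r z u v → Side v u z
        opp (inj₁ (t , _)) = ⊥-elim (side-asym s t)
        opp (inj₂ (_ , t)) = t
        cut : ∀ {x y} → E (G − (u , v)) x y → ¬ (x ≡ u × y ≡ v)
        cut h q = proj₂ h (inj₁ q)
        keep : ∀ {x y} → E G x y → Side v u x → Side v u y → E (G − (u , v)) x y
        keep h sx sy = h , λ { (inj₁ (refl , refl)) → side-asym sy (side-self e) ; (inj₂ (refl , refl)) → side-asym sx (side-self e) }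

      d-counts : ∀ {u v} → E G u v → (Counted (u , v) → d G (suc κ) P (u , v) ≡ 1) × (¬ Counted (u , v) → d G (suc κ) P (u , v) ≡ 0)
      d-counts {u} {v} e = nested-if (onPath? P (u , v)) (κ ≤? height (G − (u , v)) (farEnd G P (u , v)))
        (λ on c → proj₂ c (onPath⇒sep on)) (deep⇔counted e)

      open Comparison G tree κ
      open Edges G

      sum-d : sum (map (d G (suc κ) P) (edges G)) ≡ length (offBideep r z)
      sum-d = sum-indicator (λ e → bd? e ×-dec ¬? (sepE? r z e)) (d G (suc κ) P) (edges G) λ e∈ → d-counts (proj₂ (∈-edges⁻ e∈))

      walkLength≡ : walkLength G (suc κ) P ≡ n ∸ suc κ + length (offBideep r z)
      walkLength≡ = cong (n ∸ suc κ +_) sum-d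

  walkLength≡ : ∀ κ {r ys} → IsLongestPath G (r ∷ ys) →
                walkLength G (suc κ) (r ∷ ys) ≡ n ∸ suc κ + length (Comparison.offBideep G tree κ r (lastOf r ys))
  walkLength≡ κ {r} {ys} longest@((_ , unique , linked) , _) =
    Counting.walkLength≡ {κ} {r ∷ ys} (here refl) (lastOf-∈ r ys) (longest⇒diametral longest) onPath⇒sep
      (λ e off s → stay-on-side e linked s (off ∘ inj₂))
    where
    onPath⇒sep : ∀ {u v} → OnPath (r ∷ ys) (u , v) → Sep r (lastOf r ys) u v
    onPath⇒sep (inj₁ i) = inj₁ (proj₂ (infix⇒sides unique linked i))
    onPath⇒sep (inj₂ i) = inj₂ (proj₂ (infix⇒sides unique linked i))

-- The lower bound

module _ {A : Set} where

  -- `R x i` reads "`x` is charged to step `i`": everything is charged somewhere, and no step is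
  -- charged for two things.
  length≤-by-relation : ∀ {m} {xs : List A} (R : A → Fin m → Set) → Unique xs → (∀ {x} → x ∈ xs → ∃ (R x)) →
                        (∀ {x x′ i} → R x i → R x′ i → x ≡ x′) → length xs ≤ m
  length≤-by-relation R u total functional = injective⇒≤ {f = λ i → proj₁ (total (∈-lookup i))} λ {i} {j} eq →
    lookup-injective u i j (functional (proj₂ (total (∈-lookup i))) (subst (R _) (sym eq) (proj₂ (total (∈-lookup j)))))

first-entry : ∀ {l} {Q : Fin (suc l) → Set} → (∀ t → Dec (Q t)) → ¬ Q zero → ∀ t → Q t →
              ∃ λ i → Q (suc i) × (∀ j → toℕ j ≤ toℕ i → ¬ Q j)
first-entry         Q? ¬0 zero    q = contradiction q ¬0
first-entry {suc l} {Q} Q? ¬0 (suc t) q with Q? (suc zero)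
... | yes q₁ = zero , q₁ , λ { zero _ → ¬0 }
... | no ¬q₁ with i , qi , before ← first-entry (Q? ∘ suc) ¬q₁ t q =
  suc i , qi , λ { zero _ → ¬0 ; (suc j) (s≤s le) → before j le }

last-exit : ∀ {l} {Far Hit : Fin (suc l) → Set} → (∀ i → Far (inject₁ i) → Far (suc i) ⊎ Hit (suc i)) → ¬ Far (fromℕ l) →
            ∀ t → Far t → ∃ λ i → toℕ t ≤ toℕ i × Far (inject₁ i) × Hit (suc i)
last-exit {zero}  step ¬end zero    far = contradiction far ¬end
last-exit {suc l} {Far} {Hit} step ¬end zero    far with step zero far
... | inj₂ hit = zero , z≤n , far , hit
... | inj₁ far₁ with i , _ , fi , hi ← last-exit {Far = Far ∘ suc} {Hit = Hit ∘ suc} (step ∘ suc) ¬end zero far₁ = suc i , z≤n , fi , hi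
last-exit {suc l} {Far} {Hit} step ¬end (suc t) far with i , le , fi , hi ← last-exit {Far = Far ∘ suc} {Hit = Hit ∘ suc} (step ∘ suc) ¬end t far = suc i , s≤s le , fi , hi

visited-before : ∀ {l} {Near Hit : Fin (suc l) → Set} → (∀ i → Near (inject₁ i) → Near (suc i) ⊎ Hit (inject₁ i)) → Near zero →
                 ∀ t → ¬ Near t → ∃ λ j → toℕ j ≤ toℕ t × Hit j
visited-before         step near zero    ¬near = contradiction near ¬near
visited-before {suc l} {Near} {Hit} step near (suc t) ¬near with step zero near
... | inj₂ hit = zero , z≤n , hit
... | inj₁ near₁ with j , le , hj ← visited-before {Near = Near ∘ suc} {Hit = Hit ∘ suc} (step ∘ suc) near₁ t ¬near = suc j , s≤s le , hj

_∈ᶜ?_ : ∀ {n k} (x : Fin n) (c : Fin k → Fin n) → Dec (x ∈ᶜ c)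
x ∈ᶜ? c = any? λ i → c i ≟ᶠ x

module Configurations {n : ℕ} (G : Graph n) (tree : IsTree G) where

  open Metric G tree

  induced-walk : ∀ {k} {c : Fin k → Fin n} {i j m} → Walk (induced G c) i j m → Walk G (c i) (c j) m
  induced-walk []      = []
  induced-walk (e ∷ w) = e ∷ induced-walk w

  configuration-diameter : ∀ {k} {c : Fin k → Fin n} → Connected (induced G c) → ∀ i j → δ (c i) (c j) < k
  configuration-diameter {c = c} conn i j with m , w ← conn i j with m′ , m′<k , w′ ← shorten (induced G c) m w =
    ≤-<-trans (δ-min (induced-walk w′)) m′<k

  -- Here `w` is at least `k` away from `p`, while `k` agents forming a connected set are pairwise
  -- closer than `k`. So `p` is unoccupied, and a connected set avoiding `p` cannot cross the edge
  -- `pq`.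
  configuration-side : ∀ {κ} {c : Fin (suc κ) → Fin n} {p q w} → Connected (induced G c) → E G p q → w ∈ᶜ c → Side p q w → κ ≤ δ q w →
                       ¬ p ∈ᶜ c × (∀ j → Side p q (c j))
  configuration-side {κ} {c} {p} {q} conn pq (iw , refl) sw κ≤ = p∉ , λ j → along (proj₂ (conn iw j)) sw
    where
    p∉ : ¬ p ∈ᶜ c
    p∉ (j , refl) = <⇒≱ (configuration-diameter conn j iw) (≤-trans (s≤s κ≤) (≤-reflexive (sym sw)))

    along : ∀ {i j m} → Walk (induced G c) i j m → Side p q (c i) → Side p q (c j)
    along []                  s = s
    along (_∷_ {w = i′} e w) s with side-total pq (c i′)
    ... | inj₁ t = along w t
    ... | inj₂ t = contradiction (i′ , proj₂ (side-cross pq e s t)) p∉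

module LowerBound {n : ℕ} (G : Graph n) (tree : IsTree G) (κ l : ℕ) (C : Fin (suc l) → Fin (suc κ) → Fin n)
                  (walk : IsSpanningRestrictedWalk G (suc κ) l C) where

  open Metric G tree
  open Separation G tree
  open Configurations G tree
  open Comparison G tree κ
  open Edges G
  open IsSpanningRestrictedWalk walk

  private
    agent : Fin (suc l) → Fin n
    agent t = C t zero

    x y : Fin n
    x = agent zero
    y = agent (fromℕ l)

    record Reentry (e : Fin n × Fin n) (i : Fin l) : Set where
      field
        e∈      : e ∈ edges G
        p q     : Fin n
        ends    : Ends p q e
        pq      : E G p q
        beyond  : Side p q (agent (inject₁ i))
        enters  : p ∈ᶜ C (suc i)
        absent  : ¬ p ∈ᶜ C (inject₁ i)
        earlier : ∃ λ j → toℕ j ≤ toℕ i × p ∈ᶜ C j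

    -- A step is charged either to the first visit of a vertex or to a return through a bideep edge.
    Charge : Fin n ⊎ Fin n × Fin n → Fin l → Set
    Charge (inj₁ v) i = v ∈ᶜ C (suc i) × (∀ j → toℕ j ≤ toℕ i → ¬ v ∈ᶜ C j)
    Charge (inj₂ e) i = Reentry e i

    entering-unique : ∀ {i u v} → u ∈ᶜ C (suc i) → ¬ u ∈ᶜ C (inject₁ i) → v ∈ᶜ C (suc i) → ¬ v ∈ᶜ C (inject₁ i) → u ≡ v
    entering-unique {i} u∈ u∉ v∈ v∉ with _ , _ , only ← restricted i = trans (sym (only (u∈ , u∉))) (only (v∈ , v∉))

    not-before : ∀ {v i} → (∀ j → toℕ j ≤ toℕ i → ¬ v ∈ᶜ C j) → ¬ v ∈ᶜ C (inject₁ i)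
    not-before {i = i} h = h (inject₁ i) (≤-reflexive (toℕ-inject₁ i))

    -- `restricted` leaves one entering vertex per step. A first visit is no re-entry, because the
    -- vertex of a re-entry was occupied `earlier`. For two re-entries `p` agrees, and `q` is
    -- recovered as the neighbour of `p` towards the agent, which by `beyond` stands on the side of
    -- `q`.
    charge-functional : ∀ {a b i} → Charge a i → Charge b i → a ≡ b
    charge-functional {inj₁ u} {inj₁ v} (u∈ , u∉) (v∈ , v∉) = cong inj₁ (entering-unique u∈ (not-before u∉) v∈ (not-before v∉))
    charge-functional {inj₁ u} {inj₂ e} (u∈ , u∉) r with entering-unique u∈ (not-before u∉) (Reentry.enters r) (Reentry.absent r)
    ... | refl with j , le , p∈ ← Reentry.earlier r = contradiction p∈ (u∉ j le)
    charge-functional {inj₂ e} {inj₁ u} r (u∈ , u∉) with entering-unique u∈ (not-before u∉) (Reentry.enters r) (Reentry.absent r)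
    ... | refl with j , le , p∈ ← Reentry.earlier r = contradiction p∈ (u∉ j le)
    charge-functional {inj₂ e} {inj₂ e′} {i} r r′ = cong inj₂ (ends-unique R.e∈ R′.e∈ (subst₂ (λ u v → Ends u v e) p≡ q≡ R.ends) R′.ends)
      where
      module R = Reentry r
      module R′ = Reentry r′
      p≡ : R.p ≡ R′.p
      p≡ = entering-unique R.enters R.absent R′.enters R′.absent
      q≡ : R.q ≡ R′.q
      q≡ = trans (par-unique R.pq R.beyond) (trans (cong (par (agent (inject₁ i))) p≡) (sym (par-unique R′.pq R′.beyond)))

    fresh : List (Fin n)
    fresh = filter (λ v → ¬? (v ∈ᶜ? C zero)) (allFin n)

    charged : List (Fin n ⊎ Fin n × Fin n)
    charged = map inj₁ fresh ++ map inj₂ (offBideep x y)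

    charged-unique : Unique charged
    charged-unique = Uniqueₚ.++⁺ (Uniqueₚ.map⁺ inj₁-injective (Uniqueₚ.filter⁺ _ (Uniqueₚ.allFin⁺ n)))
      (Uniqueₚ.map⁺ inj₂-injective (Uniqueₚ.filter⁺ _ edges-unique))
      λ { (a , b) → case (∈-map⁻ inj₁ a , ∈-map⁻ inj₂ b) of λ { ((_ , _ , refl) , (_ , _ , ())) } }

    step : ∀ {p q} → E G p q → ∀ i → ¬ p ∈ᶜ C (inject₁ i) × Side p q (agent (inject₁ i)) → (¬ p ∈ᶜ C (suc i) × Side p q (agent (suc i))) ⊎ p ∈ᶜ C (suc i)
    step {p} {q} pq i (_ , s) with p ∈ᶜ? C (suc i)
    ... | yes p∈ = inj₂ p∈
    ... | no p∉ with adjacent i zero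
    ...   | inj₁ eq = inj₁ (p∉ , subst (Side p q) eq s)
    ...   | inj₂ e with side-total pq (agent (suc i))
    ...     | inj₁ t = inj₁ (p∉ , t)
    ...     | inj₂ t = contradiction (zero , proj₂ (side-cross pq e s t)) p∉

    step′ : ∀ {p q} → E G p q → ∀ i → Side q p (agent (inject₁ i)) → Side q p (agent (suc i)) ⊎ p ∈ᶜ C (inject₁ i)
    step′ {p} {q} pq i s with adjacent i zero
    ... | inj₁ eq = inj₁ (subst (Side q p) eq s)
    ... | inj₂ e with side-total pq (agent (suc i))
    ...   | inj₂ t = inj₁ t
    ...   | inj₁ t = inj₂ (zero , proj₁ (side-cross (symE G pq) e s t))

    reentry : ∀ {e p q} → e ∈ edges G → Ends p q e → E G p q → Deep κ p q →
              Side q p x → Side q p y → ∃ (Reentry e)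
    reentry {e} {p} {q} e∈ ends pq (w , sw , κ≤) sx sy with tw , w∈ ← spanning w
      with p∉ , sides ← configuration-side (proj₂ (configuration tw)) pq w∈ sw κ≤
      with i , le , (pi , si) , hit ← last-exit {Far = λ t → ¬ p ∈ᶜ C t × Side p q (agent t)} {Hit = λ t → p ∈ᶜ C t} (step pq)
                                        (λ { (_ , s) → side-asym s sy }) tw (p∉ , sides zero)
      -- The agent began on the side of `p` and can only have left it through `p`; this earlier
      -- visit tells the re-entry apart from a first entry.
      with j , lej , pj ← visited-before {Near = λ t → Side q p (agent t)} {Hit = λ t → p ∈ᶜ C t} (step′ pq) sx tw (side-asym (sides zero)) = i , record
        { e∈ = e∈ ; p = p ; q = q ; ends = ends ; pq = pq ; beyond = si ; enters = hit ; absent = pi ; earlier = j , ≤-trans lej le , pj }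

    charge-total : ∀ {a} → a ∈ charged → ∃ (Charge a)
    charge-total a∈ with ∈-++⁻ (map inj₁ fresh) a∈
    ... | inj₁ a∈₁ with v , v∈ , refl ← ∈-map⁻ inj₁ a∈₁ with _ , v∉ ← ∈-filter⁻ (λ v → ¬? (v ∈ᶜ? C zero)) {xs = allFin n} v∈ with t , v∈t ← spanning v =
      first-entry (λ t → v ∈ᶜ? C t) v∉ t v∈t
    ... | inj₂ a∈₂ with (u , v) , e∈ , refl ← ∈-map⁻ inj₂ a∈₂ with e∈′ , (d₁ , d₂) , ¬s ← ∈-filter⁻ (λ e → bd? e ×-dec ¬? (sepE? x y e)) {xs = edges G} e∈ with ¬sep⇒same-side (proj₂ (∈-edges⁻ e∈′)) ¬s
    ...   | inj₁ (sx , sy) = reentry e∈′ (inj₂ (refl , refl)) (symE G (proj₂ (∈-edges⁻ e∈′))) d₂ sx sy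
    ...   | inj₂ (sx , sy) = reentry e∈′ (inj₁ (refl , refl)) (proj₂ (∈-edges⁻ e∈′)) d₁ sx sy

    n≤ : n ≤ suc κ + length fresh
    n≤ = subst₂ _≤_ (length-tabulate id) (trans (length-++ (tabulate (C zero))) (cong (_+ length fresh) (length-tabulate (C zero))))
      (unique⊆⇒length≤ (Uniqueₚ.allFin⁺ n) λ {v} _ → here-or-fresh v)
      where
      here-or-fresh : ∀ v → v ∈ tabulate (C zero) ++ fresh
      here-or-fresh v with v ∈ᶜ? C zero
      ... | yes (i , refl) = ∈-++⁺ˡ (∈-tabulate⁺ {f = C zero} i)
      ... | no v∉          = ∈-++⁺ʳ (tabulate (C zero)) (∈-filter⁺ _ (∈-allFin v) v∉)

  lower-bound : ∀ {r z} → Diametral r z → n ∸ suc κ + length (offBideep r z) ≤ l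
  lower-bound {r} {z} diam = begin
    n ∸ suc κ + length (offBideep r z)       ≤⟨ +-mono-≤ (m≤n+o⇒m∸n≤o n (suc κ) n≤) (offBideep-minimal diam x y) ⟩
    length fresh + length (offBideep x y)    ≡⟨ sym (trans (length-++ (map inj₁ fresh)) (cong₂ _+_ (length-map inj₁ fresh) (length-map inj₂ (offBideep x y)))) ⟩
    length charged                           ≤⟨ length≤-by-relation Charge charged-unique charge-total charge-functional ⟩
    l                                        ∎
    where open ≤-Reasoning

module _ {A : Set} (F : ℕ → A) (f : ℕ) (a : A) where

  update-same : update F f a f ≡ a
  update-same = if-yes (f ≟ f) refl

  update-other : ∀ {j} → f ≢ j → update F f a j ≡ F j
  update-other {j} f≢j = if-no (f ≟ j) f≢j

update-at : ∀ {n} (g : ℕ → ℕ) {x a} {w : Fin n} → x ≡ toℕ w → update g x a (toℕ w) ≡ a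
update-at g {a = a} {w} refl = update-same g (toℕ w) a

update-≢ : ∀ {n} (g : ℕ → ℕ) {x a} {w v : Fin n} → x ≡ toℕ w → v ≢ w → update g x a (toℕ v) ≡ g (toℕ v)
update-≢ g {a = a} {w} refl v≢w = update-other g (toℕ w) a (v≢w ∘ sym ∘ toℕ-injective)

-- Moving agents along a path

module Shifting {n : ℕ} (G : Graph n) (tree : IsTree G) where

  open Metric G tree
  open Separation G tree

  anc? : ∀ w v x → Dec (Rooted.Anc G tree w v x)
  anc? w v x with v ≟ᶠ w
  ... | yes refl = yes (Rooted.anc-root G tree w x)
  ... | no v≢w with δ (par w v) x ≟ suc (δ v x)
  ...   | yes s = yes (Rooted.side⇒anc G tree w v≢w s)
  ...   | no ¬s = no (¬s ∘ Rooted.anc⇒side G tree w v≢w)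

  -- Agents 0 , … , s - 1 stand at c 0 , … , c (s - 1).
  Occupied : ℕ → (ℕ → Fin n) → Fin n → Set
  Occupied s c v = ∃ λ i → i < s × c i ≡ v

  occupied-push⁺ : ∀ {F f u v} → Occupied f F v → Occupied (suc f) (update F f u) v
  occupied-push⁺ {F} {f} {u} (j , j<f , eq) = j , m≤n⇒m≤1+n j<f , trans (update-other F f u (λ f≡j → <⇒≢ j<f (sym f≡j))) eq

  occupied-push-new : ∀ F f u → Occupied (suc f) (update F f u) u
  occupied-push-new F f u = f , ≤-refl , update-same F f u

  occupied-push⁻ : ∀ {F f u v} → Occupied (suc f) (update F f u) v → v ≡ u ⊎ Occupied f F v
  occupied-push⁻ {F} {f} {u} (j , j<1+f , eq) with f ≟ j
  ... | yes refl = inj₁ (trans (sym eq) (update-same F f u))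
  ... | no f≢j   = inj₂ (j , ≤∧≢⇒< (≤-pred j<1+f) (f≢j ∘ sym) , trans (sym (update-other F f u f≢j)) eq)

  injective-push : ∀ {F f u} → (∀ {i j} → i < f → j < f → F i ≡ F j → i ≡ j) → ¬ Occupied f F u →
                   ∀ {i j} → i < suc f → j < suc f → update F f u i ≡ update F f u j → i ≡ j
  injective-push {F} {f} {u} inj u∉ {i} {j} i< j< eq with f ≟ i | f ≟ j
  ... | yes refl | yes refl = refl
  ... | yes refl | no f≢j   = contradiction (j , ≤∧≢⇒< (≤-pred j<) (f≢j ∘ sym) , trans (sym (update-other F f u f≢j)) (trans (sym eq) (update-same F f u))) u∉
  ... | no f≢i   | yes refl = contradiction (i , ≤∧≢⇒< (≤-pred i<) (f≢i ∘ sym) , trans (sym (update-other F f u f≢i)) (trans eq (update-same F f u))) u∉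
  ... | no f≢i   | no f≢j   = inj (≤∧≢⇒< (≤-pred i<) (f≢i ∘ sym)) (≤∧≢⇒< (≤-pred j<) (f≢j ∘ sym))
                                (trans (sym (update-other F f u f≢i)) (trans eq (update-other F f u f≢j)))

  -- For a set containing `h`, closure under `par h` amounts to connectedness, and it is easier to
  -- maintain when the head moves.
  record Compact (h : Fin n) (s : ℕ) (c : ℕ → Fin n) : Set where
    field
      distinct : ∀ {i j} → i < s → j < s → c i ≡ c j → i ≡ j
      head∈    : Occupied s c h
      closed   : ∀ {v} → Occupied s c v → v ≢ h → Occupied s c (par h v)

  record Step (s : ℕ) (c c′ : ℕ → Fin n) : Set where
    field
      moves   : ∀ {i} → i < s → c i ≡ c′ i ⊎ E G (c i) (c′ i)
      new     : Fin n
      new∈    : Occupied s c′ new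
      new∉    : ¬ Occupied s c new
      only    : ∀ {v} → Occupied s c′ v → ¬ Occupied s c v → v ≡ new

  compact⇒configuration : ∀ {h s c} → Compact h s c → IsConfiguration {k = s} G (c ∘ toℕ)
  compact⇒configuration {h} {s} {c} K = (λ eq → toℕ-injective (distinct (toℕ<n _) (toℕ<n _) eq)) , connected
    where
    open Compact K
    H : Graph s
    H = induced G (c ∘ toℕ)

    index : ∀ {v} → Occupied s c v → ∃ λ (i : Fin s) → c (toℕ i) ≡ v
    index (i , i<s , eq) = fromℕ< i<s , trans (cong c (toℕ-fromℕ< i<s)) eq

    hᵢ : Fin s
    hᵢ = proj₁ (index head∈)

    to-head : ∀ m i → δ (c (toℕ i)) h ≡ m → Reachable H i hᵢ
    to-head m i eq with c (toℕ i) ≟ᶠ h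
    ... | yes ≡h with refl ← toℕ-injective {i = i} {j = hᵢ} (distinct (toℕ<n i) (toℕ<n hᵢ) (trans ≡h (sym (proj₂ (index head∈))))) = 0 , []
    to-head zero    i eq | no ≢h = contradiction (δ≡0⇒≡ eq) ≢h
    to-head (suc m) i eq | no ≢h with index (closed (toℕ i , toℕ<n i , refl) ≢h)
    ... | j , cj≡ with to-head m j (trans (cong (λ v → δ v h) cj≡) (suc-injective (trans (sym (δ-par ≢h)) eq)))
    ... | l , w = suc l , subst (E G (c (toℕ i))) (sym cj≡) (E-par ≢h) ∷ w

    connected : Connected H
    connected i j with to-head _ i refl | to-head _ j refl
    ... | a , p | b , q = a + b , walk-++ H p (walk-reverse H q)

  -- With the tree rooted at `w`, the path from `x` to `w` consists of the ancestors of `x`, which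
  -- is what `anc?` tests.
  shift : Fin n → Fin n → (ℕ → Fin n) → ℕ → Fin n
  shift x w c i = if does (anc? w (c i) x) then par w (c i) else c i

  -- `leaf` makes `x` a leaf of the occupied set as seen from `w`: no other agent needs `x` on its
  -- way to `w`, so `x` can be vacated without losing connectedness.
  module _ {h w x : Fin n} {s : ℕ} {c : ℕ → Fin n} (K : Compact h s c) (hw : E G h w) (w∉ : ¬ Occupied s c w) (x∈ : Occupied s c x)
           (leaf : ∀ {v} → Occupied s c v → par w v ≢ x) where

    open Compact K
    open Rooted G tree w

    private
      c′ : ℕ → Fin n
      c′ = shift x w c

      ∈⇒≢w : ∀ {v} → Occupied s c v → v ≢ w
      ∈⇒≢w v∈ refl = w∉ v∈

      towards : ∀ {v} → Occupied s c v → (v ≡ h × par w v ≡ w) ⊎ Occupied s c (par w v)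
      towards {v} v∈ with v ≟ᶠ h
      ... | yes refl = inj₁ (refl , par-adjacent hw)
      ... | no v≢h   = inj₂ (subst (Occupied s c) (sym (par-reroot hw v≢h (∈⇒≢w v∈))) (closed v∈ v≢h))

      head-on-chain : ∀ m {x} → dep x ≡ m → Occupied s c x → Anc h x
      head-on-chain zero    eq x∈ = contradiction (δ≡0⇒≡ eq) (∈⇒≢w x∈)
      head-on-chain (suc m) eq x∈ with towards x∈
      ... | inj₁ (refl , _) = self
      ... | inj₂ p∈         = below (∈⇒≢w x∈) (head-on-chain m (suc-injective (trans (sym (dep-parent (∈⇒≢w x∈))) eq)) p∈)

    chain⊆ : ∀ {v x} → Occupied s c x → Anc v x → v ≢ w → Occupied s c v
    chain⊆ x∈ self        v≢w = x∈
    chain⊆ x∈ (below _ a) v≢w with towards x∈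
    ... | inj₁ (_ , eq) = contradiction (anc-antisym (subst (Anc _) eq a) (≤-trans (≤-reflexive (δ-refl w)) z≤n)) v≢w
    ... | inj₂ p∈       = chain⊆ p∈ a v≢w

    private
      shift-on : ∀ {i} → Anc (c i) x → c′ i ≡ par w (c i)
      shift-on {i} a = if-yes (anc? w (c i) x) a

      shift-off : ∀ {i} → ¬ Anc (c i) x → c′ i ≡ c i
      shift-off {i} ¬a = if-no (anc? w (c i) x) ¬a

    -- On the chain each vacated vertex is taken by the agent behind it, and only `x` has none
    -- behind it. So as a set the occupied vertices lose `x` and gain `w`, as this lemma,
    -- `shift-new` and `shift-occupied⁺` express.
    shift-occupied⁻ : ∀ {v} → Occupied s c′ v → v ≡ w ⊎ (Occupied s c v × v ≢ x)
    shift-occupied⁻ (i , i<s , refl) with anc? w (c i) x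
    ... | no ¬a = inj₂ ((i , i<s , refl) , λ { refl → ¬a self })
    ... | yes a with towards (i , i<s , refl)
    ...   | inj₁ (_ , eq) = inj₁ eq
    ...   | inj₂ p∈       = inj₂ (p∈ , leaf (i , i<s , refl))

    shift-new : Occupied s c′ w
    shift-new with i , i<s , refl ← head∈ = i , i<s , trans (shift-on (head-on-chain _ refl x∈)) (par-adjacent hw)

    shift-occupied⁺ : ∀ {v} → Occupied s c v → v ≢ x → Occupied s c′ v
    shift-occupied⁺ {v} v∈@(j , j<s , refl) v≢x with anc? w v x
    ... | no ¬a = j , j<s , shift-off ¬a
    ... | yes a with u≢w , pu≡v , a′ ← anc-step a v≢x with i , i<s , ci≡u ← chain⊆ x∈ a′ u≢w =
      i , i<s , trans (shift-on (subst (λ u → Anc u x) (sym ci≡u) a′)) (trans (cong (par w) ci≡u) pu≡v)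

    private
      shift-distinct : ∀ {i j} → i < s → j < s → c′ i ≡ c′ j → i ≡ j
      shift-distinct {i} {j} i<s j<s eq with anc? w (c i) x | anc? w (c j) x
      ... | yes a | yes b = distinct i<s j<s (anc-unique a b
              (trans (dep-parent (∈⇒≢w (i , i<s , refl))) (trans (cong (suc ∘ dep) eq) (sym (dep-parent (∈⇒≢w (j , j<s , refl)))))))
      ... | yes a | no ¬b = contradiction (subst (λ v → Anc v x) eq (anc-parent (∈⇒≢w (i , i<s , refl)) a)) ¬b
      ... | no ¬a | yes b = contradiction (subst (λ v → Anc v x) (sym eq) (anc-parent (∈⇒≢w (j , j<s , refl)) b)) ¬a
      ... | no _  | no _  = distinct i<s j<s eq

    shift-compact : Compact w s c′
    shift-compact = record
      { distinct = shift-distinct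
      ; head∈    = shift-new
      ; closed   = closed′ }
      where
      closed′ : ∀ {v} → Occupied s c′ v → v ≢ w → Occupied s c′ (par w v)
      closed′ v∈′ v≢w with shift-occupied⁻ v∈′
      ... | inj₁ v≡w = contradiction v≡w v≢w
      ... | inj₂ (v∈ , _) with towards v∈
      ...   | inj₁ (_ , eq) = subst (Occupied s c′) (sym eq) shift-new
      ...   | inj₂ p∈       = shift-occupied⁺ p∈ (leaf v∈)

    shift-step : Step s c c′
    shift-step = record
      { moves = moves
      ; new   = w
      ; new∈  = shift-new
      ; new∉  = w∉
      ; only  = λ v∈ v∉ → case shift-occupied⁻ v∈ of λ { (inj₁ eq) → eq ; (inj₂ (v∈ , _)) → contradiction v∈ v∉ } }
      where
      moves : ∀ {i} → i < s → c i ≡ c′ i ⊎ E G (c i) (c′ i)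
      moves {i} i<s with anc? w (c i) x
      ... | yes _ = inj₂ (E-par (∈⇒≢w (i , i<s , refl)))
      ... | no _  = inj₁ refl

-- Post-order traversal from one end of a longest path

module Traversal {n : ℕ} (G : Graph n) (tree : IsTree G) (z r : Fin n) (diametral : Separation.Diametral G tree r z)
                 (adj : Fin n → List (Fin n)) (isAdj : IsAdjacencyLists G adj) where

  open Metric G tree
  open Separation G tree
  open Shifting G tree
  open Rooted G tree z
  open import Data.List.Membership.DecPropositional (_≟ᶠ_ {n}) using (_∈?_)

  bump : Fin n → (Fin n → ℕ) → Fin n → ℕ
  bump u cnt v = if does (u ≟ᶠ v) then suc (cnt v) else cnt v

  -- The head h walks through the tree in post-order, starting at r: V lists the visited vertices, F 0 , … , F (f - 1)
  -- the finished ones in the order of completion, and cnt v counts the inspected neighbours of v.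
  record Trav (h : Fin n) (V : List (Fin n)) (F : ℕ → Fin n) (f : ℕ) (cnt : Fin n → ℕ) : Set where
    field
      h∈V           : h ∈ V
      h∉F           : ¬ Occupied f F h
      F⊆V           : ∀ {v} → Occupied f F v → v ∈ V
      V-unique      : Unique V
      F-injective   : ∀ {i j} → i < f → j < f → F i ≡ F j → i ≡ j
      active-anc    : ∀ {v} → v ∈ V → ¬ Occupied f F v → Anc v h
      ordered       : ∀ {j w} → j < f → w ≢ z → parent w ≡ F j → Occupied j F w
      consumed      : ∀ v i → toℕ i < cnt v → lookup (adj v) i ≡ parent v ⊎ lookup (adj v) i ∈ V
      cnt≤          : ∀ v → cnt v ≤ length (adj v)
      -- The spine is the path from `r` to `z`, which the head climbs from below. Its unvisited
      -- vertices are above the head, only its vertices can have an unvisited parent, and those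
      -- below a visited spine vertex are finished.
      spine-above   : ∀ {v} → Anc v r → v ∉ V → Anc v h
      spine-entered : ∀ {v} → v ∈ V → v ≢ z → parent v ∉ V → Anc v r
      spine-done    : ∀ {v} → Anc v r → v ≢ z → parent v ∈ V → Occupied f F v

    child-done : ∀ {v w} → Occupied f F v → w ≢ z → parent w ≡ v → Occupied f F w
    child-done (j , j<f , eq) w≢z pw with i , i<j , e ← ordered j<f w≢z (trans pw (sym eq)) = i , <-trans i<j j<f , e

    descendant-done : ∀ {u v} → Occupied f F u → Anc u v → Occupied f F v
    descendant-done u∈ self          = u∈
    descendant-done u∈ (below v≢z a) = child-done (descendant-done u∈ a) v≢z refl

    parent∉F : h ≢ z → ¬ Occupied f F (parent h)
    parent∉F h≢z p∈ = h∉F (child-done p∈ h≢z refl)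

  trav-start : Trav r (r ∷ []) (λ _ → r) 0 (λ _ → 0)
  trav-start = record
    { h∈V           = here refl
    ; h∉F           = λ ()
    ; F⊆V           = λ ()
    ; V-unique      = [] ∷ []
    ; F-injective   = λ ()
    ; active-anc    = λ { (here refl) _ → self }
    ; ordered       = λ ()
    ; consumed      = λ _ _ ()
    ; cnt≤          = λ _ → z≤n
    ; spine-above   = λ a _ → a
    ; spine-entered = λ { (here refl) _ _ → self }
    ; spine-done    = λ { a v≢z (here eq) → contradiction (anc-dep a) (<⇒≱ (≤-reflexive (trans (cong (suc ∘ dep) (sym eq)) (sym (dep-parent v≢z))))) } }

  trav-consume : ∀ {h V F f cnt} → Trav h V F f cnt → ∀ u i → toℕ i ≡ cnt u → lookup (adj u) i ≡ parent u ⊎ lookup (adj u) i ∈ V →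
                 Trav h V F f (bump u cnt)
  trav-consume {cnt = cnt} t u i i≡ ok = record
    { Trav t hiding (consumed; cnt≤) ; consumed = consumed′ ; cnt≤ = cnt≤′ }
    where
    open Trav t
    consumed′ : ∀ v j → toℕ j < bump u cnt v → lookup (adj v) j ≡ parent v ⊎ lookup (adj v) j ∈ _
    consumed′ v j j< with u ≟ᶠ v
    ... | no _     = consumed v j j<
    ... | yes refl with m≤n⇒m<n∨m≡n (≤-pred j<)
    ...   | inj₁ lt = consumed v j lt
    ...   | inj₂ eq with refl ← toℕ-injective {i = j} {j = i} (trans eq (sym i≡)) = ok
    cnt≤′ : ∀ v → bump u cnt v ≤ length (adj v)
    cnt≤′ v with u ≟ᶠ v
    ... | no _     = cnt≤ v
    ... | yes refl = ≤-trans (s≤s (≤-reflexive (sym i≡))) (toℕ<n i)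

  trav-down : ∀ {h V F f cnt w} → Trav h V F f cnt → w ≢ z → parent w ≡ h → w ∉ V → Trav w (w ∷ V) F f cnt
  trav-down {h} {V} {F} {f} {cnt} {w} t w≢z refl w∉ = record
    { h∈V           = here refl
    ; h∉F           = w∉ ∘ F⊆V
    ; F⊆V           = there ∘ F⊆V
    ; V-unique      = All.tabulate (λ v∈ w≡v → w∉ (subst (_∈ V) (sym w≡v) v∈)) ∷ V-unique
    ; F-injective   = F-injective
    ; active-anc    = λ { (here refl) _ → self ; (there v∈) v∉ → below w≢z (active-anc v∈ v∉) }
    ; ordered       = ordered
    ; consumed      = λ v i i< → case consumed v i i< of λ { (inj₁ eq) → inj₁ eq ; (inj₂ v∈) → inj₂ (there v∈) }
    ; cnt≤          = cnt≤
    ; spine-above   = λ a v∉ → below w≢z (spine-above a (v∉ ∘ there))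
    ; spine-entered = λ { (here refl) _ p∉ → contradiction (there h∈V) p∉ ; (there v∈) v≢z p∉ → spine-entered v∈ v≢z (p∉ ∘ there) }
    ; spine-done    = λ { a v≢z (there p∈) → spine-done a v≢z p∈
                        ; a v≢z (here refl) → contradiction (anc-dep (spine-above (anc-parent v≢z a) w∉)) (<⇒≱ (≤-reflexive (sym (dep-parent w≢z)))) } }
    where open Trav t

  -- Covers at once the return to a parent seen before, with `V′ = V`, and the first ascent to a new
  -- spine vertex.
  record Visit (w : Fin n) (V V′ : List (Fin n)) : Set where
    field
      old    : ∀ {v} → v ∈ V → v ∈ V′
      new    : w ∈ V′
      only   : ∀ {v} → v ∈ V′ → v ≡ w ⊎ v ∈ V
      unique : Unique V′

  children-visited : ∀ {h V F f cnt} → Trav h V F f cnt → ∀ {c} → cnt (parent c) ≡ length (adj (parent c)) → c ≢ z → c ∈ V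
  children-visited {V = V} t {c} full c≢z = decide (consumed (parent c) i (subst (toℕ i <_) (sym full) (toℕ<n i)))
    where
    open Trav t
    c∈ : c ∈ adj (parent c)
    c∈ = Equivalence.from (proj₂ (isAdj (parent c)) c) (symE G (E-par c≢z))

    i : Fin (length (adj (parent c)))
    i = Any.index c∈

    at-i : c ≡ lookup (adj (parent c)) i
    at-i = Anyₚ.lookup-index c∈

    grandparent : c ≢ parent (parent c)
    grandparent eq with parent c ≟ᶠ z
    -- The junk value `parent z = z` would make `c` the root.
    ... | yes pc≡z = c≢z (trans eq (trans (cong parent pc≡z) (par-self z)))
    ... | no pc≢z = <-asym (≤-reflexive (sym (dep-parent c≢z))) (≤-reflexive (trans (cong (suc ∘ dep) eq) (sym (dep-parent pc≢z))))

    decide : lookup (adj (parent c)) i ≡ parent (parent c) ⊎ lookup (adj (parent c)) i ∈ V → c ∈ V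
    decide (inj₁ eq) = contradiction (trans at-i eq) grandparent
    decide (inj₂ v∈) = subst (_∈ V) (sym at-i) v∈

  parent-unfinished : ∀ {h V F f cnt} → Trav h V F f cnt → h ≢ z → ¬ Occupied (suc f) (update F f h) (parent h)
  parent-unfinished t h≢z p∈ = case occupied-push⁻ p∈ of λ { (inj₁ eq) → parent≢ h≢z eq ; (inj₂ p∈) → Trav.parent∉F t h≢z p∈ }

  active-above : ∀ {h V V′ F f cnt} → Trav h V F f cnt → Visit (parent h) V V′ →
                 ∀ {v} → v ∈ V′ → ¬ Occupied (suc f) (update F f h) v → Anc v (parent h)
  active-above {h} {F = F} {f} t visit v∈ v∉ with Visit.only visit v∈
  ... | inj₁ refl = self
  ... | inj₂ v∈V  = anc-up (Trav.active-anc t v∈V (v∉ ∘ occupied-push⁺)) λ { refl → v∉ (occupied-push-new F f h) }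

  trav-up : ∀ {h V V′ F f cnt} → Trav h V F f cnt → h ≢ z → cnt h ≡ length (adj h) → Visit (parent h) V V′ →
            Trav (parent h) V′ (update F f h) (suc f) cnt
  trav-up {h} {V} {V′} {F} {f} {cnt} t h≢z full visit = record
    { h∈V           = new
    ; h∉F           = parent-unfinished t h≢z
    ; F⊆V           = λ v∈ → case occupied-push⁻ v∈ of λ { (inj₁ refl) → old h∈V ; (inj₂ v∈) → old (F⊆V v∈) }
    ; V-unique      = unique
    ; F-injective   = injective-push F-injective h∉F
    ; active-anc    = active-above t visit
    ; ordered       = ordered′
    ; consumed      = λ v i i< → case consumed v i i< of λ { (inj₁ eq) → inj₁ eq ; (inj₂ v∈) → inj₂ (old v∈) }
    ; cnt≤          = cnt≤
    ; spine-above   = λ a v∉ → anc-up (spine-above a (v∉ ∘ old)) λ { refl → v∉ (old h∈V) }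
    ; spine-entered = entered
    ; spine-done    = done }
    where
    open Trav t
    open Visit visit

    lift : ∀ {j w} → j ≤ f → Occupied j F w → Occupied j (update F f h) w
    lift j≤f (i , i<j , eq) = i , i<j , trans (update-other F f h (λ f≡i → <⇒≢ (≤-trans i<j j≤f) (sym f≡i))) eq

    ordered′ : ∀ {j w} → j < suc f → w ≢ z → parent w ≡ update F f h j → Occupied j (update F f h) w
    ordered′ {j} {w} j< w≢z eq with f ≟ j
    ... | no f≢j = lift (≤-pred j<) (ordered (≤∧≢⇒< (≤-pred j<) (f≢j ∘ sym)) w≢z (trans eq (update-other F f h f≢j)))
    ... | yes refl with pw≡h ← trans eq (update-same F f h) with any? (λ i → F (toℕ {f} i) ≟ᶠ w)
    ...   | yes (i , e) = lift ≤-refl (toℕ i , toℕ<n i , e)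
    -- A visited child of `h` that is not finished would be active, hence an ancestor of `h`,
    -- although it is deeper.
    ...   | no ¬d = contradiction (anc-dep (active-anc w∈ w∉)) (<⇒≱ (≤-reflexive (trans (cong (suc ∘ dep) (sym pw≡h)) (sym (dep-parent w≢z)))))
      where
      w∈ : w ∈ V
      w∈ = children-visited t (subst (λ v → cnt v ≡ length (adj v)) (sym pw≡h) full) w≢z
      w∉ : ¬ Occupied f F w
      w∉ (i , i<f , e) = ¬d (fromℕ< i<f , trans (cong F (toℕ-fromℕ< i<f)) e)

    entered : ∀ {v} → v ∈ V′ → v ≢ z → parent v ∉ V′ → Anc v r
    entered v∈ v≢z p∉ with only v∈
    ... | inj₂ v∈V = spine-entered v∈V v≢z (p∉ ∘ old)
    ... | inj₁ refl with parent h ∈? V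
    ...   | yes p∈ = spine-entered p∈ v≢z (p∉ ∘ old)
    ...   | no p∉V = anc-parent h≢z (spine-entered h∈V h≢z p∉V)

    done : ∀ {v} → Anc v r → v ≢ z → parent v ∈ V′ → Occupied (suc f) (update F f h) v
    done a v≢z p∈ with only p∈
    ... | inj₂ p∈V = occupied-push⁺ (spine-done a v≢z p∈V)
    ... | inj₁ eq with parent h ∈? V
    ...   | yes p∈V = occupied-push⁺ (spine-done a v≢z (subst (_∈ V) (sym eq) p∈V))
    ...   | no p∉V  = subst (Occupied _ _) (anc-unique (spine-entered h∈V h≢z p∉V) a
                        (trans (dep-parent h≢z) (trans (cong (suc ∘ dep) (sym eq)) (sym (dep-parent v≢z))))) (occupied-push-new F f h)

  -- The traversal may stop on reaching `z`, without inspecting its neighbours: since `z` ends a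
  -- longest path, every child of `z` is on the spine, so it is finished together with everything
  -- below it.
  trav-complete : ∀ {h V F f cnt} → Trav h V F f cnt → h ≡ z → ∀ v → v ∈ V
  trav-complete t refl v with v ≟ᶠ z
  ... | yes refl = Trav.h∈V t
  ... | no v≢z with c≢z , pc≡z , a ← anc-step (anc-root v) (v≢z ∘ sym) = F⊆V (descendant-done (spine-done (on-spine c≢z pc≡z) c≢z (subst (_∈ _) (sym pc≡z) h∈V)) a)
    where
    open Trav t
    -- A second branch at z would prolong the longest path.
    on-spine : ∀ {c} → c ≢ z → parent c ≡ z → Anc c r
    on-spine {c} c≢z pc≡z with side-total (symE G (E-par c≢z)) r
    ... | inj₁ s = side⇒anc c≢z s
    ... | inj₂ s = contradiction (diametral c r) (<⇒≱ (≤-reflexive (trans (cong suc (trans (δ-sym r z) (cong (λ v → δ v r) (sym pc≡z)))) (sym s))))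

  -- The occupied vertices during the traversal

  module _ (κ : ℕ) where

    -- The occupied vertices are the kept finished ones F q , … , F (f - 1) and the active ones from top down to the head.
    record Link (h top : Fin n) (V : List (Fin n)) (F : ℕ → Fin n) (f q s : ℕ) (c : ℕ → Fin n) : Set where
      field
        compact : Compact h s c
        S⊆V     : ∀ {v} → Occupied s c v → v ∈ V
        top∈V   : top ∈ V
        top∉F   : ¬ Occupied f F top
        top-low : ∀ {v} → v ∈ V → ¬ Occupied f F v → Occupied s c v → dep top ≤ dep v
        top-in  : ∀ {v} → v ∈ V → ¬ Occupied f F v → dep top ≤ dep v → Occupied s c v
        q≤f     : q ≤ f
        kept    : ∀ {j} → q ≤ j → j < f → Occupied s c (F j)
        gone    : ∀ {j} → j < q → ¬ Occupied s c (F j)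
        deep    : ∀ {v} → v ∈ V → ¬ Occupied f F v → ¬ Occupied s c v → Deep κ v (par h v)

      kept-push : ∀ {j} → q ≤ j → j < suc f → Occupied s c (update F f h j)
      kept-push {j} q≤j j< with f ≟ j
      ... | yes refl = subst (Occupied s c) (sym (update-same F f h)) (Compact.head∈ compact)
      ... | no f≢j   = subst (Occupied s c) (sym (update-other F f h f≢j)) (kept q≤j (≤∧≢⇒< (≤-pred j<) (f≢j ∘ sym)))

      gone-push : ∀ {j} → j < q → ¬ Occupied s c (update F f h j)
      gone-push j<q = subst (λ v → ¬ Occupied s c v) (sym (update-other F f h λ f≡j → <⇒≢ (≤-trans j<q q≤f) (sym f≡j))) (gone j<q)

    link-start : Link r r (r ∷ []) (λ _ → r) 0 0 1 (λ _ → r)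
    link-start = record
      { compact = record
        { distinct = λ { (s≤s z≤n) (s≤s z≤n) _ → refl } ; head∈ = 0 , s≤s z≤n , refl ; closed = λ { (_ , _ , refl) r≢r → contradiction refl r≢r } }
      ; S⊆V     = λ { (_ , _ , refl) → here refl }
      ; top∈V   = here refl
      ; top∉F   = λ ()
      ; top-low = λ { (here refl) _ _ → ≤-refl }
      ; top-in  = λ { (here refl) _ _ → 0 , s≤s z≤n , refl }
      ; q≤f     = z≤n
      ; kept    = λ _ ()
      ; gone    = λ ()
      ; deep    = λ { (here refl) _ v∉ → contradiction (0 , s≤s z≤n , refl) v∉ } }

    -- The situation just before w is occupied and becomes the head.
    record Arriving (h w top : Fin n) (V : List (Fin n)) (F : ℕ → Fin n) (f q s : ℕ) (c : ℕ → Fin n) : Set where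
      field
        hw      : E G h w
        w∉S     : ¬ Occupied s c w
        compact : Compact h s c
        S⊆V     : ∀ {v} → Occupied s c v → v ∈ V
        top∈V   : top ∈ V
        top∉F   : ¬ Occupied f F top
        top≤w   : dep top ≤ dep w
        top-low : ∀ {v} → v ∈ V → ¬ Occupied f F v → Occupied s c v → dep top ≤ dep v
        top-in  : ∀ {v} → v ∈ V → ¬ Occupied f F v → dep top ≤ dep v → v ≡ w ⊎ Occupied s c v
        q≤f     : q ≤ f
        kept    : ∀ {j} → q ≤ j → j < f → Occupied s c (F j)
        gone    : ∀ {j} → j < q → ¬ Occupied s c (F j)
        deep    : ∀ {v} → v ∈ V → ¬ Occupied f F v → ¬ Occupied s c v → v ≢ w → Deep κ v (par w v)

    arrive-down : ∀ {h top V F f q s c cnt w} → Trav h V F f cnt → Link h top V F f q s c → w ≢ z → parent w ≡ h → w ∉ V →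
                  Arriving h w top (w ∷ V) F f q s c
    arrive-down {h} {top} {V} {F} {f} {q} {s} {c} {w = w} t l w≢z refl w∉ = record
      { hw = hw ; w∉S = w∉ ∘ S⊆V ; compact = compact ; S⊆V = there ∘ S⊆V ; top∈V = there top∈V ; top∉F = top∉F
      ; top≤w   = ≤-trans (anc-dep (active-anc top∈V top∉F)) (≤-trans (n≤1+n _) (≤-reflexive (sym (dep-parent w≢z))))
      ; top-low = λ { (here refl) _ v∈ → contradiction (S⊆V v∈) w∉ ; (there v∈) → top-low v∈ }
      ; top-in  = λ { (here refl) _ _ → inj₁ refl ; (there v∈) v∉ d≤ → inj₂ (top-in v∈ v∉ d≤) }
      ; q≤f = q≤f ; kept = kept ; gone = gone
      ; deep    = λ { (here refl) _ _ w≢w → contradiction refl w≢w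
                    ; {v} (there v∈) v∉F v∉S v≢w → subst (Deep κ v) (sym (par-reroot hw (λ { refl → v∉S (Compact.head∈ compact) }) v≢w)) (deep v∈ v∉F v∉S) } }
      where
      open Trav t using (active-anc)
      open Link l
      hw : E G h w
      hw = symE G (E-par w≢z)

    -- Active vertices are ancestors of `h`, so with `top = h` the only occupied active one is `h`.
    -- Once `h` is finished, none is left below its unoccupied parent, which becomes the new top.
    arrive-up : ∀ {h V V′ F f q s c cnt} → Trav h V F f cnt → Link h h V F f q s c → h ≢ z → Visit (parent h) V V′ →
                Arriving h (parent h) (parent h) V′ (update F f h) (suc f) q s c
    arrive-up {h} {V} {V′} {F} {f} {q} {s} {c} t l h≢z visit = record
      { hw = E-par h≢z ; w∉S = w∉S ; compact = compact ; S⊆V = old ∘ S⊆V ; top∈V = new ; top∉F = parent-unfinished t h≢z ; top≤w = ≤-refl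
      ; top-low = λ v∈ v∉ v∈S → contradiction (anc-dep (active-above t visit v∈ v∉)) (<⇒≱ (low v∈ v∉ v∈S))
      ; top-in  = λ v∈ v∉ d≤ → inj₁ (anc-antisym (active-above t visit v∈ v∉) d≤)
      ; q≤f     = m≤n⇒m≤1+n q≤f
      ; kept    = kept-push
      ; gone    = gone-push
      ; deep    = deep′ }
      where
      open Trav t
      open Link l
      open Visit visit

      below-h : dep (parent h) < dep h
      below-h = ≤-reflexive (sym (dep-parent h≢z))

      w∉S : ¬ Occupied s c (parent h)
      w∉S p∈ = <⇒≱ below-h (top-low (S⊆V p∈) (parent∉F h≢z) p∈)

      low : ∀ {v} → v ∈ V′ → ¬ Occupied (suc f) (update F f h) v → Occupied s c v → dep (parent h) < dep v
      low v∈ v∉ v∈S = ≤-trans below-h (top-low (S⊆V v∈S) (v∉ ∘ occupied-push⁺) v∈S)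

      deep′ : ∀ {v} → v ∈ V′ → ¬ Occupied (suc f) (update F f h) v → ¬ Occupied s c v → v ≢ parent h → Deep κ v (par (parent h) v)
      deep′ {v} v∈ v∉ v∉S v≢p with only v∈
      ... | inj₁ v≡p = contradiction v≡p v≢p
      ... | inj₂ v∈V = subst (Deep κ v) (sym (par-reroot (E-par h≢z) (λ { refl → v∉S (Compact.head∈ compact) }) v≢p)) (deep v∈V (v∉ ∘ occupied-push⁺) v∉S)

    -- The path from `top` down to `h` is occupied, so a head strictly below `top` returns to its
    -- parent without any move of the agents.
    link-hit : ∀ {h top V F f q s c cnt} → Trav h V F f cnt → Link h top V F f q s c → h ≢ top →
               h ≢ z × parent h ∈ V × Link (parent h) top V (update F f h) (suc f) q s c
    link-hit {h} {top} {V} {F} {f} {q} {s} {c} t l h≢top = h≢z , S⊆V p∈S , record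
      { compact = record { distinct = distinct ; head∈ = p∈S ; closed = closed′ }
      ; S⊆V     = S⊆V
      ; top∈V   = top∈V
      ; top∉F   = λ t∈ → case occupied-push⁻ t∈ of λ { (inj₁ eq) → h≢top (sym eq) ; (inj₂ t∈) → top∉F t∈ }
      ; top-low = λ v∈ v∉ → top-low v∈ (v∉ ∘ occupied-push⁺)
      ; top-in  = λ v∈ v∉ → top-in v∈ (v∉ ∘ occupied-push⁺)
      ; q≤f     = m≤n⇒m≤1+n q≤f
      ; kept    = kept-push
      ; gone    = gone-push
      ; deep    = λ {v} v∈ v∉ v∉S → subst (Deep κ v) (sym (par-reroot (E-par h≢z) (λ { refl → v∉S head∈ }) (λ { refl → v∉S p∈S }))) (deep v∈ (v∉ ∘ occupied-push⁺) v∉S) }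
      where
      open Trav t
      open Link l
      open Compact compact

      top-anc : Anc top h
      top-anc = active-anc top∈V top∉F

      h≢z : h ≢ z
      h≢z refl = h≢top (sym (anc-antisym top-anc (≤-trans (≤-reflexive (δ-refl z)) z≤n)))

      climb : ∀ m {v} → δ v h ≡ m → Occupied s c v → Anc v h → v ≢ h → Occupied s c (parent h)
      climb zero    eq v∈ a v≢h = contradiction (δ≡0⇒≡ eq) v≢h
      climb (suc m) {v} eq v∈ a v≢h with u≢z , pu≡v , a′ ← anc-step a v≢h with par h v ≟ᶠ h
      ... | yes u≡h = subst (Occupied s c) (trans (sym pu≡v) (cong parent u≡h)) v∈
      ... | no u≢h  = climb m (suc-injective (trans (sym (δ-par v≢h)) eq)) (closed v∈ v≢h) a′ u≢h

      p∈S : Occupied s c (parent h)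
      p∈S = climb _ refl (top-in top∈V top∉F ≤-refl) top-anc (h≢top ∘ sym)

      closed′ : ∀ {v} → Occupied s c v → v ≢ parent h → Occupied s c (par (parent h) v)
      closed′ {v} v∈ v≢p with v ≟ᶠ h
      ... | yes refl = subst (Occupied s c) (sym (par-adjacent (E-par h≢z))) p∈S
      ... | no v≢h   = subst (Occupied s c) (sym (par-reroot (E-par h≢z) v≢h v≢p)) (closed v∈ v≢h)

    -- Used while agents are still missing: the first `k` visited vertices make up the initial
    -- configuration, and nobody is evicted.
    place : ∀ {h w top V F f q s c cnt} → Trav w V F f cnt → Arriving h w top V F f q s c → Link w top V F f q (suc s) (update c s w)
    place {h} {w} {top} {V} {F} {f} {q} {s} {c} t a = record
      { compact = record { distinct = injective-push distinct w∉S ; head∈ = occupied-push-new c s w ; closed = closed′ }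
      ; S⊆V     = λ v∈ → case occupied-push⁻ v∈ of λ { (inj₁ refl) → h∈V ; (inj₂ v∈) → S⊆V v∈ }
      ; top∈V   = top∈V
      ; top∉F   = top∉F
      ; top-low = λ v∈ v∉ v∈S → case occupied-push⁻ v∈S of λ { (inj₁ refl) → top≤w ; (inj₂ v∈S) → top-low v∈ v∉ v∈S }
      ; top-in  = λ v∈ v∉ d≤ → case top-in v∈ v∉ d≤ of λ { (inj₁ refl) → occupied-push-new c s w ; (inj₂ v∈S) → occupied-push⁺ v∈S }
      ; q≤f     = q≤f
      ; kept    = λ q≤j j<f → occupied-push⁺ (kept q≤j j<f)
      ; gone    = λ j<q v∈ → case occupied-push⁻ v∈ of λ { (inj₁ eq) → h∉F (_ , ≤-trans j<q q≤f , eq) ; (inj₂ v∈) → gone j<q v∈ }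
      ; deep    = λ v∈ v∉ v∉S → deep v∈ v∉ (v∉S ∘ occupied-push⁺) λ { refl → v∉S (occupied-push-new c s w) } }
      where
      open Trav t
      open Arriving a
      open Compact compact
      closed′ : ∀ {v} → Occupied (suc s) (update c s w) v → v ≢ w → Occupied (suc s) (update c s w) (par w v)
      closed′ {v} v∈ v≢w with occupied-push⁻ v∈
      ... | inj₁ v≡w = contradiction v≡w v≢w
      ... | inj₂ v∈S with v ≟ᶠ h
      ...   | yes refl = subst (Occupied _ _) (sym (par-adjacent hw)) (occupied-push-new c s w)
      ...   | no v≢h   = occupied-push⁺ (subst (Occupied s c) (sym (par-reroot hw v≢h v≢w)) (closed v∈S v≢h))

    evict-finished : ∀ {h w top V F f q s c cnt} → Trav w V F f cnt → Arriving h w top V F f q s c → q < f →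
                     Occupied s c (F q) × (∀ {v} → Occupied s c v → par w v ≢ F q) × Link w top V F f (suc q) s (shift (F q) w c) × Step s c (shift (F q) w c)
    evict-finished {h} {w} {top} {V} {F} {f} {q} {s} {c} t a q<f = x∈ , leaf , record
      { compact = shift-compact compact hw w∉S x∈ leaf
      ; S⊆V     = λ v∈ → case occupied⁻ v∈ of λ { (inj₁ refl) → h∈V ; (inj₂ (v∈ , _)) → S⊆V v∈ }
      ; top∈V   = top∈V
      ; top∉F   = top∉F
      ; top-low = λ v∈ v∉ v∈S → case occupied⁻ v∈S of λ { (inj₁ refl) → top≤w ; (inj₂ (v∈S , _)) → top-low v∈ v∉ v∈S }
      ; top-in  = λ v∈ v∉ d≤ → case top-in v∈ v∉ d≤ of λ { (inj₁ refl) → new ; (inj₂ v∈S) → occupied⁺ v∈S λ { refl → v∉ (q , q<f , refl) } }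
      ; q≤f     = q<f
      ; kept    = λ q<j j<f → occupied⁺ (kept (<⇒≤ q<j) j<f) λ eq → <⇒≢ q<j (sym (F-injective j<f q<f eq))
      ; gone    = gone′
      ; deep    = λ v∈ v∉ v∉S → deep v∈ v∉ (λ v∈S → v∉S (occupied⁺ v∈S λ { refl → v∉ (q , q<f , refl) })) λ { refl → v∉S new } } ,
      shift-step compact hw w∉S x∈ leaf
      where
      open Trav t
      open Arriving a

      x∈ : Occupied s c (F q)
      x∈ = kept ≤-refl q<f

      -- The children of F q were finished, hence evicted, before it.
      leaf : ∀ {v} → Occupied s c v → par w v ≢ F q
      leaf {v} v∈ eq with v ≟ᶠ w
      ... | yes refl = w∉S v∈
      ... | no v≢w with edge-parent (E-par v≢w)
      ...   | inj₁ (v≢z , pv≡) with i , i<q , refl ← ordered q<f v≢z (trans pv≡ eq) = gone i<q v∈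
      -- Here `v` is the parent of `F q`, and `w` lies below `F q`; but all vertices below a
      -- finished vertex are finished, and the new head `w` is not.
      ...   | inj₂ (x≢z , px≡v) = h∉F (descendant-done (q , q<f , sym eq) (side⇒anc x≢z (subst (λ u → Side u (par w v) w) (sym px≡v) (side-par v≢w))))

      occupied⁻ : ∀ {v} → Occupied s (shift (F q) w c) v → v ≡ w ⊎ (Occupied s c v × v ≢ F q)
      occupied⁻ = shift-occupied⁻ compact hw w∉S x∈ leaf

      occupied⁺ : ∀ {v} → Occupied s c v → v ≢ F q → Occupied s (shift (F q) w c) v
      occupied⁺ = shift-occupied⁺ compact hw w∉S x∈ leaf

      new : Occupied s (shift (F q) w c) w
      new = shift-new compact hw w∉S x∈ leaf

      gone′ : ∀ {j} → j < suc q → ¬ Occupied s (shift (F q) w c) (F j)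
      gone′ {j} j< v∈ with occupied⁻ v∈
      ... | inj₁ eq = h∉F (j , ≤-trans j< q<f , eq)
      ... | inj₂ (v∈S , ≢x) with m≤n⇒m<n∨m≡n (≤-pred j<)
      ...   | inj₁ j<q  = gone j<q v∈S
      ...   | inj₂ refl = ≢x refl

    -- `q = f` says that no finished vertex is occupied, so the `k` agents stand on ancestors of
    -- `w`. The highest of them is then at least `k` edges above `w`, and `w` itself witnesses
    -- `deep` for it.
    evict-top : ∀ {h w top V F f c cnt} → Trav w V F f cnt → Arriving h w top V F f f (suc κ) c →
                Occupied (suc κ) c top × top ≢ w × (∀ {v} → Occupied (suc κ) c v → par w v ≢ top) × Link w (par w top) V F f f (suc κ) (shift top w c) × Step (suc κ) c (shift top w c)
    evict-top {h} {w} {top} {V} {F} {f} {c} t a = x∈ , top≢w , leaf , record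
      { compact = shift-compact compact hw w∉S x∈ leaf
      ; S⊆V     = λ v∈ → case occupied⁻ v∈ of λ { (inj₁ refl) → h∈V ; (inj₂ (v∈ , _)) → S⊆V v∈ }
      ; top∈V   = case next of λ { (inj₁ eq) → subst (_∈ V) (sym eq) h∈V ; (inj₂ n∈) → S⊆V n∈ }
      ; top∉F   = case next of λ { (inj₁ eq) → subst (¬_ ∘ Occupied f F) (sym eq) h∉F ; (inj₂ n∈) → active n∈ }
      ; top-low = low
      ; top-in  = λ v∈ v∉ d≤ → case top-in v∈ v∉ (≤-trans (n≤1+n _) (≤-trans (≤-reflexive (sym next-dep)) d≤)) of λ
                    { (inj₁ refl) → new ; (inj₂ v∈S) → occupied⁺ v∈S λ { refl → <⇒≱ (≤-reflexive (sym next-dep)) d≤ } }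
      ; q≤f     = q≤f
      ; kept    = λ f≤j j<f → contradiction f≤j (<⇒≱ j<f)
      ; gone    = λ j<f v∈ → case occupied⁻ v∈ of λ { (inj₁ eq) → h∉F (_ , j<f , eq) ; (inj₂ (v∈ , _)) → gone j<f v∈ }
      ; deep    = deep′ } ,
      shift-step compact hw w∉S x∈ leaf
      where
      open Trav t
      open Arriving a

      active : ∀ {v} → Occupied (suc κ) c v → ¬ Occupied f F v
      active v∈ (j , j<f , refl) = gone j<f v∈

      ancestor : ∀ {v} → Occupied (suc κ) c v → Anc v w
      ancestor v∈ = active-anc (S⊆V v∈) (active v∈)

      ∈⇒≢w : ∀ {v} → Occupied (suc κ) c v → v ≢ w
      ∈⇒≢w v∈ refl = w∉S v∈

      top≢w : top ≢ w
      top≢w refl with h∈ ← Compact.head∈ compact = ∈⇒≢w h∈ (anc-antisym (ancestor h∈) (top-low (S⊆V h∈) (active h∈) h∈))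

      x∈ : Occupied (suc κ) c top
      x∈ = case top-in top∈V top∉F ≤-refl of λ { (inj₁ eq) → contradiction eq top≢w ; (inj₂ t∈) → t∈ }

      leaf : ∀ {v} → Occupied (suc κ) c v → par w v ≢ top
      leaf v∈ eq = <⇒≱ (≤-reflexive (trans (sym (anc-step-dep (ancestor v∈) (∈⇒≢w v∈))) (cong dep eq))) (top-low (S⊆V v∈) (active v∈) v∈)

      next-dep : dep (par w top) ≡ suc (dep top)
      next-dep = anc-step-dep (ancestor x∈) top≢w

      next : par w top ≡ w ⊎ Occupied (suc κ) c (par w top)
      next with top ≟ᶠ h
      ... | yes refl  = inj₁ (par-adjacent hw)
      ... | no top≢h = inj₂ (subst (Occupied _ c) (sym (par-reroot hw top≢h top≢w)) (Compact.closed compact x∈ top≢h))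

      occupied⁻ : ∀ {v} → Occupied (suc κ) (shift top w c) v → v ≡ w ⊎ (Occupied (suc κ) c v × v ≢ top)
      occupied⁻ = shift-occupied⁻ compact hw w∉S x∈ leaf

      occupied⁺ : ∀ {v} → Occupied (suc κ) c v → v ≢ top → Occupied (suc κ) (shift top w c) v
      occupied⁺ = shift-occupied⁺ compact hw w∉S x∈ leaf

      new : Occupied (suc κ) (shift top w c) w
      new = shift-new compact hw w∉S x∈ leaf

      low : ∀ {v} → v ∈ V → ¬ Occupied f F v → Occupied (suc κ) (shift top w c) v → dep (par w top) ≤ dep v
      low v∈ v∉ v∈S with occupied⁻ v∈S
      ... | inj₁ refl = anc-dep (proj₂ (proj₂ (anc-step (ancestor x∈) top≢w)))
      ... | inj₂ (v∈c , v≢top) with m≤n⇒m<n∨m≡n (top-low v∈ v∉ v∈c)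
      ...   | inj₁ lt = ≤-trans (≤-reflexive next-dep) lt
      ...   | inj₂ eq = contradiction (anc-unique (ancestor v∈c) (ancestor x∈) (sym eq)) v≢top

      -- The k occupied vertices are ancestors of h of pairwise different depths.
      long : κ + dep top ≤ dep h
      long = +-cancelˡ-≤ 1 _ _ (subst (suc κ + dep top ≤_) (cong suc (m∸n+n≡m (d≤h x∈))) (+-monoˡ-≤ (dep top) (injective⇒≤ {f = level} level-injective)))
        where
        d≤h : ∀ {v} → Occupied (suc κ) c v → dep v ≤ dep h
        d≤h v∈ = ≤-pred (≤-trans (anc-dep< (ancestor v∈) (∈⇒≢w v∈)) (δ-step z (symE G hw)))

        occ : ∀ (i : Fin (suc κ)) → Occupied (suc κ) c (c (toℕ i))
        occ i = toℕ i , toℕ<n i , refl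

        lo : ∀ {v} → Occupied (suc κ) c v → dep top ≤ dep v
        lo v∈ = top-low (S⊆V v∈) (active v∈) v∈

        level : Fin (suc κ) → Fin (suc (dep h ∸ dep top))
        level i = fromℕ< (s≤s (∸-monoˡ-≤ (dep top) (d≤h (occ i))))

        level-injective : ∀ {i j} → level i ≡ level j → i ≡ j
        level-injective {i} {j} eq = toℕ-injective (Compact.distinct compact (toℕ<n i) (toℕ<n j) (anc-unique (ancestor (occ i)) (ancestor (occ j))
          (∸-cancelʳ-≡ (lo (occ i)) (lo (occ j)) (fromℕ<-injective _ _ _ _ eq))))

      deep′ : ∀ {v} → v ∈ V → ¬ Occupied f F v → ¬ Occupied (suc κ) (shift top w c) v → Deep κ v (par w v)
      deep′ {v} v∈ v∉ v∉S with v ≟ᶠ top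
      ... | no v≢top = deep v∈ v∉ (λ v∈c → v∉S (occupied⁺ v∈c v≢top)) λ { refl → v∉S new }
      ... | yes refl = w , side-par top≢w , +-cancelʳ-≤ (suc (dep top)) _ _ (begin
        κ + suc (dep v)                    ≡⟨ +-suc κ (dep v) ⟩
        suc (κ + dep v)                    ≤⟨ s≤s long ⟩
        suc (dep h)                        ≤⟨ h<w ⟩
        dep w                              ≤⟨ δ-triangle w (par w v) z ⟩
        δ w (par w v) + dep (par w v)      ≡⟨ cong₂ _+_ (δ-sym w (par w v)) next-dep ⟩
        δ (par w v) w + suc (dep v)        ∎)
        where
        open ≤-Reasoning
        h<w : dep h < dep w
        h<w = anc-dep< (ancestor (Compact.head∈ compact)) (∈⇒≢w (Compact.head∈ compact))

-- The abstract machine and the length of its walk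

module Execution {n : ℕ} (G : Graph n) (tree : IsTree G) (z r : Fin n) (diametral : Separation.Diametral G tree r z)
                 (adj : Fin n → List (Fin n)) (isAdj : IsAdjacencyLists G adj) (κ : ℕ) where

  open Metric G tree
  open Separation G tree
  open Shifting G tree
  open Rooted G tree z
  open Traversal G tree z r diametral adj isAdj
  open import Data.List.Membership.DecPropositional (_≟ᶠ_ {n}) using (_∈?_)

  -- M lists the finished vertices whose parent had been evicted; cfg 0 , … , cfg T are the configurations so far.
  record Machine : Set where
    constructor machine
    field
      h top   : Fin n
      V M     : List (Fin n)
      F       : ℕ → Fin n
      f q s T : ℕ
      cfg     : ℕ → ℕ → Fin n
      cnt     : Fin n → ℕ

  open Machine

  now : Machine → ℕ → Fin n
  now m = cfg m (T m)

  -- `count` is the ledger: each placed agent and each step is paid for by a first visit, recorded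
  -- in `V`, or by a return to an evicted parent, recorded in `M`. `unfull` describes the filling
  -- phase, in which no step has been made.
  record Hist (m : Machine) : Set where
    field
      s≤k     : s m ≤ suc κ
      unfull  : s m < suc κ → T m ≡ 0 × (∀ {v} → v ∈ V m → Occupied (s m) (now m) v)
      emitted : ∀ {v} → v ∈ V m → ∃₂ λ t i → t ≤ T m × i < s m × cfg m t i ≡ v
      past    : ∀ {t} → t < T m → ∃ λ h′ → Compact h′ (s m) (cfg m t)
      steps   : ∀ {t} → t < T m → Step (s m) (cfg m t) (cfg m (suc t))
      count   : T m + s m ≡ length (V m) + length (M m)
      M-unique : Unique (M m)
      M-spec   : ∀ {u} → u ∈ M m → Occupied (f m) (F m) u × u ≢ z × Deep κ (parent u) u × ¬ Anc u r

  record Inv (m : Machine) : Set where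
    field
      trav : Trav (h m) (V m) (F m) (f m) (cnt m)
      link : Link κ (h m) (top m) (V m) (F m) (f m) (q m) (s m) (now m)
      hist : Hist m

  -- The head has decided to enter `w` and the payment is already booked in `V` or `M`, but no agent
  -- has moved; hence the successor in `count`.
  record Pending (m : Machine) (w : Fin n) : Set where
    field
      trav     : Trav w (V m) (F m) (f m) (cnt m)
      arriving : Arriving κ (h m) w (top m) (V m) (F m) (f m) (q m) (s m) (now m)
      s≤k      : s m ≤ suc κ
      unfull   : s m < suc κ → T m ≡ 0 × (∀ {v} → v ∈ V m → v ≡ w ⊎ Occupied (s m) (now m) v)
      emitted  : ∀ {v} → v ∈ V m → v ≡ w ⊎ ∃₂ λ t i → t ≤ T m × i < s m × cfg m t i ≡ v
      past     : ∀ {t} → t < T m → ∃ λ h′ → Compact h′ (s m) (cfg m t)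
      steps    : ∀ {t} → t < T m → Step (s m) (cfg m t) (cfg m (suc t))
      count    : suc (T m + s m) ≡ length (V m) + length (M m)
      M-unique : Unique (M m)
      M-spec   : ∀ {u} → u ∈ M m → Occupied (f m) (F m) u × u ≢ z × Deep κ (parent u) u × ¬ Anc u r

  start : Machine
  start = machine r r (r ∷ []) [] (λ _ → r) 0 0 1 0 (λ _ _ → r) (λ _ → 0)

  inv-start : Inv start
  inv-start = record { trav = trav-start ; link = link-start κ ; hist = record
    { s≤k = s≤s z≤n ; unfull = λ _ → refl , λ { (here refl) → 0 , s≤s z≤n , refl } ; emitted = λ { (here refl) → 0 , 0 , z≤n , s≤s z≤n , refl }
    ; past = λ () ; steps = λ () ; count = refl ; M-unique = [] ; M-spec = λ () } }

  skipped : Machine → Machine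
  skipped m = record m { cnt = bump (h m) (cnt m) }

  inv-skipped : ∀ {m} → Inv m → ∀ i → toℕ i ≡ cnt m (h m) → lookup (adj (h m)) i ≡ parent (h m) ⊎ lookup (adj (h m)) i ∈ V m → Inv (skipped m)
  inv-skipped I i eq ok = record { trav = trav-consume trav _ i eq ok ; link = link ; hist = record { Hist hist } }
    where open Inv I

  returned : Machine → Machine
  returned m = record m { h = parent (h m) ; F = update (F m) (f m) (h m) ; f = suc (f m) }

  stay : ∀ {w V} → w ∈ V → Unique V → Visit w V V
  stay w∈ u = record { old = id ; new = w∈ ; only = inj₂ ; unique = u }

  inv-returned : ∀ {m} → Inv m → cnt m (h m) ≡ length (adj (h m)) → h m ≢ top m → h m ≢ z × Inv (returned m)
  inv-returned {m} I full h≢top with h≢z , p∈ , link′ ← link-hit κ (Inv.trav I) (Inv.link I) h≢top = h≢z , record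
    { trav = trav-up trav h≢z full (stay p∈ (Trav.V-unique trav)) ; link = link′
    ; hist = record { Hist hist hiding (M-spec) ; M-spec = λ u∈ → case M-spec u∈ of λ { (u∈F , rest) → occupied-push⁺ u∈F , rest } } }
    where
    open Inv I
    open Hist hist

  descending : Machine → Fin n → Machine
  descending m w = record m { V = w ∷ V m ; cnt = bump (h m) (cnt m) }

  pending-descending : ∀ {m} → Inv m → ∀ i → toℕ i ≡ cnt m (h m) → lookup (adj (h m)) i ≢ parent (h m) → lookup (adj (h m)) i ∉ V m →
                       Pending (descending m (lookup (adj (h m)) i)) (lookup (adj (h m)) i)
  pending-descending {m} I i eq ≢p w∉ with w≢z , pw ← child (Equivalence.to (proj₂ (isAdj (h m)) _) (∈-lookup i)) ≢p = record
    { trav     = trav-consume (trav-down trav w≢z pw w∉) (h m) i eq (inj₂ (here refl))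
    ; arriving = arrive-down κ trav link w≢z pw w∉
    ; s≤k      = s≤k
    ; unfull   = λ s< → proj₁ (unfull s<) , λ { (here refl) → inj₁ refl ; (there v∈) → inj₂ (proj₂ (unfull s<) v∈) }
    ; emitted  = λ { (here refl) → inj₁ refl ; (there v∈) → inj₂ (emitted v∈) }
    ; past = past ; steps = steps
    ; count    = cong suc count
    ; M-unique = M-unique ; M-spec = M-spec }
    where
    open Inv I
    open Hist hist


  climbTo : Machine → List (Fin n) → List (Fin n) → Machine
  climbTo m V′ M′ = record m { V = V′ ; M = M′ ; F = update (F m) (f m) (h m) ; f = suc (f m) ; top = parent (h m) }

  -- The evicted parent is deep towards the head by `Link.deep`, and its neighbour in that direction
  -- is `h`. The edge is off the spine: a spine vertex with visited parent is finished, and `h` was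
  -- not.
  pending-revisit : ∀ {m} → Inv m → cnt m (h m) ≡ length (adj (h m)) → h m ≡ top m → h m ≢ z → parent (h m) ∈ V m →
                    Pending (climbTo m (V m) (h m ∷ M m)) (parent (h m))
  pending-revisit {m} I full refl h≢z p∈ = record
    { trav     = trav-up trav h≢z full visit
    ; arriving = arriving
    ; s≤k      = s≤k
    ; unfull   = λ s< → proj₁ (unfull s<) , λ v∈ → inj₂ (proj₂ (unfull s<) v∈)
    ; emitted  = inj₂ ∘ emitted
    ; past = past ; steps = steps
    ; count    = trans (cong suc count) (sym (+-suc _ _))
    ; M-unique = All.tabulate (λ { u∈ refl → Trav.h∉F trav (proj₁ (M-spec u∈)) }) ∷ M-unique
    ; M-spec   = λ { (here refl) → occupied-push-new (F m) (f m) (h m) , h≢z ,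
                       subst (Deep κ (parent (h m))) (par-adjacent (symE G (E-par h≢z))) (Link.deep link p∈ (Trav.parent∉F trav h≢z) (Arriving.w∉S arriving)) ,
                       λ a → Trav.h∉F trav (Trav.spine-done trav a h≢z p∈)
                   ; (there u∈) → case M-spec u∈ of λ { (u∈F , rest) → occupied-push⁺ u∈F , rest } } }
    where
    open Inv I
    open Hist hist
    visit : Visit (parent (h m)) (V m) (V m)
    visit = stay p∈ (Trav.V-unique trav)
    arriving : Arriving κ (h m) (parent (h m)) (parent (h m)) (V m) (update (F m) (f m) (h m)) (suc (f m)) (q m) (s m) (now m)
    arriving = arrive-up κ trav link h≢z visit
  pending-spine : ∀ {m} → Inv m → cnt m (h m) ≡ length (adj (h m)) → h m ≡ top m → h m ≢ z → parent (h m) ∉ V m →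
                  Pending (climbTo m (parent (h m) ∷ V m) (M m)) (parent (h m))
  pending-spine {m} I full refl h≢z p∉ = record
    { trav     = trav-up trav h≢z full visit
    ; arriving = arrive-up κ trav link h≢z visit
    ; s≤k      = s≤k
    ; unfull   = λ s< → proj₁ (unfull s<) , λ { (here refl) → inj₁ refl ; (there v∈) → inj₂ (proj₂ (unfull s<) v∈) }
    ; emitted  = λ { (here refl) → inj₁ refl ; (there v∈) → inj₂ (emitted v∈) }
    ; past = past ; steps = steps
    ; count    = cong suc count
    ; M-unique = M-unique
    ; M-spec   = λ u∈ → case M-spec u∈ of λ { (u∈F , rest) → occupied-push⁺ u∈F , rest } }
    where
    open Inv I
    open Hist hist
    visit : Visit (parent (h m)) (V m) (parent (h m) ∷ V m)
    visit = record { old = there ; new = here refl ; only = λ { (here eq) → inj₁ eq ; (there v∈) → inj₂ v∈ }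
                   ; unique = All.tabulate (λ v∈ p≡v → p∉ (subst (_∈ V m) (sym p≡v) v∈)) ∷ Trav.V-unique trav }

  placed : Machine → Fin n → Machine
  placed m w = record m { h = w ; s = suc (s m) ; cfg = update (cfg m) (T m) (update (now m) (s m) w) }

  inv-placed : ∀ {m w} → Pending m w → s m < suc κ → Inv (placed m w)
  inv-placed {m} {w} P s<k = record
    { trav = trav
    ; link = subst (Link κ w (top m) (V m) (F m) (f m) (q m) (suc (s m))) (sym now≡) (place κ trav arriving)
    ; hist = record
      { s≤k      = s<k
      ; unfull   = λ _ → T≡0 , λ v∈ → subst (λ c → Occupied (suc (s m)) c _) (sym now≡) (occ v∈)
      ; emitted  = λ v∈ → case occ v∈ of λ { (i , i< , eq) → T m , i , ≤-refl , i< , trans (cong (λ c → c i) now≡) eq }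
      ; past     = λ {t} t<T → contradiction (subst (t <_) T≡0 t<T) λ ()
      ; steps    = λ {t} t<T → contradiction (subst (t <_) T≡0 t<T) λ ()
      ; count    = trans (+-suc (T m) (s m)) count
      ; M-unique = M-unique ; M-spec = M-spec } }
    where
    open Pending P
    T≡0 : T m ≡ 0
    T≡0 = proj₁ (unfull s<k)
    now≡ : now (placed m w) ≡ update (now m) (s m) w
    now≡ = update-same (cfg m) (T m) (update (now m) (s m) w)
    occ : ∀ {v} → v ∈ V m → Occupied (suc (s m)) (update (now m) (s m) w) v
    occ v∈ with proj₂ (unfull s<k) v∈
    ... | inj₁ refl = occupied-push-new (now m) (s m) w
    ... | inj₂ v∈S  = occupied-push⁺ v∈S

  module _ {m : Machine} {w : Fin n} (P : Pending m w) (s≡k : s m ≡ suc κ) (c′ : ℕ → Fin n) (top′ : Fin n) (q′ : ℕ) where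

    open Pending P

    evicted : Machine
    evicted = record m { h = w ; top = top′ ; q = q′ ; T = suc (T m) ; cfg = update (cfg m) (suc (T m)) c′ }

    inv-evicted : Link κ w top′ (V m) (F m) (f m) q′ (s m) c′ → Step (s m) (now m) c′ → Inv evicted
    inv-evicted link′ step = record
      { trav = trav
      ; link = subst (Link κ w top′ (V m) (F m) (f m) q′ (s m)) (sym now≡) link′
      ; hist = record
        { s≤k      = s≤k
        ; unfull   = λ s< → contradiction (subst (_< suc κ) s≡k s<) (<-irrefl refl)
        ; emitted  = emitted′
        ; past     = λ {t} t< → subst (λ c → ∃ λ h′ → Compact h′ (s m) c) (sym (old t<)) (past′ (≤-pred t<))
        ; steps    = λ {t} t< → steps′ t<
        ; count    = count ; M-unique = M-unique ; M-spec = M-spec } }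
      where
      now≡ : now evicted ≡ c′
      now≡ = update-same (cfg m) (suc (T m)) c′

      old : ∀ {t} → t < suc (T m) → cfg evicted t ≡ cfg m t
      old t< = update-other (cfg m) (suc (T m)) c′ (λ eq → <⇒≢ t< (sym eq))

      past′ : ∀ {t} → t ≤ T m → ∃ λ h′ → Compact h′ (s m) (cfg m t)
      past′ t≤ with m≤n⇒m<n∨m≡n t≤
      ... | inj₁ t<   = past t<
      ... | inj₂ refl = h m , Arriving.compact arriving

      steps′ : ∀ {t} → t < suc (T m) → Step (s m) (cfg evicted t) (cfg evicted (suc t))
      steps′ {t} t< with m≤n⇒m<n∨m≡n (≤-pred t<)
      ... | inj₁ lt   = subst₂ (Step (s m)) (sym (old t<)) (sym (old (s≤s lt))) (steps lt)
      ... | inj₂ refl = subst₂ (Step (s m)) (sym (old t<)) (sym now≡) step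

      emitted′ : ∀ {v} → v ∈ V m → ∃₂ λ t i → t ≤ suc (T m) × i < s m × cfg evicted t i ≡ v
      emitted′ v∈ with emitted v∈
      ... | inj₂ (t , i , t≤ , i< , eq) = t , i , m≤n⇒m≤1+n t≤ , i< , trans (cong (λ c → c i) (old (s≤s t≤))) eq
      ... | inj₁ refl with i , i< , eq ← Compact.head∈ (Link.compact link′) = suc (T m) , i , ≤-refl , i< , trans (cong (λ c → c i) now≡) eq

  module _ {m : Machine} (I : Inv m) (h≡z : h m ≡ z) (k≤n : suc κ ≤ n) where

    open Inv I
    open Hist hist

    all-visited : ∀ v → v ∈ V m
    all-visited = trav-complete trav h≡z

    -- With fewer than `k` agents placed, all visited vertices would be occupied; now these are all
    -- `n` vertices, and `k ≤ n`.
    filled : s m ≡ suc κ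
    filled with m≤n⇒m<n∨m≡n s≤k
    ... | inj₂ eq = eq
    ... | inj₁ s< = contradiction (injective⇒≤ {f = place-of} λ {u} {v} → place-injective u v) (<⇒≱ (≤-trans s< k≤n))
      where
      occ : ∀ v → Occupied (s m) (now m) v
      occ v = proj₂ (unfull s<) (all-visited v)
      place-of : Fin n → Fin (s m)
      place-of v = fromℕ< (proj₁ (proj₂ (occ v)))
      at : ∀ v → now m (toℕ (place-of v)) ≡ v
      at v = trans (cong (now m) (toℕ-fromℕ< (proj₁ (proj₂ (occ v))))) (proj₂ (proj₂ (occ v)))
      place-injective : ∀ u v → place-of u ≡ place-of v → u ≡ v
      place-injective u v eq = trans (sym (at u)) (trans (cong (now m ∘ toℕ) eq) (at v))

    result : Fin (suc (T m)) → Fin (suc κ) → Fin n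
    result t i = cfg m (toℕ t) (toℕ i)

    private
      compact-at : ∀ {t} → t ≤ T m → ∃ λ h′ → Compact h′ (suc κ) (cfg m t)
      compact-at t≤ with m≤n⇒m<n∨m≡n t≤
      ... | inj₁ t<   = subst (λ k → ∃ λ h′ → Compact h′ k _) filled (past t<)
      ... | inj₂ refl = h m , subst (λ k → Compact (h m) k (now m)) filled (Link.compact link)

      step-at : ∀ (t : Fin (T m)) → Step (suc κ) (cfg m (toℕ t)) (cfg m (suc (toℕ t)))
      step-at t = subst (λ k → Step k _ _) filled (steps (toℕ<n t))

      ∈ᶜ⇒occupied : ∀ {k c v} → v ∈ᶜ (c ∘ toℕ {k}) → Occupied k c v
      ∈ᶜ⇒occupied (i , eq) = toℕ i , toℕ<n i , eq

      occupied⇒∈ᶜ : ∀ {k c v} → Occupied k c v → v ∈ᶜ (c ∘ toℕ {k})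
      occupied⇒∈ᶜ {c = c} (i , i< , eq) = fromℕ< i< , trans (cong c (toℕ-fromℕ< i<)) eq

    result-walk : IsSpanningRestrictedWalk G (suc κ) (T m) result
    result-walk = record
      { configuration = λ t → compact⇒configuration (proj₂ (compact-at (≤-pred (toℕ<n t))))
      ; adjacent      = adjacent
      ; restricted    = restricted
      ; spanning      = spanning }
      where
      before : ∀ (t : Fin (T m)) → result (inject₁ t) ≡ cfg m (toℕ t) ∘ toℕ
      before t = cong (λ a → cfg m a ∘ toℕ) (toℕ-inject₁ t)

      adjacent : ∀ t → Adjacent G (result (inject₁ t)) (result (suc t))
      adjacent t i rewrite toℕ-inject₁ t = Step.moves (step-at t) (toℕ<n i)

      restricted : ∀ t → ∃! _≡_ λ x → x ∈ᶜ result (suc t) × ¬ (x ∈ᶜ result (inject₁ t))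
      restricted t = S.new , (occupied⇒∈ᶜ S.new∈ , λ v∈ → S.new∉ (∈ᶜ⇒occupied (subst (S.new ∈ᶜ_) (before t) v∈))) ,
        λ {v} (v∈ , v∉) → sym (S.only (∈ᶜ⇒occupied v∈) λ o → v∉ (subst (v ∈ᶜ_) (sym (before t)) (occupied⇒∈ᶜ o)))
        where module S = Step (step-at t)

      spanning : ∀ x → ∃ λ t → x ∈ᶜ result t
      spanning x with t , i , t≤ , i< , eq ← emitted (all-visited x) =
        fromℕ< (s≤s t≤) , occupied⇒∈ᶜ (i , subst (i <_) filled i< , trans (cong (λ a → cfg m a i) (toℕ-fromℕ< (s≤s t≤))) eq)

    open Edges G
    open Comparison G tree κ

    -- Read off `count`: `V` has at most `n` entries, and `up-edge` maps `M` injectively to the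
    -- bideep edges off the path from `r` to `z`.
    result-length : T m ≤ n ∸ suc κ + length (offBideep r z)
    result-length = +-cancelʳ-≤ (suc κ) _ _ (begin
      T m + suc κ                                       ≡⟨ cong (T m +_) (sym filled) ⟩
      T m + s m                                         ≡⟨ count ⟩
      length (V m) + length (M m)                       ≤⟨ +-mono-≤ V≤n M≤ ⟩
      n + length (offBideep r z)                        ≡⟨ cong (_+ length (offBideep r z)) (sym (m∸n+n≡m k≤n)) ⟩
      n ∸ suc κ + suc κ + length (offBideep r z)        ≡⟨ trans (+-assoc (n ∸ suc κ) _ _) (trans (cong (n ∸ suc κ +_) (+-comm (suc κ) _)) (sym (+-assoc (n ∸ suc κ) _ _))) ⟩
      n ∸ suc κ + length (offBideep r z) + suc κ        ∎)
      where
      open ≤-Reasoning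
      V≤n : length (V m) ≤ n
      V≤n = subst (length (V m) ≤_) (length-tabulate id) (unique⊆⇒length≤ (Trav.V-unique trav) λ {v} _ → ∈-allFin v)

      up-edge : Fin n → Fin n × Fin n
      up-edge u = orient (parent u) u

      near : ∀ {u} → u ≢ z → ¬ Anc u r → Side u (parent u) r
      near u≢z ¬a with side-total (E-par u≢z) r
      ... | inj₁ s = s
      ... | inj₂ s = contradiction (side⇒anc u≢z s) ¬a

      member : ∀ {u} → u ∈ M m → up-edge u ∈ offBideep r z
      member {u} u∈ with _ , u≢z , dp , ¬a ← M-spec u∈ = ∈-filter⁺ _ (orient-∈ e) (good (orient-cases (parent u) u))
        where
        e : E G (parent u) u
        e = symE G (E-par u≢z)
        sr : Side u (parent u) r
        sr = near u≢z ¬a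
        sz : Side u (parent u) z
        sz = side-par u≢z
        opposite : Deep κ u (parent u)
        opposite = deep-opposite κ diametral e sr sz dp
        good : ∀ {e} → e ≡ (parent u , u) ⊎ e ≡ (u , parent u) → BD e × ¬ Sep r z (proj₁ e) (proj₂ e)
        good (inj₁ refl) = (dp , opposite) , λ { (inj₁ (_ , t)) → side-asym sz t ; (inj₂ (t , _)) → side-asym sr t }
        good (inj₂ refl) = (opposite , dp) , λ { (inj₁ (t , _)) → side-asym sr t ; (inj₂ (_ , t)) → side-asym sz t }

      injective : ∀ {u v} → u ∈ M m → v ∈ M m → up-edge u ≡ up-edge v → u ≡ v
      injective {u} {v} u∈ v∈ eq with _ , u≢z , _ ← M-spec u∈ | _ , v≢z , _ ← M-spec v∈ = match (orient-cases (parent u) u) (orient-cases (parent v) v) eq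
        where
        loop : u ≡ parent v → parent u ≡ v → u ≡ v
        loop p q = contradiction (≤-reflexive (trans (cong (suc ∘ dep) p) (sym (dep-parent v≢z)))) (<-asym (≤-reflexive (trans (cong (suc ∘ dep) (sym q)) (sym (dep-parent u≢z)))))
        match : ∀ {a b} → a ≡ (parent u , u) ⊎ a ≡ (u , parent u) → b ≡ (parent v , v) ⊎ b ≡ (v , parent v) → a ≡ b → u ≡ v
        match (inj₁ refl) (inj₁ refl) e = cong proj₂ e
        match (inj₁ refl) (inj₂ refl) e = loop (cong proj₂ e) (cong proj₁ e)
        match (inj₂ refl) (inj₁ refl) e = loop (cong proj₁ e) (cong proj₂ e)
        match (inj₂ refl) (inj₂ refl) e = cong proj₁ e

      M≤ : length (M m) ≤ length (offBideep r z)
      M≤ = subst (_≤ length (offBideep r z)) (length-map up-edge (M m)) (unique⊆⇒length≤ (unique-map-on up-edge injective M-unique)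
        λ e∈ → case ∈-map⁻ up-edge e∈ of λ { (u , u∈ , refl) → member u∈ })

-- Total correctness with cost bounds

-- A Hoare triple for total correctness, in which `b` bounds the number of steps.
Run : Cmd → State → ℕ → (State → Set) → Set
Run p σ b Q = ∃₂ λ τ s → ⟨ p , σ ⟩⇓⟨ τ , s ⟩ × s ≤ b × Q τ

assigned : ℕ → Expr → State → State
assigned x e σ = ⟪ update (regs σ) x (⟦ e ⟧ σ) , arrs σ ⟫

stored : ℕ → Expr → Expr → State → State
stored a e f σ = ⟪ regs σ , update (arrs σ) a (update (arrs σ a) (⟦ e ⟧ σ) (⟦ f ⟧ σ)) ⟫

run-weaken : ∀ {p σ b b′ Q} → b ≤ b′ → Run p σ b Q → Run p σ b′ Q
run-weaken b≤ (τ , s , d , s≤ , q) = τ , s , d , ≤-trans s≤ b≤ , q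

run-map : ∀ {p σ b Q Q′} → (∀ {τ} → Q τ → Q′ τ) → Run p σ b Q → Run p σ b Q′
run-map f (τ , s , d , s≤ , q) = τ , s , d , s≤ , f q

run-skip : ∀ {σ b} {Q : State → Set} → Q σ → Run skip σ (suc b) Q
run-skip q = _ , _ , ⇓skip , s≤s z≤n , q

run-assign : ∀ {x e σ b} {Q : State → Set} → Q (assigned x e σ) → Run (x ≔ e) σ (suc b) Q
run-assign q = _ , _ , ⇓assign , s≤s z≤n , q

assign-then : ∀ {x e p σ b Q} → Run p (assigned x e σ) b Q → Run (x ≔ e ⨾ p) σ (suc b) Q
assign-then (τ , s , d , s≤ , q) = τ , _ , ⇓seq ⇓assign d , s≤s s≤ , q

store-then : ∀ {a e f p σ b Q} → Run p (stored a e f σ) b Q → Run (a [ e ]≔ f ⨾ p) σ (suc b) Q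
store-then (τ , s , d , s≤ , q) = τ , _ , ⇓seq ⇓store d , s≤s s≤ , q

run-seq : ∀ {p p′ σ b b′ R Q} → Run p σ b R → (∀ {τ} → R τ → Run p′ τ b′ Q) → Run (p ⨾ p′) σ (b + b′) Q
run-seq (τ , s , d , s≤ , r) next with τ′ , s′ , d′ , s′≤ , q ← next r = τ′ , _ , ⇓seq d d′ , +-mono-≤ s≤ s′≤ , q

run-then : ∀ {e p p′ σ b Q} → ⟦ e ⟧ σ ≢ 0 → Run p σ b Q → Run (cond e p p′) σ (suc b) Q
run-then t (τ , s , d , s≤ , q) = τ , _ , ⇓then t d , s≤s s≤ , q

run-else : ∀ {e p p′ σ b Q} → ⟦ e ⟧ σ ≡ 0 → Run p′ σ b Q → Run (cond e p p′) σ (suc b) Q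
run-else t (τ , s , d , s≤ , q) = τ , _ , ⇓else t d , s≤s s≤ , q

-- I N is a loop invariant under which at most N iterations remain.
run-while : ∀ {e p b} (I : ℕ → State → Set) →
            (∀ {N σ} → I N σ → ⟦ e ⟧ σ ≢ 0 → ∃ λ N′ → N ≡ suc N′ × Run p σ b (I N′)) →
            ∀ N {σ} → I N σ → Run (while e p) σ (suc (N * suc b)) (λ τ → (∃ λ N′ → I N′ τ) × ⟦ e ⟧ τ ≡ 0)
run-while {e} {p} {b} I body N {σ} i with ⟦ e ⟧ σ ≟ 0
... | yes t≡0 = σ , 1 , ⇓done t≡0 , s≤s z≤n , (N , i) , t≡0
... | no t≢0 with body i t≢0
... | N′ , refl , (τ , s , d , s≤ , i′) with run-while I body N′ i′
... | τ′ , s′ , d′ , s′≤ , q = τ′ , _ , ⇓loop t≢0 d d′ , s≤s (≤-trans (+-mono-≤ s≤ s′≤) (≤-reflexive (+-suc b _))) , q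

-- The absolute difference, as one of the two truncated differences vanishes; it is nonzero exactly
-- when the values differ.
_≠ᴱ_ : Expr → Expr → Expr
e ≠ᴱ f = (e ⊖ f) ⊕ (f ⊖ e)

∸+∸≢0 : ∀ {a b} → a ≢ b → (a ∸ b) + (b ∸ a) ≢ 0
∸+∸≢0 {a} {b} a≢b eq = a≢b (≤-antisym (m∸n≡0⇒m≤n (m+n≡0⇒m≡0 (a ∸ b) eq)) (m∸n≡0⇒m≤n (m+n≡0⇒n≡0 (a ∸ b) eq)))

∸+∸≡0 : ∀ {a b} → a ≡ b → (a ∸ b) + (b ∸ a) ≡ 0
∸+∸≡0 {a} refl = cong₂ _+_ (n∸n≡0 a) (n∸n≡0 a)

∸+∸≡0⇒≡ : ∀ {a b} → (a ∸ b) + (b ∸ a) ≡ 0 → a ≡ b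
∸+∸≡0⇒≡ {a} {b} eq with a ≟ b
... | yes a≡b = a≡b
... | no a≢b  = contradiction eq (∸+∸≢0 a≢b)

∸≢0 : ∀ {a b} → b < a → a ∸ b ≢ 0
∸≢0 b<a eq = <⇒≱ b<a (m∸n≡0⇒m≤n eq)

∸≢0⇒< : ∀ {a b} → a ∸ b ≢ 0 → b < a
∸≢0⇒< {a} {b} ne = ≰⇒> λ a≤b → ne (m≤n⇒m∸n≡0 a≤b)

-- Memory layout and the searches for the diametral pair

rK rLen rHead rNext rTop rKept rDone rSize rBase rCur rIdx rTmp rRoot rBest rFront rBack rNode rPos rStamp : ℕ
rK     = 1
rLen   = 2
rHead  = 3
rNext  = 4
rTop   = 5
rKept  = 6
rDone  = 7
rSize  = 8
rBase  = 9
rCur   = 10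
rIdx   = 11
rTmp   = 12
rRoot  = 13
rBest  = 14
rFront = 15
rBack  = 16
rNode  = 17
rPos   = 18
rStamp = 19

-- aSeen holds, for every vertex, the number of the last of the three passes that reached it.
aOff aAdj aOut aPar aDep aQueue aSeen aUsed aToward aMark aDone : ℕ
aOff    = 0
aAdj    = 1
aOut    = 2
aPar    = 3
aDep    = 4
aQueue  = 5
aSeen   = 6
aUsed   = 7
aToward = 8
aMark   = 9
aDone   = 10

-- Breadth-first search from rRoot; rBest becomes a vertex farthest from it.
discover : Cmd
discover =
  aSeen [ reg rNext ]≔ reg rStamp ⨾
  aPar [ reg rNext ]≔ reg rNode ⨾
  aDep [ reg rNext ]≔ arr aDep (reg rNode) ⊕ lit 1 ⨾
  aQueue [ reg rBack ]≔ reg rNext ⨾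
  rBack ≔ reg rBack ⊕ lit 1 ⨾
  cond (arr aDep (reg rNext) ⊖ arr aDep (reg rBest)) (rBest ≔ reg rNext) skip

scan : Cmd
scan =
  rNode ≔ arr aQueue (reg rFront) ⨾
  rCur ≔ arr aOff (reg rNode) ⊕ reg rPos ⨾
  cond (arr aOff (reg rNode ⊕ lit 1) ⊖ reg rCur)
    (rNext ≔ arr aAdj (reg rCur) ⨾
     rPos ≔ reg rPos ⊕ lit 1 ⨾
     cond (reg rStamp ⊖ arr aSeen (reg rNext)) discover skip)
    (rFront ≔ reg rFront ⊕ lit 1 ⨾
     rPos ≔ lit 0)

sweep : Cmd
sweep =
  aSeen [ reg rRoot ]≔ reg rStamp ⨾
  aPar [ reg rRoot ]≔ reg rRoot ⨾
  aDep [ reg rRoot ]≔ lit 0 ⨾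
  aQueue [ lit 0 ]≔ reg rRoot ⨾
  rBest ≔ reg rRoot ⨾
  rFront ≔ lit 0 ⨾
  rPos ≔ lit 0 ⨾
  rBack ≔ lit 1 ⨾
  while (reg rBack ⊖ reg rFront) scan

module Sweep {n : ℕ} (G : Graph n) (tree : IsTree G) (adj : Fin n → List (Fin n)) (isAdj : IsAdjacencyLists G adj)
             (off nbr : ℕ → ℕ)
             (off-suc : ∀ v → off (toℕ v + 1) ≡ off (toℕ v) + length (adj v))
             (nbr-at : ∀ v i → nbr (off (toℕ v) + toℕ i) ≡ toℕ (lookup (adj v) i))
             (Δ : ℕ) (Δ-bound : ∀ v → length (adj v) ≤ Δ) where

  open Metric G tree
  open Shifting G tree

  -- What both searches must leave intact for the walk phase: the input, and the arrays that phase
  -- expects to be zero.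
  record Frame (k : ℕ) (σ : State) : Set where
    field
      frame-k    : regs σ rK ≡ k
      frame-off  : arrs σ aOff ≡ off
      frame-adj  : arrs σ aAdj ≡ nbr
      frame-used : ∀ v → arrs σ aUsed v ≡ 0
      frame-mark : ∀ v → arrs σ aMark v ≡ 0

  module _ (k : ℕ) (ρ : Fin n) (stamp : ℕ) where

    -- No order of layers is recorded for the queue: in a tree a vertex is discovered along its only
    -- path from `ρ`, so parents and depths come out right in any search order.
    record Core (Q : ℕ → Fin n) (front back : ℕ) (best : Fin n) (σ : State) : Set where
      field
        frame      : Frame k σ
        at-root    : regs σ rRoot ≡ toℕ ρ
        at-stamp   : regs σ rStamp ≡ stamp
        at-front   : regs σ rFront ≡ front
        at-back    : regs σ rBack ≡ back
        at-best    : regs σ rBest ≡ toℕ best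
        queue      : ∀ {j} → j < back → arrs σ aQueue j ≡ toℕ (Q j)
        seen       : ∀ {v} → Occupied back Q v → arrs σ aSeen (toℕ v) ≡ stamp
        unseen     : ∀ {v} → ¬ Occupied back Q v → arrs σ aSeen (toℕ v) < stamp
        parents    : ∀ {v} → Occupied back Q v → arrs σ aPar (toℕ v) ≡ toℕ (par ρ v)
        depths     : ∀ {v} → Occupied back Q v → arrs σ aDep (toℕ v) ≡ δ v ρ
        injective  : ∀ {i j} → i < back → j < back → Q i ≡ Q j → i ≡ j
        root∈      : Occupied back Q ρ
        best∈      : Occupied back Q best
        farthest   : ∀ {v} → Occupied back Q v → δ v ρ ≤ δ best ρ
        parent∈    : ∀ {v} → Occupied back Q v → v ≢ ρ → Occupied back Q (par ρ v)
        front≤     : front ≤ back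
        processed  : ∀ {j w} → j < front → E G (Q j) w → Occupied back Q w

      back≤n : back ≤ n
      back≤n = injective⇒≤ {f = λ (i : Fin back) → Q (toℕ i)} λ eq → toℕ-injective (injective (toℕ<n _) (toℕ<n _) eq)

    record Searching (Q : ℕ → Fin n) (front pos back : ℕ) (best : Fin n) (σ : State) : Set where
      field
        core       : Core Q front back best σ
        at-pos     : regs σ rPos ≡ pos
        processing : ∀ i → toℕ i < pos → Occupied back Q (lookup (adj (Q front)) i)
        pos≤       : front < back → pos ≤ length (adj (Q front))
      open Core core public

      -- The measure of progress. A completed queue entry is worth `suc Δ` rounds: at most `Δ`
      -- neighbours, and one round to pass on to the next entry.
      used-bound : front < back → front * suc Δ + pos < n * suc Δ
      used-bound front< = begin-strict
        front * suc Δ + pos   <⟨ +-monoʳ-< (front * suc Δ) (s≤s (≤-trans (pos≤ front<) (Δ-bound (Q front)))) ⟩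
        front * suc Δ + suc Δ ≡⟨ +-comm (front * suc Δ) (suc Δ) ⟩
        suc front * suc Δ     ≤⟨ *-monoˡ-≤ (suc Δ) (≤-trans front< back≤n) ⟩
        n * suc Δ             ∎
        where open ≤-Reasoning

    Search : ℕ → State → Set
    Search N σ = ∃ λ Q → ∃ λ front → ∃ λ pos → ∃ λ back → ∃ λ best → Searching Q front pos back best σ × n * suc Δ ≤ N + (front * suc Δ + pos)

    run-discover : ∀ {Q front back best σ u w} → Core Q front back best σ → regs σ rNode ≡ toℕ u → regs σ rNext ≡ toℕ w →
                   E G u w → Occupied back Q u → ¬ Occupied back Q w →
                   Run discover σ 7 (λ τ → ∃ λ best′ → Core (update Q back w) front (suc back) best′ τ × regs τ rPos ≡ regs σ rPos)
    run-discover {Q} {front} {back} {best} {σ} {u} {w} C node next uw u∈ w∉ =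
      store-then (store-then (store-then (store-then (assign-then compare))))
      where
      open Core C
      σ₅ : State
      σ₅ = assigned rBack (reg rBack ⊕ lit 1) (stored aQueue (reg rBack) (reg rNext)
             (stored aDep (reg rNext) (arr aDep (reg rNode) ⊕ lit 1) (stored aPar (reg rNext) (reg rNode) (stored aSeen (reg rNext) (reg rStamp) σ))))

      -- Were `w` the neighbour of `u` towards `ρ`, it would be the parent of `u` and so in the
      -- queue already.
      w-child : Side w u ρ
      w-child with side-total uw ρ
      ... | inj₂ s = s
      ... | inj₁ s with u ≟ᶠ ρ
      ...   | yes refl = contradiction (trans (sym (δ-refl ρ)) s) λ ()
      ...   | no u≢ρ = contradiction (subst (Occupied back Q) (sym (par-unique uw s)) (parent∈ u∈ u≢ρ)) w∉

      par-w : par ρ w ≡ u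
      par-w = sym (par-unique (symE G uw) w-child)

      ∈⇒≢w : ∀ {v} → Occupied back Q v → v ≢ w
      ∈⇒≢w v∈ refl = w∉ v∈

      new-depth : arrs σ₅ aDep (toℕ w) ≡ δ w ρ
      new-depth = trans (update-at (arrs σ aDep) next) (trans (+-comm _ 1) (trans (cong suc (trans (cong (arrs σ aDep) node) (depths u∈))) (sym w-child)))

      old-depth : ∀ {v} → Occupied back Q v → arrs σ₅ aDep (toℕ v) ≡ δ v ρ
      old-depth v∈ = trans (update-≢ (arrs σ aDep) next (∈⇒≢w v∈)) (depths v∈)

      cases : ∀ {v} {P : Fin n → Set} → Occupied (suc back) (update Q back w) v → P w → (Occupied back Q v → P v) → P v
      cases v∈ pw pv with occupied-push⁻ v∈
      ... | inj₁ refl = pw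
      ... | inj₂ v∈Q  = pv v∈Q

      next-core : ∀ {b x} → x ≡ toℕ b → Occupied (suc back) (update Q back w) b → (∀ {v} → Occupied (suc back) (update Q back w) v → δ v ρ ≤ δ b ρ) →
                  Core (update Q back w) front (suc back) b ⟪ update (regs σ₅) rBest x , arrs σ₅ ⟫
      next-core at-b b∈ far = record
        { frame = record { Frame frame } ; at-root = at-root ; at-stamp = at-stamp ; at-front = at-front
        ; at-back   = trans (+-comm _ 1) (cong suc at-back)
        ; at-best   = at-b
        ; queue     = queue′
        ; seen      = λ v∈ → cases {P = λ v → arrs σ₅ aSeen (toℕ v) ≡ stamp} v∈ (trans (update-at (arrs σ aSeen) next) at-stamp)
                               (λ v∈ → trans (update-≢ (arrs σ aSeen) next (∈⇒≢w v∈)) (seen v∈))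
        ; unseen    = λ v∉ → ≤-trans (≤-reflexive (cong suc (update-≢ (arrs σ aSeen) next (λ { refl → v∉ (occupied-push-new Q back w) })))) (unseen (v∉ ∘ occupied-push⁺))
        ; parents   = λ v∈ → cases {P = λ v → arrs σ₅ aPar (toℕ v) ≡ toℕ (par ρ v)} v∈ (trans (update-at (arrs σ aPar) next) (trans node (cong toℕ (sym par-w))))
                               (λ v∈ → trans (update-≢ (arrs σ aPar) next (∈⇒≢w v∈)) (parents v∈))
        ; depths    = λ v∈ → cases {P = λ v → arrs σ₅ aDep (toℕ v) ≡ δ v ρ} v∈ new-depth old-depth
        ; injective = injective-push injective w∉
        ; root∈     = occupied-push⁺ root∈
        ; best∈     = b∈
        ; farthest  = far
        ; parent∈   = λ v∈ → cases {P = λ v → v ≢ ρ → Occupied (suc back) (update Q back w) (par ρ v)} v∈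
                               (λ _ → subst (Occupied (suc back) (update Q back w)) (sym par-w) (occupied-push⁺ u∈)) (λ v∈ v≢ρ → occupied-push⁺ (parent∈ v∈ v≢ρ))
        ; front≤    = m≤n⇒m≤1+n front≤
        ; processed = λ {j} j< e → occupied-push⁺ (processed j< (subst (λ v → E G v _) (update-other Q back w (λ eq → <⇒≢ (≤-trans j< front≤) (sym eq))) e)) }
        where
        queue′ : ∀ {j} → j < suc back → arrs σ₅ aQueue j ≡ toℕ (update Q back w j)
        queue′ {j} j< with back ≟ j
        ... | yes refl = trans (trans (cong (λ x → update (arrs σ aQueue) x (regs σ rNext) back) at-back) (update-same (arrs σ aQueue) back _)) (trans next (cong toℕ (sym (update-same Q back w))))
        ... | no b≢j   = trans (trans (cong (λ x → update (arrs σ aQueue) x (regs σ rNext) j) at-back) (update-other (arrs σ aQueue) back _ b≢j))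
                           (trans (queue (≤∧≢⇒< (≤-pred j<) (b≢j ∘ sym))) (cong toℕ (sym (update-other Q back w b≢j))))

      test≡ : ⟦ arr aDep (reg rNext) ⊖ arr aDep (reg rBest) ⟧ σ₅ ≡ δ w ρ ∸ δ best ρ
      test≡ = cong₂ _∸_ (trans (cong (arrs σ₅ aDep) next) new-depth) (trans (cong (arrs σ₅ aDep) at-best) (old-depth best∈))

      compare : Run (cond (arr aDep (reg rNext) ⊖ arr aDep (reg rBest)) (rBest ≔ reg rNext) skip) σ₅ 2
                    (λ τ → ∃ λ best′ → Core (update Q back w) front (suc back) best′ τ × regs τ rPos ≡ regs σ rPos)
      compare with δ best ρ <? δ w ρ
      ... | yes lt = run-then (λ eq → ∸≢0 lt (trans (sym test≡) eq)) (run-assign (w ,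
              next-core next (occupied-push-new Q back w) (λ v∈ → cases {P = λ v → δ v ρ ≤ δ w ρ} v∈ ≤-refl (λ v∈ → ≤-trans (farthest v∈) (<⇒≤ lt))) , refl))
      ... | no ≮ = run-else (trans test≡ (m≤n⇒m∸n≡0 (≮⇒≥ ≮))) (run-skip (best ,
              record { Core (next-core at-best (occupied-push⁺ best∈) (λ v∈ → cases {P = λ v → δ v ρ ≤ δ best ρ} v∈ (≮⇒≥ ≮) farthest)) hiding (frame) ; frame = record { Frame frame } } , refl))

    record Swept (σ : State) : Set where
      field
        frame    : Frame k σ
        at-root  : regs σ rRoot ≡ toℕ ρ
        best     : Fin n
        at-best  : regs σ rBest ≡ toℕ best
        farthest : ∀ v → δ ρ v ≤ δ ρ best
        parents  : ∀ v → arrs σ aPar (toℕ v) ≡ toℕ (par ρ v)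
        seen     : ∀ (v : Fin n) → arrs σ aSeen (toℕ v) ≡ stamp

    private
      spend : ∀ {N used used′ total} → total ≤ N + used → used < total → used < used′ → ∃ λ N′ → N ≡ suc N′ × total ≤ N′ + used′
      spend {zero}  le lt _   = contradiction le (<⇒≱ lt)
      spend {suc N} le _  lt′ = N , refl , ≤-trans le (≤-trans (≤-reflexive (sym (+-suc N _))) (+-monoʳ-≤ N lt′))

    run-scan : ∀ {N σ} → Search N σ → ⟦ reg rBack ⊖ reg rFront ⟧ σ ≢ 0 → ∃ λ N′ → N ≡ suc N′ × Run scan σ 13 (Search N′)
    run-scan {N} {σ} (Q , front , pos , back , best , S , fuel) test = go (m≤n⇒m<n∨m≡n (pos≤ front<))
      where
      open Searching S
      front< : front < back
      front< = ∸≢0⇒< λ eq → test (trans (cong₂ _∸_ at-back at-front) eq)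

      u : Fin n
      u = Q front

      u∈ : Occupied back Q u
      u∈ = front , front< , refl

      node : ⟦ arr aQueue (reg rFront) ⟧ σ ≡ toℕ u
      node = trans (cong (arrs σ aQueue) at-front) (queue front<)

      σ₁ σ₂ : State
      σ₁ = assigned rNode (arr aQueue (reg rFront)) σ
      σ₂ = assigned rCur (arr aOff (reg rNode) ⊕ reg rPos) σ₁

      cur : regs σ₂ rCur ≡ off (toℕ u) + pos
      cur = cong₂ _+_ (trans (cong (arrs σ aOff) node) (cong (λ g → g (toℕ u)) (Frame.frame-off frame))) at-pos

      limit : arrs σ₂ aOff (regs σ₂ rNode + 1) ≡ off (toℕ u) + length (adj u)
      limit = trans (cong₂ (λ g x → g (x + 1)) (Frame.frame-off frame) node) (off-suc u)

      test₂ : ⟦ arr aOff (reg rNode ⊕ lit 1) ⊖ reg rCur ⟧ σ₂ ≡ length (adj u) ∸ pos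
      test₂ = trans (cong₂ _∸_ limit cur) ([m+n]∸[m+o]≡n∸o (off (toℕ u)) _ _)

      go : pos < length (adj u) ⊎ pos ≡ length (adj u) → ∃ λ N′ → N ≡ suc N′ × Run scan σ 13 (Search N′)
      go (inj₂ refl) with N′ , N≡ , fuel′ ← spend fuel (used-bound front<) (≤-trans (s≤s (+-monoʳ-≤ (front * suc Δ) (Δ-bound u)))
                            (≤-reflexive (trans (sym (+-suc (front * suc Δ) Δ)) (trans (+-comm (front * suc Δ) (suc Δ)) (sym (+-identityʳ _)))))) =
        N′ , N≡ , assign-then (assign-then (run-else (trans test₂ (n∸n≡0 (length (adj u)))) (assign-then (run-assign
          (Q , suc front , 0 , back , best , record
            { core = record
              { Core core hiding (frame; at-front; front≤; processed) ; frame = record { Frame frame }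
              ; at-front = trans (+-comm _ 1) (cong suc at-front) ; front≤ = front< ; processed = processed′ }
            ; at-pos = refl ; processing = λ _ () ; pos≤ = λ _ → z≤n } , fuel′)))))
        where
        processed′ : ∀ {j w} → j < suc front → E G (Q j) w → Occupied back Q w
        processed′ {j} {w} j< e with m≤n⇒m<n∨m≡n (≤-pred j<)
        ... | inj₁ lt   = processed lt e
        ... | inj₂ refl with w∈ ← Equivalence.from (proj₂ (isAdj u) w) e =
          subst (Occupied back Q) (sym (Anyₚ.lookup-index w∈)) (processing (Any.index w∈) (toℕ<n _))
      go (inj₁ pos<) with N′ , N≡ , fuel′ ← spend fuel (used-bound front<) (≤-reflexive (sym (+-suc (front * suc Δ) pos))) =
        N′ , N≡ , assign-then (assign-then (run-then (λ eq → ∸≢0 pos< (trans (sym test₂) eq)) (assign-then (assign-then (inspect (any? (λ j → Q (toℕ {back} j) ≟ᶠ w)))))))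
        where
        i : Fin (length (adj u))
        i = fromℕ< pos<

        w : Fin n
        w = lookup (adj u) i

        σ₄ : State
        σ₄ = assigned rPos (reg rPos ⊕ lit 1) (assigned rNext (arr aAdj (reg rCur)) σ₂)

        next : regs σ₄ rNext ≡ toℕ w
        next = trans (cong₂ (λ g x → g x) (Frame.frame-adj frame) (trans cur (cong (off (toℕ u) +_) (sym (toℕ-fromℕ< pos<))))) (nbr-at u i)

        core₄ : Core Q front back best σ₄
        core₄ = record { Core core hiding (frame) ; frame = record { Frame frame } }

        uw : E G u w
        uw = Equivalence.to (proj₂ (isAdj u) w) (∈-lookup i)

        at-pos₄ : regs σ₄ rPos ≡ suc pos
        at-pos₄ = trans (+-comm _ 1) (cong suc at-pos)

        next-processing : ∀ {back′ Q′ x} → (∀ {v} → Occupied back Q v → Occupied back′ Q′ v) → x ≡ u → Occupied back′ Q′ w →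
                          ∀ j → toℕ j < suc pos → Occupied back′ Q′ (lookup (adj x) j)
        next-processing mono refl w∈ j j< with m≤n⇒m<n∨m≡n (≤-pred j<)
        ... | inj₁ lt = mono (processing j lt)
        ... | inj₂ eq with refl ← toℕ-injective {i = j} {j = i} (trans eq (sym (toℕ-fromℕ< pos<))) = w∈

        inspect : Dec (∃ λ (j : Fin back) → Q (toℕ j) ≡ w) → Run (cond (reg rStamp ⊖ arr aSeen (reg rNext)) discover skip) σ₄ 8 (Search N′)
        inspect (yes (j , eq)) = run-else (trans (cong₂ _∸_ at-stamp (trans (cong (arrs σ aSeen) next) (seen w∈))) (n∸n≡0 stamp)) (run-skip
          (Q , front , suc pos , back , best , record { core = core₄ ; at-pos = at-pos₄ ; processing = next-processing id refl w∈ ; pos≤ = λ _ → pos< } , fuel′))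
          where
          w∈ : Occupied back Q w
          w∈ = toℕ j , toℕ<n j , eq
        inspect (no ¬j) = run-then (λ eq → ∸≢0 (unseen w∉) (trans (sym (cong₂ _∸_ at-stamp (cong (arrs σ aSeen) next))) eq))
          (run-map (λ { (best′ , core′ , pos≡) → update Q back w , front , suc pos , suc back , best′ , record
              { core = core′ ; at-pos = trans pos≡ at-pos₄ ; processing = next-processing occupied-push⁺ front-same (occupied-push-new Q back w)
              ; pos≤ = λ _ → subst (λ v → suc pos ≤ length (adj v)) (sym front-same) pos< } , fuel′ })
            (run-discover core₄ node next uw u∈ w∉))
          where
          w∉ : ¬ Occupied back Q w
          w∉ (j , j< , eq) = ¬j (fromℕ< j< , trans (cong Q (toℕ-fromℕ< j<)) eq)
          front-same : update Q back w front ≡ u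
          front-same = update-other Q back w (λ eq → <⇒≢ front< (sym eq))

    search-complete : ∀ {N σ} → Search N σ → ⟦ reg rBack ⊖ reg rFront ⟧ σ ≡ 0 → Swept σ
    search-complete {σ = σ} (Q , front , pos , back , best , S , _) test = record
      { frame = frame ; at-root = at-root ; best = best ; at-best = at-best
      ; farthest = λ v → subst₂ _≤_ (δ-sym v ρ) (δ-sym best ρ) (farthest (all v)) ; parents = parents ∘ all ; seen = seen ∘ all }
      where
      open Searching S
      finished : back ≤ front
      finished = m∸n≡0⇒m≤n (trans (sym (cong₂ _∸_ at-back at-front)) test)

      reached : ∀ m v → δ v ρ ≡ m → Occupied back Q v
      reached m v eq with v ≟ᶠ ρ
      ... | yes refl = root∈
      reached zero    v eq | no v≢ρ = contradiction (δ≡0⇒≡ eq) v≢ρ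
      reached (suc m) v eq | no v≢ρ with j , j< , Qj ← reached m (par ρ v) (suc-injective (trans (sym (δ-par v≢ρ)) eq)) =
        processed (≤-trans j< finished) (subst (λ x → E G x v) (sym Qj) (symE G (E-par v≢ρ)))

      all : ∀ v → Occupied back Q v
      all v = reached _ v refl

    -- Since only `aSeen < stamp` is required, a larger stamp replaces clearing the array between
    -- passes. The factor 14 is the bound 13 for `scan` plus the loop test.
    run-sweep : ∀ {σ} → Frame k σ → regs σ rRoot ≡ toℕ ρ → regs σ rStamp ≡ stamp → (∀ (v : Fin n) → arrs σ aSeen (toℕ v) < stamp) →
                Run sweep σ (9 + n * suc Δ * 14) Swept
    run-sweep {σ} F at-root at-stamp fresh =
      store-then (store-then (store-then (store-then (assign-then (assign-then (assign-then (assign-then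
        (run-map (λ { ((N , search) , test) → search-complete {N} search test }) (run-while Search run-scan (n * suc Δ)
          ((λ _ → ρ) , 0 , 0 , 1 , ρ , record { core = core ; at-pos = refl ; processing = λ _ () ; pos≤ = λ _ → z≤n } , m≤m+n _ _))))))))))
      where
      only-root : ∀ {v} → Occupied 1 (λ _ → ρ) v → v ≡ ρ
      only-root (_ , _ , eq) = sym eq
      σ₀ : State
      σ₀ = assigned rBack (lit 1) (assigned rPos (lit 0) (assigned rFront (lit 0) (assigned rBest (reg rRoot) (stored aQueue (lit 0) (reg rRoot)
             (stored aDep (reg rRoot) (lit 0) (stored aPar (reg rRoot) (reg rRoot) (stored aSeen (reg rRoot) (reg rStamp) σ)))))))
      core : Core (λ _ → ρ) 0 1 ρ σ₀
      core = record
        { frame = record { Frame F } ; at-root = at-root ; at-stamp = at-stamp ; at-front = refl ; at-back = refl ; at-best = at-root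
        ; queue     = λ { (s≤s z≤n) → at-root }
        ; seen      = λ v∈ → trans (cong (λ v → arrs σ₀ aSeen (toℕ v)) (only-root v∈)) (trans (update-at (arrs σ aSeen) at-root) at-stamp)
        ; unseen    = λ {v} v∉ → ≤-trans (≤-reflexive (cong suc (update-≢ (arrs σ aSeen) at-root (λ { refl → v∉ (0 , s≤s z≤n , refl) })))) (fresh v)
        ; parents   = λ v∈ → trans (cong (λ v → arrs σ₀ aPar (toℕ v)) (only-root v∈)) (trans (update-at (arrs σ aPar) at-root) (trans at-root (cong toℕ (trans (sym (par-self ρ)) (cong (par ρ) (sym (only-root v∈)))))))
        ; depths    = λ v∈ → trans (cong (λ v → arrs σ₀ aDep (toℕ v)) (only-root v∈)) (trans (update-at (arrs σ aDep) at-root) (trans (sym (δ-refl ρ)) (cong (λ v → δ v ρ) (sym (only-root v∈)))))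
        ; injective = λ { (s≤s z≤n) (s≤s z≤n) _ → refl }
        ; root∈     = 0 , s≤s z≤n , refl
        ; best∈     = 0 , s≤s z≤n , refl
        ; farthest  = λ v∈ → ≤-reflexive (cong (λ v → δ v ρ) (only-root v∈))
        ; parent∈   = λ v∈ v≢ρ → contradiction (only-root v∈) v≢ρ
        ; front≤    = z≤n
        ; processed = λ () }

-- The walk phase: commands and the writing of a configuration

-- A mark is the number of the step it was made for, so older marks are at most `rLen` and need no
-- clearing; `copyAgents` moves the agents whose mark exceeds `rLen`.
markChain : Cmd
markChain = while (reg rCur ≠ᴱ reg rNext)
  (aMark [ reg rCur ]≔ reg rLen ⊕ lit 1 ⨾
   rCur ≔ arr aToward (reg rCur))

copyAgents : Cmd
copyAgents = while (reg rK ⊖ reg rIdx)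
  (rTmp ≔ arr aOut (reg rBase ⊕ reg rIdx) ⨾
   cond (arr aMark (reg rTmp) ⊖ reg rLen) (rTmp ≔ arr aToward (reg rTmp)) skip ⨾
   aOut [ reg rBase ⊕ reg rK ⊕ reg rIdx ]≔ reg rTmp ⨾
   rIdx ≔ reg rIdx ⊕ lit 1)

-- Write the next configuration: the agents on the path from rCur to rNext move one step along it.
emit : Cmd
emit =
  markChain ⨾
  rIdx ≔ lit 0 ⨾
  copyAgents ⨾
  rBase ≔ reg rBase ⊕ reg rK ⨾
  rLen ≔ reg rLen ⊕ lit 1

chooseEvicted : Cmd
chooseEvicted = cond (reg rDone ⊖ reg rKept)
  (rCur ≔ arr aDone (reg rKept) ⨾ rKept ≔ reg rKept ⊕ lit 1)
  (rCur ≔ reg rTop ⨾ rTop ≔ arr aToward (reg rTop))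

-- By `par-reroot` one store to `aToward`, at the old head, updates all directions that matter; the
-- entry at the new head is not relied on.
enter : Cmd
enter =
  aSeen [ reg rNext ]≔ lit 3 ⨾
  aToward [ reg rHead ]≔ reg rNext ⨾
  cond (reg rK ⊖ reg rSize)
    (aOut [ reg rSize ]≔ reg rNext ⨾ rSize ≔ reg rSize ⊕ lit 1)
    (chooseEvicted ⨾ emit) ⨾
  rHead ≔ reg rNext

advance : Cmd
advance =
  rCur ≔ arr aOff (reg rHead) ⊕ arr aUsed (reg rHead) ⨾
  cond (arr aOff (reg rHead ⊕ lit 1) ⊖ reg rCur)
    (rNext ≔ arr aAdj (reg rCur) ⨾
     aUsed [ reg rHead ]≔ arr aUsed (reg rHead) ⊕ lit 1 ⨾
     cond (reg rNext ≠ᴱ arr aPar (reg rHead))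
       (cond (lit 3 ⊖ arr aSeen (reg rNext)) enter skip)
       skip)
    (rNext ≔ arr aPar (reg rHead) ⨾
     aDone [ reg rDone ]≔ reg rHead ⨾
     rDone ≔ reg rDone ⊕ lit 1 ⨾
     cond (reg rHead ≠ᴱ reg rTop)
       (aToward [ reg rHead ]≔ reg rNext ⨾ rHead ≔ reg rNext)
       (rTop ≔ reg rNext ⨾ enter))

module Emission {n : ℕ} (G : Graph n) (tree : IsTree G) (κ : ℕ) where

  open Metric G tree
  open Shifting G tree
  open Configurations G tree

  private
    k : ℕ
    k = suc κ

  compact-diameter : ∀ {h c x} → Compact h k c → Occupied k c x → δ x h < k
  compact-diameter {h} {c} {x} K (i , i< , ci) with j , j< , cj ← Compact.head∈ K =
    subst₂ (λ a b → δ a b < k) (trans (cong c (toℕ-fromℕ< i<)) ci) (trans (cong c (toℕ-fromℕ< j<)) cj)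
      (configuration-diameter (proj₂ (compact⇒configuration K)) (fromℕ< i<) (fromℕ< j<))

  module _ {h w x : Fin n} {c : ℕ → Fin n} {T B : ℕ} {σ₀ : State}
           (K : Compact h k c) (hw : E G h w) (w∉ : ¬ Occupied k c w) (x∈ : Occupied k c x)
           (leaf : ∀ {v} → Occupied k c v → par w v ≢ x)
           (at-k    : regs σ₀ rK ≡ k)
           (at-len  : regs σ₀ rLen ≡ T)
           (at-next : regs σ₀ rNext ≡ toℕ w)
           (at-base : regs σ₀ rBase ≡ B)
           (at-cur  : regs σ₀ rCur ≡ toℕ x)
           (toward  : ∀ {v} → Occupied k c v → arrs σ₀ aToward (toℕ v) ≡ toℕ (par w v))
           (marks   : ∀ (v : Fin n) → arrs σ₀ aMark (toℕ v) ≤ T)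
           (row     : ∀ {i} → i < k → arrs σ₀ aOut (B + i) ≡ toℕ (c i)) where

    open Rooted G tree w

    private
      record Marking (u : Fin n) (σ : State) : Set where
        field
          keepR    : ∀ y → y ≢ rCur → regs σ y ≡ regs σ₀ y
          keepA    : ∀ a → a ≢ aMark → arrs σ a ≡ arrs σ₀ a
          cur      : regs σ rCur ≡ toℕ u
          on-chain : Anc u x
          marked   : ∀ {v} → Anc v x → dep u < dep v → arrs σ aMark (toℕ v) ≡ suc T
          unmarked : ∀ {v} → ¬ (Anc v x × dep u < dep v) → arrs σ aMark (toℕ v) ≤ T

      I : ℕ → State → Set
      I N σ = ∃ λ u → N ≡ dep u × Marking u σ

      step : ∀ {N σ} → I N σ → ⟦ reg rCur ≠ᴱ reg rNext ⟧ σ ≢ 0 →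
             ∃ λ N′ → N ≡ suc N′ × Run (aMark [ reg rCur ]≔ reg rLen ⊕ lit 1 ⨾ rCur ≔ arr aToward (reg rCur)) σ 2 (I N′)
      step {N} {σ} (u , N≡ , mk) test = dep (parent u) , trans N≡ (dep-parent u≢w) , store-then (run-assign (parent u , refl , record
        { keepR    = λ y y≢ → trans (update-other (regs σ) rCur _ (y≢ ∘ sym)) (keepR y y≢)
        ; keepA    = λ a a≢ → trans (update-other (arrs σ) aMark _ (a≢ ∘ sym)) (keepA a a≢)
        ; cur      = trans (cong₂ (λ g y → g y) (keepA aToward (λ ())) cur) (toward (chain⊆ K hw w∉ x∈ leaf x∈ on-chain u≢w))
        ; on-chain = anc-parent u≢w on-chain
        ; marked   = marked′
        ; unmarked = unmarked′ }))
        where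
        open Marking mk
        u≢w : u ≢ w
        u≢w refl = test (∸+∸≡0 (trans cur (sym (trans (keepR rNext (λ ())) at-next))))

        marked′ : ∀ {v} → Anc v x → dep (parent u) < dep v → update (arrs σ aMark) (regs σ rCur) (regs σ rLen + 1) (toℕ v) ≡ suc T
        marked′ {v} a lt with v ≟ᶠ u
        ... | yes refl = trans (update-at (arrs σ aMark) cur) (trans (+-comm _ 1) (cong suc (trans (keepR rLen (λ ())) at-len)))
        ... | no v≢u   = trans (update-≢ (arrs σ aMark) cur v≢u) (marked a (≤∧≢⇒< (≤-trans (≤-reflexive (dep-parent u≢w)) lt) λ eq → v≢u (anc-unique a on-chain (sym eq))))

        unmarked′ : ∀ {v} → ¬ (Anc v x × dep (parent u) < dep v) → update (arrs σ aMark) (regs σ rCur) (regs σ rLen + 1) (toℕ v) ≤ T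
        unmarked′ {v} ¬a with v ≟ᶠ u
        ... | yes refl = contradiction (on-chain , ≤-reflexive (sym (dep-parent u≢w))) ¬a
        ... | no v≢u   = ≤-trans (≤-reflexive (update-≢ (arrs σ aMark) cur v≢u)) (unmarked λ { (a , lt) → ¬a (a , <-trans (≤-reflexive (sym (dep-parent u≢w))) lt) })

      -- Agents are within `κ` of the head and `w` is one edge further, so marking takes O(k) steps
      -- however large the tree.
      dep-x≤k : dep x ≤ k
      dep-x≤k = ≤-trans (≤-reflexive (δ-sym x w)) (≤-trans (δ-step x (symE G hw)) (≤-trans (≤-reflexive (cong suc (δ-sym h x))) (compact-diameter K x∈)))

    record Marked (σ : State) : Set where
      field
        keepR  : ∀ y → y ≢ rCur → regs σ y ≡ regs σ₀ y
        keepA  : ∀ a → a ≢ aMark → arrs σ a ≡ arrs σ₀ a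
        on     : ∀ {v} → Anc v x → v ≢ w → arrs σ aMark (toℕ v) ≡ suc T
        off    : ∀ {v} → ¬ Anc v x → arrs σ aMark (toℕ v) ≤ T
        at-w   : arrs σ aMark (toℕ w) ≤ T

    run-markChain : Run markChain σ₀ (suc (k * 3)) Marked
    run-markChain = run-weaken (s≤s (*-monoˡ-≤ 3 dep-x≤k)) (run-map finish (run-while I step (dep x) (x , refl , record
      { keepR = λ _ _ → refl ; keepA = λ _ _ → refl ; cur = at-cur ; on-chain = self
      ; marked = λ a lt → contradiction (anc-dep a) (<⇒≱ lt) ; unmarked = λ {v} _ → marks v })))
      where
      finish : ∀ {τ} → (∃ λ N → I N τ) × ⟦ reg rCur ≠ᴱ reg rNext ⟧ τ ≡ 0 → Marked τ
      finish {τ} ((_ , u , _ , mk) , test) = record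
        { keepR = keepR ; keepA = keepA
        ; on    = λ {v} a v≢w → marked a (subst (λ y → dep y < dep v) (sym u≡w) (≤-trans (≤-reflexive (cong suc (δ-refl w))) (n≢0⇒n>0 (v≢w ∘ δ≡0⇒≡))))
        ; off   = λ ¬a → unmarked (¬a ∘ proj₁)
        ; at-w  = unmarked λ { (_ , lt) → contradiction (subst (dep u <_) (δ-refl w) lt) λ () } }
        where
        open Marking mk
        u≡w : u ≡ w
        u≡w = toℕ-injective (trans (sym cur) (trans (∸+∸≡0⇒≡ test) (trans (keepR rNext (λ ())) at-next)))

    private
      record Copying (i : ℕ) (σ : State) : Set where
        field
          keepR : ∀ y → y ≢ rCur → y ≢ rIdx → y ≢ rTmp → regs σ y ≡ regs σ₀ y
          keepA : ∀ a → a ≢ aMark → a ≢ aOut → arrs σ a ≡ arrs σ₀ a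
          on    : ∀ {v} → Anc v x → v ≢ w → arrs σ aMark (toℕ v) ≡ suc T
          off   : ∀ {v} → ¬ Anc v x → arrs σ aMark (toℕ v) ≤ T
          at-w  : arrs σ aMark (toℕ w) ≤ T
          idx   : regs σ rIdx ≡ i
          old   : ∀ {j} → j < B + k → arrs σ aOut j ≡ arrs σ₀ aOut j
          new   : ∀ {j} → j < i → arrs σ aOut (B + k + j) ≡ toℕ (shift x w c j)

      J : ℕ → State → Set
      J N σ = ∃ λ i → N + i ≡ k × Copying i σ

      copy : ∀ {N σ} → J N σ → ⟦ reg rK ⊖ reg rIdx ⟧ σ ≢ 0 → ∃ λ N′ → N ≡ suc N′ ×
             Run (rTmp ≔ arr aOut (reg rBase ⊕ reg rIdx) ⨾
                  cond (arr aMark (reg rTmp) ⊖ reg rLen) (rTmp ≔ arr aToward (reg rTmp)) skip ⨾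
                  aOut [ reg rBase ⊕ reg rK ⊕ reg rIdx ]≔ reg rTmp ⨾ rIdx ≔ reg rIdx ⊕ lit 1) σ 5 (J N′)
      copy {zero}  {σ} (i , refl , cp) test = contradiction (trans (cong₂ _∸_ (trans (Copying.keepR cp rK (λ ()) (λ ()) (λ ())) at-k) (Copying.idx cp)) (n∸n≡0 i)) test
      copy {suc N} {σ} (i , Ni≡k , cp) test = N , refl , assign-then (run-seq {b = 2} {b′ = 2} move write)
        where
        open Copying cp
        σ₁ : State
        σ₁ = assigned rTmp (arr aOut (reg rBase ⊕ reg rIdx)) σ

        i<k : i < k
        i<k = subst (i <_) Ni≡k (s≤s (m≤n+m i N))

        ci∈ : Occupied k c (c i)
        ci∈ = i , i<k , refl

        ci≢w : c i ≢ w
        ci≢w eq = w∉ (i , i<k , eq)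

        base≡ : regs σ rBase ≡ B
        base≡ = trans (keepR rBase (λ ()) (λ ()) (λ ())) at-base

        tmp : regs σ₁ rTmp ≡ toℕ (c i)
        tmp = trans (cong (arrs σ aOut) (cong₂ _+_ base≡ idx)) (trans (old (+-monoʳ-< B i<k)) (row i<k))

        len≡ : regs σ rLen ≡ T
        len≡ = trans (keepR rLen (λ ()) (λ ()) (λ ())) at-len

        Moved : State → Set
        Moved τ = (∀ y → y ≢ rTmp → regs τ y ≡ regs σ y) × (arrs τ ≡ arrs σ) × regs τ rTmp ≡ toℕ (shift x w c i)

        move : Run (cond (arr aMark (reg rTmp) ⊖ reg rLen) (rTmp ≔ arr aToward (reg rTmp)) skip) σ₁ 2 Moved
        move with anc? w (c i) x
        ... | yes a = run-then (λ eq → ∸≢0 (s≤s (≤-reflexive len≡)) (trans (cong (_∸ regs σ rLen) (sym (trans (cong (arrs σ aMark) tmp) (on a ci≢w)))) eq))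
                (run-assign ((λ y y≢ → trans (update-other (regs σ₁) rTmp _ (y≢ ∘ sym)) (update-other (regs σ) rTmp _ (y≢ ∘ sym))) , refl ,
                  trans (cong₂ (λ g y → g y) (keepA aToward (λ ()) (λ ())) tmp) (toward ci∈)))
        ... | no ¬a = run-else (m≤n⇒m∸n≡0 (≤-trans (≤-reflexive (cong (arrs σ aMark) tmp)) (≤-trans (off ¬a) (≤-reflexive (sym len≡)))))
                (run-skip ((λ y y≢ → update-other (regs σ) rTmp _ (y≢ ∘ sym)) , refl , tmp))

        write : ∀ {τ} → Moved τ → Run (aOut [ reg rBase ⊕ reg rK ⊕ reg rIdx ]≔ reg rTmp ⨾ rIdx ≔ reg rIdx ⊕ lit 1) τ 2 (J N)
        write {τ} (keep , refl , tmp′) = store-then (run-assign (suc i , trans (+-suc N i) Ni≡k , record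
          { keepR = λ y p q r → trans (update-other (regs τ) rIdx _ (q ∘ sym)) (trans (keep y r) (keepR y p q r))
          ; keepA = λ a p q → trans (update-other (arrs τ) aOut _ (q ∘ sym)) (keepA a p q)
          ; on = on ; off = off ; at-w = at-w
          ; idx   = trans (+-comm _ 1) (cong suc (trans (keep rIdx (λ ())) idx))
          ; old   = λ {j} j< → trans (cong (λ y → update (arrs τ aOut) y (regs τ rTmp) j) place≡)
                      (trans (update-other (arrs τ aOut) (B + k + i) _ (λ eq → <⇒≢ (≤-trans j< (m≤m+n (B + k) i)) (sym eq))) (old j<))
          ; new   = new′ }))
          where
          place≡ : regs τ rBase + regs τ rK + regs τ rIdx ≡ B + k + i
          place≡ = cong₂ _+_ (cong₂ _+_ (trans (keep rBase (λ ())) base≡) (trans (keep rK (λ ())) (trans (keepR rK (λ ()) (λ ()) (λ ())) at-k))) (trans (keep rIdx (λ ())) idx)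

          new′ : ∀ {j} → j < suc i → update (arrs τ aOut) (regs τ rBase + regs τ rK + regs τ rIdx) (regs τ rTmp) (B + k + j) ≡ toℕ (shift x w c j)
          new′ {j} j< rewrite place≡ with m≤n⇒m<n∨m≡n (≤-pred j<)
          ... | inj₁ lt   = trans (update-other (arrs τ aOut) (B + k + i) _ (λ eq → <⇒≢ lt (sym (+-cancelˡ-≡ (B + k) _ _ eq)))) (new lt)
          ... | inj₂ refl = trans (update-same (arrs τ aOut) (B + k + i) _) tmp′

    record Emitted (σ : State) : Set where
      field
        keepR : ∀ y → y ≢ rCur → y ≢ rIdx → y ≢ rTmp → y ≢ rBase → y ≢ rLen → regs σ y ≡ regs σ₀ y
        keepA : ∀ a → a ≢ aMark → a ≢ aOut → arrs σ a ≡ arrs σ₀ a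
        len   : regs σ rLen ≡ suc T
        base  : regs σ rBase ≡ k + B
        marks′ : ∀ (v : Fin n) → arrs σ aMark (toℕ v) ≤ suc T
        old   : ∀ {j} → j < k + B → arrs σ aOut j ≡ arrs σ₀ aOut j
        new   : ∀ {j} → j < k → arrs σ aOut (k + B + j) ≡ toℕ (shift x w c j)

    run-emit : Run emit σ₀ (suc (k * 3) + suc (suc (k * 6) + 2)) Emitted
    run-emit = run-seq run-markChain λ {τ} mk → let open Marked mk in
      assign-then (run-seq (run-while J copy k (0 , +-identityʳ k , record
        { keepR = λ y p q r → trans (update-other (regs τ) rIdx 0 (q ∘ sym)) (keepR y p)
        ; keepA = λ a p q → keepA a p ; on = on ; off = off ; at-w = at-w ; idx = refl
        ; old = λ {j} _ → cong (λ g → g j) (keepA aOut (λ ())) ; new = λ () })) finish)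
      where
      finish : ∀ {τ} → (∃ λ N → J N τ) × ⟦ reg rK ⊖ reg rIdx ⟧ τ ≡ 0 → Run (rBase ≔ reg rBase ⊕ reg rK ⨾ rLen ≔ reg rLen ⊕ lit 1) τ 2 Emitted
      finish {τ} ((N , i , _ , cp) , test) = assign-then (run-assign record
        { keepR  = λ y p q r s t → trans (update-other (regs (assigned rBase (reg rBase ⊕ reg rK) τ)) rLen _ (t ∘ sym)) (trans (update-other (regs τ) rBase _ (s ∘ sym)) (keepR y p q r))
        ; keepA  = keepA
        ; len    = trans (+-comm _ 1) (cong suc (trans (keepR rLen (λ ()) (λ ()) (λ ())) at-len))
        ; base   = trans (cong₂ _+_ (trans (keepR rBase (λ ()) (λ ()) (λ ())) at-base) k≡) (+-comm B k)
        ; marks′ = marks″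
        ; old    = λ j< → old (≤-trans j< (≤-reflexive (+-comm k B)))
        ; new    = λ {j} j<k → trans (cong (λ y → arrs τ aOut (y + j)) (+-comm k B)) (new (≤-trans j<k k≤i)) })
        where
        open Copying cp
        k≡ : regs τ rK ≡ k
        k≡ = trans (keepR rK (λ ()) (λ ()) (λ ())) at-k

        k≤i : k ≤ i
        k≤i = m∸n≡0⇒m≤n (trans (sym (cong₂ _∸_ k≡ idx)) test)

        marks″ : ∀ v → arrs τ aMark (toℕ v) ≤ suc T
        marks″ v with anc? w v x | v ≟ᶠ w
        ... | no ¬a | _        = m≤n⇒m≤1+n (off ¬a)
        ... | yes a | no v≢w   = ≤-reflexive (on a v≢w)
        ... | yes _ | yes refl = m≤n⇒m≤1+n at-w

-- The program simulates the abstract machine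

sum-tabulate-< : ∀ {n} {g g′ : Fin n → ℕ} u → (∀ v → g′ v ≤ g v) → g′ u < g u → sum (tabulate g′) < sum (tabulate g)
sum-tabulate-≤ : ∀ {n} {g g′ : Fin n → ℕ} → (∀ v → g′ v ≤ g v) → sum (tabulate g′) ≤ sum (tabulate g)
sum-tabulate-≤ {zero}  le = z≤n
sum-tabulate-≤ {suc n} le = +-mono-≤ (le zero) (sum-tabulate-≤ (le ∘ suc))
sum-tabulate-< zero    le lt = +-mono-<-≤ lt (sum-tabulate-≤ (le ∘ suc))
sum-tabulate-< (suc u) le lt = +-mono-≤-< (le zero) (sum-tabulate-< u (le ∘ suc) lt)

module Simulation {n : ℕ} (G : Graph n) (tree : IsTree G) (z r : Fin n) (diametral : Separation.Diametral G tree r z)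
                  (adj : Fin n → List (Fin n)) (isAdj : IsAdjacencyLists G adj) (κ : ℕ) (off nbr : ℕ → ℕ)
                  (off-suc : ∀ v → off (toℕ v + 1) ≡ off (toℕ v) + length (adj v))
                  (nbr-at : ∀ v i → nbr (off (toℕ v) + toℕ i) ≡ toℕ (lookup (adj v) i)) where

  open Metric G tree
  open Separation G tree
  open Shifting G tree
  open Rooted G tree z
  open Traversal G tree z r diametral adj isAdj
  open Execution G tree z r diametral adj isAdj κ
  open Emission G tree κ
  open import Data.List.Membership.DecPropositional (_≟ᶠ_ {n}) using (_∈?_)

  open Machine

  private
    k : ℕ
    k = suc κ

  record Base (m : Machine) (σ : State) : Set where
    field
      at-k    : regs σ rK ≡ k
      at-len  : regs σ rLen ≡ T m
      at-head : regs σ rHead ≡ toℕ (h m)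
      at-top  : regs σ rTop ≡ toℕ (top m)
      at-kept : regs σ rKept ≡ q m
      at-done : regs σ rDone ≡ f m
      at-size : regs σ rSize ≡ s m
      at-base : regs σ rBase ≡ T m * k
      at-root : regs σ rRoot ≡ toℕ z
      at-off  : arrs σ aOff ≡ off
      at-adj  : arrs σ aAdj ≡ nbr
      at-par  : ∀ v → arrs σ aPar (toℕ v) ≡ toℕ (parent v)
      at-used : ∀ v → arrs σ aUsed (toℕ v) ≡ cnt m v
      at-mark : ∀ (v : Fin n) → arrs σ aMark (toℕ v) ≤ T m
      at-fin  : ∀ {j} → j < f m → arrs σ aDone j ≡ toℕ (F m j)
      at-out  : ∀ {t i} → t ≤ T m → i < s m → arrs σ aOut (t * k + i) ≡ toℕ (cfg m t i)

  record Rep (m : Machine) (σ : State) : Set where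
    field
      base   : Base m σ
      seen   : ∀ {v} → v ∈ V m → arrs σ aSeen (toℕ v) ≡ 3
      unseen : ∀ {v} → v ∉ V m → arrs σ aSeen (toℕ v) < 3
      toward : ∀ {v} → v ∈ V m → v ≢ h m → arrs σ aToward (toℕ v) ≡ toℕ (par (h m) v)

  -- Memory on starting `enter`: `V m` already includes `w`, and directions refer to `w`. Exempt are
  -- the flag of `w` and the direction at the old head, which the first two stores of `enter` set,
  -- and the direction at `w`, which has no meaning.
  record PendingRep (m : Machine) (w : Fin n) (σ : State) : Set where
    field
      base    : Base m σ
      at-next : regs σ rNext ≡ toℕ w
      seen    : ∀ {v} → v ∈ V m → v ≢ w → arrs σ aSeen (toℕ v) ≡ 3
      unseen  : ∀ {v} → v ∉ V m → arrs σ aSeen (toℕ v) < 3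
      toward  : ∀ {v} → v ∈ V m → v ≢ h m → v ≢ w → arrs σ aToward (toℕ v) ≡ toℕ (par w v)

  private
    record Entered (m : Machine) (w : Fin n) (σ : State) : Set where
      field
        base    : Base m σ
        at-next : regs σ rNext ≡ toℕ w
        seen    : ∀ {v} → v ∈ V m → arrs σ aSeen (toℕ v) ≡ 3
        unseen  : ∀ {v} → v ∉ V m → arrs σ aSeen (toℕ v) < 3
        toward  : ∀ {v} → v ∈ V m → v ≢ w → arrs σ aToward (toℕ v) ≡ toℕ (par w v)

  -- Uninspected adjacency entries plus unfinished vertices: each round of `advance` uses up one of
  -- either.
  measure : Machine → ℕ
  measure m = sum (tabulate (λ v → length (adj v) ∸ cnt m v)) + (n ∸ f m)

  Reached : (Machine → Set) → State → Set
  Reached P σ = ∃ λ m → Inv m × Rep m σ × P m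

  emit-cost : ℕ
  emit-cost = suc (k * 3) + suc (suc (k * 6) + 2)

  -- `enter` changes neither `f` nor `cnt`, so whatever depends on these alone survives it; `Q` is
  -- instantiated with a bound on `measure`.
  module _ {m : Machine} {w : Fin n} (P : Pending m w) (Q : Machine → Set)
           (respects : ∀ m′ → f m′ ≡ f m → cnt m′ ≡ cnt m → Q m′) where

    open Pending P
    open Arriving arriving hiding (deep; top-in)

    private
      Pre : State → Set
      Pre τ = Reached Q (assigned rHead (reg rNext) τ)

      run-place : ∀ {σ} → Entered m w σ → s m < k → Run (aOut [ reg rSize ]≔ reg rNext ⨾ rSize ≔ reg rSize ⊕ lit 1) σ 2 Pre
      run-place {σ} en s<k = store-then (run-assign (placed m w , inv-placed P s<k , record
        { base = record
          { at-k = at-k ; at-len = at-len ; at-head = at-next ; at-top = at-top ; at-kept = at-kept ; at-done = at-done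
          ; at-size = trans (+-comm _ 1) (cong suc at-size)
          ; at-base = at-base ; at-root = at-root ; at-off = at-off ; at-adj = at-adj ; at-par = at-par ; at-used = at-used
          ; at-mark = at-mark ; at-fin = at-fin ; at-out = out′ }
        ; seen = seen ; unseen = unseen ; toward = toward } , respects _ refl refl))
        where
        open Entered en
        open Base base
        T≡0 : T m ≡ 0
        T≡0 = proj₁ (unfull s<k)

        out′ : ∀ {t i} → t ≤ T m → i < suc (s m) → update (arrs σ aOut) (regs σ rSize) (regs σ rNext) (t * k + i) ≡ toℕ (cfg (placed m w) t i)
        out′ {t} {i} t≤ i< with refl ← n≤0⇒n≡0 (subst (t ≤_) T≡0 t≤) = trans (go (s m ≟ i)) (cong (λ g → toℕ (g i)) (sym row≡))
          where
          row≡ : cfg (placed m w) 0 ≡ update (now m) (s m) w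
          row≡ = trans (cong (λ y → update (cfg m) y (update (now m) (s m) w) 0) T≡0) (update-same (cfg m) 0 _)
          go : Dec (s m ≡ i) → update (arrs σ aOut) (regs σ rSize) (regs σ rNext) i ≡ toℕ (update (now m) (s m) w i)
          go (yes refl) = trans (cong (λ y → update (arrs σ aOut) y (regs σ rNext) i) at-size) (trans (update-same (arrs σ aOut) (s m) _) (trans at-next (cong toℕ (sym (update-same (now m) (s m) w)))))
          go (no s≢i)   = trans (cong (λ y → update (arrs σ aOut) y (regs σ rNext) i) at-size) (trans (update-other (arrs σ aOut) (s m) _ s≢i)
            (trans (at-out z≤n (≤∧≢⇒< (≤-pred i<) (s≢i ∘ sym))) (cong toℕ (trans (cong (λ y → cfg m y i) (sym T≡0)) (sym (update-other (now m) (s m) w s≢i))))))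

      -- Common to both eviction rules, which differ only in the evicted `x` and in the new values
      -- of `top` and `q`.
      run-evict : ∀ {σ σ₁ x top′ q′} → Entered m w σ → (s≡k : s m ≡ k) → Occupied (s m) (now m) x →
                  (∀ {v} → Occupied (s m) (now m) v → par w v ≢ x) →
                  (∀ y → y ≢ rCur → y ≢ rTop → y ≢ rKept → regs σ₁ y ≡ regs σ y) → arrs σ₁ ≡ arrs σ →
                  regs σ₁ rCur ≡ toℕ x → regs σ₁ rTop ≡ toℕ top′ → regs σ₁ rKept ≡ q′ →
                  Link κ w top′ (V m) (F m) (f m) q′ (s m) (shift x w (now m)) → Step (s m) (now m) (shift x w (now m)) →
                  Run emit σ₁ emit-cost Pre
      run-evict {σ} {σ₁} {x} {top′} {q′} en s≡k x∈ leaf keep refl cur₁ top₁ kept₁ link′ step =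
        run-map emitted⇒ (run-emit (subst (λ a → Compact (h m) a (now m)) s≡k compact) hw (w∉S ∘ subst-occ (sym s≡k)) (subst-occ s≡k x∈) (leaf ∘ subst-occ (sym s≡k))
          (trans (keep rK (λ ()) (λ ()) (λ ())) at-k) (trans (keep rLen (λ ()) (λ ()) (λ ())) at-len) (trans (keep rNext (λ ()) (λ ()) (λ ())) at-next)
          (trans (keep rBase (λ ()) (λ ()) (λ ())) at-base) cur₁
          (λ v∈ → toward (S⊆V (subst-occ (sym s≡k) v∈)) λ { refl → w∉S (subst-occ (sym s≡k) v∈) }) at-mark (λ i<k → at-out ≤-refl (≤-trans i<k (≤-reflexive (sym s≡k)))))
        where
        open Entered en
        open Base base

        subst-occ : ∀ {a b c v} → a ≡ b → Occupied a c v → Occupied b c v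
        subst-occ refl o = o

        emitted⇒ : ∀ {τ} → Emitted {h = h m} _ _ _ _ _ _ _ _ _ _ _ _ _ τ → Pre τ
        emitted⇒ {τ} em = evicted P s≡k (shift x w (now m)) top′ q′ , inv-evicted P s≡k _ top′ q′ link′ step , record
          { base = record
            { at-k    = trans (stays rK (λ ()) (λ ()) (λ ()) (λ ()) (λ ()) (λ ()) (λ ())) at-k
            ; at-len  = em.len
            ; at-head = trans (stays rNext (λ ()) (λ ()) (λ ()) (λ ()) (λ ()) (λ ()) (λ ())) at-next
            ; at-top  = trans (em.keepR rTop (λ ()) (λ ()) (λ ()) (λ ()) (λ ())) top₁
            ; at-kept = trans (em.keepR rKept (λ ()) (λ ()) (λ ()) (λ ()) (λ ())) kept₁
            ; at-done = trans (stays rDone (λ ()) (λ ()) (λ ()) (λ ()) (λ ()) (λ ()) (λ ())) at-done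
            ; at-size = trans (stays rSize (λ ()) (λ ()) (λ ()) (λ ()) (λ ()) (λ ()) (λ ())) at-size
            ; at-base = em.base
            ; at-root = trans (stays rRoot (λ ()) (λ ()) (λ ()) (λ ()) (λ ()) (λ ()) (λ ())) at-root
            ; at-off  = trans (em.keepA aOff (λ ()) (λ ())) at-off
            ; at-adj  = trans (em.keepA aAdj (λ ()) (λ ())) at-adj
            ; at-par  = λ v → trans (cong (λ g → g (toℕ v)) (em.keepA aPar (λ ()) (λ ()))) (at-par v)
            ; at-used = λ v → trans (cong (λ g → g (toℕ v)) (em.keepA aUsed (λ ()) (λ ()))) (at-used v)
            ; at-mark = em.marks′
            ; at-fin  = λ {j} j< → trans (cong (λ g → g j) (em.keepA aDone (λ ()) (λ ()))) (at-fin j<)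
            ; at-out  = out′ }
          ; seen   = λ {v} v∈ → trans (cong (λ g → g (toℕ v)) (em.keepA aSeen (λ ()) (λ ()))) (seen v∈)
          ; unseen = λ {v} v∉ → subst (λ g → g (toℕ v) < 3) (sym (em.keepA aSeen (λ ()) (λ ()))) (unseen v∉)
          ; toward = λ {v} v∈ v≢w → trans (cong (λ g → g (toℕ v)) (em.keepA aToward (λ ()) (λ ()))) (toward v∈ v≢w) } , respects _ refl refl
          where
          module em = Emitted em
          stays : ∀ y → y ≢ rCur → y ≢ rIdx → y ≢ rTmp → y ≢ rBase → y ≢ rLen → y ≢ rTop → y ≢ rKept → regs τ y ≡ regs σ y
          stays y a b c d e g i = trans (em.keepR y a b c d e) (keep y a g i)

          out′ : ∀ {t i} → t ≤ suc (T m) → i < s m → arrs τ aOut (t * k + i) ≡ toℕ (update (cfg m) (suc (T m)) (shift x w (now m)) t i)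
          out′ {t} {i} t≤ i< with m≤n⇒m<n∨m≡n t≤
          ... | inj₂ refl = trans (em.new (≤-trans i< (≤-reflexive s≡k))) (cong (λ g → toℕ (g i)) (sym (update-same (cfg m) (suc (T m)) _)))
          ... | inj₁ t<   = trans (em.old in-range) (trans (at-out (≤-pred t<) i<) (cong (λ g → toℕ (g i)) (sym (update-other (cfg m) (suc (T m)) _ (λ eq → <⇒≢ t< (sym eq))))))
            where
            in-range : t * k + i < k + T m * k
            in-range = ≤-trans (+-monoʳ-< (t * k) (≤-trans i< (≤-reflexive s≡k))) (≤-trans (≤-reflexive (+-comm (t * k) k)) (+-monoʳ-≤ k (*-monoˡ-≤ k (≤-pred t<))))

      run-choose : ∀ {σ} → Entered m w σ → s m ≡ k → Run (chooseEvicted ⨾ emit) σ (3 + emit-cost) Pre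
      run-choose {σ} en s≡k with m≤n⇒m<n∨m≡n q≤f
      ... | inj₁ q<f with x∈ , leaf , link′ , step ← evict-finished κ trav arriving q<f =
        run-seq {b = 3} {R = _≡ assigned rKept (reg rKept ⊕ lit 1) (assigned rCur (arr aDone (reg rKept)) σ)}
          (run-then (λ eq → ∸≢0 q<f (trans (sym (cong₂ _∸_ at-done at-kept)) eq)) (assign-then (run-assign refl)))
          λ { refl → run-evict en s≡k x∈ leaf
                (λ y a b c → trans (update-other (regs (assigned rCur (arr aDone (reg rKept)) σ)) rKept _ (c ∘ sym)) (update-other (regs σ) rCur _ (a ∘ sym)))
                refl (trans (cong (arrs σ aDone) at-kept) (at-fin q<f)) at-top (trans (+-comm _ 1) (cong suc at-kept)) link′ step }
        where
        open Entered en
        open Base base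
      ... | inj₂ q≡f with x∈ , top≢w , leaf , link′ , step ← evict-top κ trav (subst₂ (λ a b → Arriving κ (h m) w (top m) (V m) (F m) (f m) a b (now m)) q≡f s≡k arriving) =
        run-seq {b = 3} {R = _≡ assigned rTop (arr aToward (reg rTop)) (assigned rCur (reg rTop) σ)}
          (run-else (trans (cong₂ _∸_ at-done at-kept) (trans (cong (f m ∸_) q≡f) (n∸n≡0 (f m)))) (assign-then (run-assign refl)))
          λ { refl → run-evict en s≡k (subst (λ a → Occupied a (now m) (top m)) (sym s≡k) x∈) (λ {v} v∈ → leaf (subst (λ a → Occupied a (now m) v) s≡k v∈))
                (λ y a b c → trans (update-other (regs (assigned rCur (reg rTop) σ)) rTop _ (b ∘ sym)) (update-other (regs σ) rCur _ (a ∘ sym)))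
                refl at-top (trans (cong (arrs σ aToward) at-top) (toward top∈V top≢w)) at-kept
                (subst₂ (λ a b → Link κ w (par w (top m)) (V m) (F m) (f m) a b (shift (top m) w (now m))) (sym q≡f) (sym s≡k) link′)
                (subst (λ a → Step a (now m) (shift (top m) w (now m))) (sym s≡k) step) }
        where
        open Entered en
        open Base base

    run-enter : ∀ {σ} → PendingRep m w σ → Run enter σ (2 + (suc (3 + emit-cost) + 1)) (Reached Q)
    run-enter {σ} R = store-then (store-then (run-seq branch λ pre → run-assign pre))
      where
      open PendingRep R
      open Base base
      σ₂ : State
      σ₂ = stored aToward (reg rHead) (reg rNext) (stored aSeen (reg rNext) (lit 3) σ)

      seen′ : ∀ {v} → v ∈ V m → arrs σ₂ aSeen (toℕ v) ≡ 3
      seen′ {v} v∈ with v ≟ᶠ w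
      ... | yes refl = update-at (arrs σ aSeen) at-next
      ... | no v≢w   = trans (update-≢ (arrs σ aSeen) at-next v≢w) (seen v∈ v≢w)

      toward′ : ∀ {v} → v ∈ V m → v ≢ w → arrs σ₂ aToward (toℕ v) ≡ toℕ (par w v)
      toward′ {v} v∈ v≢w with v ≟ᶠ h m
      ... | yes refl = trans (update-at (arrs σ aToward) at-head) (trans at-next (cong toℕ (sym (par-adjacent hw))))
      ... | no v≢h   = trans (update-≢ (arrs σ aToward) at-head v≢h) (toward v∈ v≢h v≢w)

      entered : Entered m w σ₂
      entered = record
        { base = record { Base base } ; at-next = at-next ; seen = seen′
        ; unseen = λ {v} v∉ → ≤-trans (≤-reflexive (cong suc (update-≢ (arrs σ aSeen) at-next λ { refl → v∉ (Trav.h∈V trav) }))) (unseen v∉)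
        ; toward = toward′ }

      branch : Run (cond (reg rK ⊖ reg rSize) (aOut [ reg rSize ]≔ reg rNext ⨾ rSize ≔ reg rSize ⊕ lit 1) (chooseEvicted ⨾ emit)) σ₂ (suc (3 + emit-cost)) Pre
      branch with m≤n⇒m<n∨m≡n s≤k
      ... | inj₁ s<k = run-then (λ eq → ∸≢0 s<k (trans (sym (cong₂ _∸_ at-k at-size)) eq)) (run-weaken (s≤s (s≤s z≤n)) (run-place entered s<k))
      ... | inj₂ s≡k = run-else (trans (cong₂ _∸_ at-k at-size) (trans (cong (k ∸_) s≡k) (n∸n≡0 k))) (run-choose entered s≡k)

  enter-cost : ℕ
  enter-cost = 2 + (suc (3 + emit-cost) + 1)

  Loop : ℕ → State → Set
  Loop N = Reached (λ m → measure m ≤ N)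

  private
    spend : ∀ {a b N} → a < b → b ≤ N → ∃ λ N′ → N ≡ suc N′ × a ≤ N′
    spend {N = zero}  a<b b≤ = contradiction (≤-trans a<b b≤) λ ()
    spend {N = suc N} a<b b≤ = N , refl , ≤-pred (≤-trans a<b b≤)

  run-advance : ∀ {N σ} → Loop N σ → ⟦ reg rHead ≠ᴱ reg rRoot ⟧ σ ≢ 0 → ∃ λ N′ → N ≡ suc N′ × Run advance σ (7 + enter-cost) (Loop N′)
  run-advance {N} {σ} (m , I , R , fuel) test = go (m≤n⇒m<n∨m≡n (Trav.cnt≤ trav (h m)))
    where
    open Inv I
    open Rep R
    open Base base

    u : Fin n
    u = h m

    u≢z : u ≢ z
    u≢z eq = test (∸+∸≡0 (trans at-head (trans (cong toℕ eq) (sym at-root))))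

    σ₁ : State
    σ₁ = assigned rCur (arr aOff (reg rHead) ⊕ arr aUsed (reg rHead)) σ

    used≡ : arrs σ aUsed (regs σ rHead) ≡ cnt m u
    used≡ = trans (cong (arrs σ aUsed) at-head) (at-used u)

    cur : regs σ₁ rCur ≡ off (toℕ u) + cnt m u
    cur = cong₂ _+_ (cong₂ (λ g y → g y) at-off at-head) used≡

    test₁ : ⟦ arr aOff (reg rHead ⊕ lit 1) ⊖ reg rCur ⟧ σ₁ ≡ length (adj u) ∸ cnt m u
    test₁ = trans (cong₂ _∸_ (trans (cong₂ (λ g y → g (y + 1)) at-off at-head) (off-suc u)) cur) ([m+n]∸[m+o]≡n∸o (off (toℕ u)) _ _)

    par≡ : arrs σ aPar (regs σ rHead) ≡ toℕ (parent u)
    par≡ = trans (cong (arrs σ aPar) at-head) (at-par u)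

    continue : ∀ {a p b} → (∃ λ N′ → N ≡ suc N′ × a ≤ N′) → (∀ N′ → a ≤ N′ → Run p σ b (Loop N′)) → ∃ λ N′ → N ≡ suc N′ × Run p σ b (Loop N′)
    continue (N′ , N≡ , le) body = N′ , N≡ , body N′ le

    go : cnt m u < length (adj u) ⊎ cnt m u ≡ length (adj u) → ∃ λ N′ → N ≡ suc N′ × Run advance σ (7 + enter-cost) (Loop N′)
    go (inj₁ c<) = continue (spend less fuel) λ N′ fuel′ → run-weaken (n≤1+n _)
      (assign-then (run-then (λ eq → ∸≢0 c< (trans (sym test₁) eq)) (assign-then (store-then (inspect N′ fuel′ (w ≟ᶠ parent u) (w ∈? V m))))))
      where
      i : Fin (length (adj u))
      i = fromℕ< c<

      i≡ : toℕ i ≡ cnt m u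
      i≡ = toℕ-fromℕ< c<

      w : Fin n
      w = lookup (adj u) i

      cnt′ : Fin n → ℕ
      cnt′ = bump u (cnt m)

      less : sum (tabulate (λ v → length (adj v) ∸ cnt′ v)) + (n ∸ f m) < measure m
      less = +-monoˡ-< (n ∸ f m) (sum-tabulate-< u (λ v → ∸-monoʳ-≤ (length (adj v)) (bump≥ v)) strict)
        where
        bump≥ : ∀ v → cnt m v ≤ cnt′ v
        bump≥ v with u ≟ᶠ v
        ... | yes _ = n≤1+n _
        ... | no _  = ≤-refl
        strict : length (adj u) ∸ cnt′ u < length (adj u) ∸ cnt m u
        strict = subst (λ y → length (adj u) ∸ y < length (adj u) ∸ cnt m u) (sym (if-yes (u ≟ᶠ u) refl)) (∸-monoʳ-< (n<1+n (cnt m u)) c<)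

      σ₃ : State
      σ₃ = stored aUsed (reg rHead) (arr aUsed (reg rHead) ⊕ lit 1) (assigned rNext (arr aAdj (reg rCur)) σ₁)

      next : regs σ₃ rNext ≡ toℕ w
      next = trans (cong₂ (λ g y → g y) at-adj (trans cur (cong (off (toℕ u) +_) (sym i≡)))) (nbr-at u i)

      used′ : ∀ v → arrs σ₃ aUsed (toℕ v) ≡ cnt′ v
      used′ v with u ≟ᶠ v
      ... | yes refl = trans (update-at (arrs σ aUsed) at-head) (trans (+-comm _ 1) (cong suc used≡))
      ... | no u≢v   = trans (update-≢ (arrs σ aUsed) at-head (u≢v ∘ sym)) (at-used v)

      skipped-rep : Rep (skipped m) σ₃
      skipped-rep = record { base = record { Base base hiding (at-used) ; at-used = used′ } ; seen = seen ; unseen = unseen ; toward = toward }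

      inspect : ∀ N′ → sum (tabulate (λ v → length (adj v) ∸ cnt′ v)) + (n ∸ f m) ≤ N′ → Dec (w ≡ parent u) → Dec (w ∈ V m) →
                Run (cond (reg rNext ≠ᴱ arr aPar (reg rHead)) (cond (lit 3 ⊖ arr aSeen (reg rNext)) enter skip) skip) σ₃ (2 + enter-cost) (Loop N′)
      inspect N′ fuel′ (yes w≡p) _ = run-else (∸+∸≡0 (trans next (trans (cong toℕ w≡p) (sym par≡))))
        (run-skip (skipped m , inv-skipped I i i≡ (inj₁ w≡p) , skipped-rep , fuel′))
      inspect N′ fuel′ (no w≢p) (yes w∈) = run-then (∸+∸≢0 λ eq → w≢p (toℕ-injective (trans (sym next) (trans eq par≡))))
        (run-else (trans (cong (3 ∸_) (trans (cong (arrs σ aSeen) next) (seen w∈))) refl)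
          (run-skip (skipped m , inv-skipped I i i≡ (inj₂ w∈) , skipped-rep , fuel′)))
      inspect N′ fuel′ (no w≢p) (no w∉) = run-then (∸+∸≢0 λ eq → w≢p (toℕ-injective (trans (sym next) (trans eq par≡))))
        (run-then (λ eq → ∸≢0 (unseen w∉) (trans (cong (3 ∸_) (sym (cong (arrs σ aSeen) next))) eq))
          (run-enter P (λ m′ → measure m′ ≤ N′) (λ m′ f≡ cnt≡ → subst₂ (λ a b → sum (tabulate (λ v → length (adj v) ∸ a v)) + (n ∸ b) ≤ N′) (sym cnt≡) (sym f≡) fuel′) record
            { base    = record { Base base hiding (at-used) ; at-used = used′ }
            ; at-next = next
            ; seen    = λ { (here refl) w≢w → contradiction refl w≢w ; (there v∈) _ → seen v∈ }
            ; unseen  = λ v∉ → unseen (v∉ ∘ there)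
            ; toward  = λ { (here refl) _ w≢w → contradiction refl w≢w
                          ; {v} (there v∈) v≢u v≢w → trans (toward v∈ v≢u) (cong toℕ (sym (par-reroot (Arriving.hw (Pending.arriving P)) v≢u v≢w))) } }))
        where
        P : Pending (descending m w) w
        P = pending-descending I i i≡ w≢p w∉
    go (inj₂ c≡) = continue (spend less fuel) λ N′ fuel′ →
      assign-then (run-else (trans test₁ (trans (cong (length (adj u) ∸_) c≡) (n∸n≡0 (length (adj u))))) (assign-then (store-then (assign-then (leave N′ fuel′ (u ≟ᶠ top m))))))
      where
      f<n : f m < n
      f<n = injective⇒≤ {f = λ (i : Fin (suc (f m))) → update (F m) (f m) u (toℕ i)}
              λ eq → toℕ-injective (injective-push (Trav.F-injective trav) (Trav.h∉F trav) (toℕ<n _) (toℕ<n _) eq)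

      less : sum (tabulate (λ v → length (adj v) ∸ cnt m v)) + (n ∸ suc (f m)) < measure m
      less = +-monoʳ-< (sum (tabulate (λ v → length (adj v) ∸ cnt m v))) (∸-monoʳ-< (n<1+n (f m)) f<n)

      σ₄ : State
      σ₄ = assigned rDone (reg rDone ⊕ lit 1) (stored aDone (reg rDone) (reg rHead) (assigned rNext (arr aPar (reg rHead)) σ₁))

      fin′ : ∀ {j} → j < suc (f m) → arrs σ₄ aDone j ≡ toℕ (update (F m) (f m) u j)
      fin′ {j} j< = trans (cong (λ y → update (arrs σ aDone) y (regs σ rHead) j) at-done) (by (f m ≟ j))
        where
        by : Dec (f m ≡ j) → update (arrs σ aDone) (f m) (regs σ rHead) j ≡ toℕ (update (F m) (f m) u j)
        by (yes refl) = trans (update-same (arrs σ aDone) (f m) _) (trans at-head (cong toℕ (sym (update-same (F m) (f m) u))))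
        by (no f≢j)   = trans (update-other (arrs σ aDone) (f m) _ f≢j) (trans (at-fin (≤∧≢⇒< (≤-pred j<) (f≢j ∘ sym))) (cong toℕ (sym (update-other (F m) (f m) u f≢j))))

      uw : E G u (parent u)
      uw = E-par u≢z

      leave : ∀ N′ → sum (tabulate (λ v → length (adj v) ∸ cnt m v)) + (n ∸ suc (f m)) ≤ N′ → Dec (u ≡ top m) →
              Run (cond (reg rHead ≠ᴱ reg rTop) (aToward [ reg rHead ]≔ reg rNext ⨾ rHead ≔ reg rNext) (rTop ≔ reg rNext ⨾ enter)) σ₄ (2 + enter-cost) (Loop N′)
      leave N′ fuel′ (no u≢top) with _ , I′ ← inv-returned I c≡ u≢top = run-then (∸+∸≢0 λ eq → u≢top (toℕ-injective (trans (sym at-head) (trans eq at-top))))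
        (store-then (run-assign (returned m , I′ , record
          { base   = record { Base base hiding (at-head; at-done; at-fin) ; at-head = par≡ ; at-done = trans (+-comm _ 1) (cong suc at-done) ; at-fin = fin′ }
          ; seen   = seen
          ; unseen = unseen
          ; toward = toward′ } , fuel′)))
        where
        toward′ : ∀ {v} → v ∈ V m → v ≢ parent u → update (arrs σ aToward) (regs σ rHead) (arrs σ aPar (regs σ rHead)) (toℕ v) ≡ toℕ (par (parent u) v)
        toward′ {v} v∈ v≢p with v ≟ᶠ u
        ... | yes refl = trans (update-at (arrs σ aToward) at-head) (trans par≡ (cong toℕ (sym (par-adjacent uw))))
        ... | no v≢u   = trans (update-≢ (arrs σ aToward) at-head v≢u) (trans (toward v∈ v≢u) (cong toℕ (sym (par-reroot uw v≢u v≢p))))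
      leave N′ fuel′ (yes u≡top) = run-else (∸+∸≡0 (trans at-head (trans (cong toℕ u≡top) (sym at-top)))) (assign-then (climb (parent u ∈? V m)))
        where
        σ₅ : State
        σ₅ = assigned rTop (reg rNext) σ₄

        base′ : ∀ {V′ M′} → Base (climbTo m V′ M′) σ₅
        base′ = record { Base base hiding (at-top; at-done; at-fin) ; at-top = par≡ ; at-done = trans (+-comm _ 1) (cong suc at-done) ; at-fin = fin′ }

        toward′ : ∀ {v} → v ∈ V m → v ≢ u → v ≢ parent u → arrs σ aToward (toℕ v) ≡ toℕ (par (parent u) v)
        toward′ v∈ v≢u v≢p = trans (toward v∈ v≢u) (cong toℕ (sym (par-reroot uw v≢u v≢p)))

        respects : ∀ m′ → f m′ ≡ suc (f m) → cnt m′ ≡ cnt m → measure m′ ≤ N′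
        respects m′ f≡ cnt≡ = subst₂ (λ a b → sum (tabulate (λ v → length (adj v) ∸ a v)) + (n ∸ b) ≤ N′) (sym cnt≡) (sym f≡) fuel′

        climb : Dec (parent u ∈ V m) → Run enter σ₅ enter-cost (Loop N′)
        climb (yes p∈) = run-enter (pending-revisit I c≡ u≡top u≢z p∈) (λ m′ → measure m′ ≤ N′) respects record
          { base = base′ ; at-next = par≡ ; seen = λ v∈ _ → seen v∈ ; unseen = unseen ; toward = toward′ }
        climb (no p∉) = run-enter (pending-spine I c≡ u≡top u≢z p∉) (λ m′ → measure m′ ≤ N′) respects record
          { base = base′ ; at-next = par≡
          ; seen   = λ { (here refl) p≢p → contradiction refl p≢p ; (there v∈) _ → seen v∈ }
          ; unseen = λ v∉ → unseen (v∉ ∘ there)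
          ; toward = λ { (here refl) _ p≢p → contradiction refl p≢p ; (there v∈) → toward′ v∈ } }

-- The whole program

planWalk : Cmd
planWalk =
  rRoot ≔ lit 0 ⨾
  rStamp ≔ lit 1 ⨾
  sweep ⨾
  rRoot ≔ reg rBest ⨾
  rStamp ≔ lit 2 ⨾
  sweep ⨾
  rHead ≔ reg rBest ⨾
  rTop ≔ reg rBest ⨾
  rLen ≔ lit 0 ⨾
  rBase ≔ lit 0 ⨾
  rKept ≔ lit 0 ⨾
  rDone ≔ lit 0 ⨾
  rSize ≔ lit 1 ⨾
  aSeen [ reg rHead ]≔ lit 3 ⨾
  aOut [ lit 0 ]≔ reg rHead ⨾
  while (reg rHead ≠ᴱ reg rRoot) advance

-- Adjacency lists in the input arrays, and degrees

load-map-applyUpTo : ∀ (g f : ℕ → ℕ) m i → i < m → load (map g (applyUpTo f m)) i ≡ g (f i)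
load-map-applyUpTo g f (suc m) zero    _         = refl
load-map-applyUpTo g f (suc m) (suc i) (s≤s i<m) = load-map-applyUpTo g (f ∘ suc) m i i<m

sum-take-suc : ∀ {m} (g : Fin m → ℕ) v → sum (take (suc (toℕ v)) (tabulate g)) ≡ sum (take (toℕ v) (tabulate g)) + g v
sum-take-suc g zero    = +-identityʳ (g zero)
sum-take-suc g (suc v) = trans (cong (g zero +_) (sum-take-suc (g ∘ suc) v)) (sym (+-assoc (g zero) _ _))

load-++ˡ : ∀ {n} (xs ys : List (Fin n)) i → load (map toℕ (xs ++ ys)) (toℕ i) ≡ toℕ (lookup xs i)
load-++ˡ (x ∷ xs) ys zero    = refl
load-++ˡ (x ∷ xs) ys (suc i) = load-++ˡ xs ys i

load-++ʳ : ∀ {n} (xs ys : List (Fin n)) j → load (map toℕ (xs ++ ys)) (length xs + j) ≡ load (map toℕ ys) j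
load-++ʳ []       ys j = refl
load-++ʳ (x ∷ xs) ys j = load-++ʳ xs ys j

load-concat : ∀ {m n} (adj : Fin m → List (Fin n)) v i →
              load (map toℕ (concat (tabulate adj))) (sum (take (toℕ v) (tabulate (length ∘ adj))) + toℕ i) ≡ toℕ (lookup (adj v) i)
load-concat adj zero    i = load-++ˡ (adj zero) (concat (tabulate (adj ∘ suc))) i
load-concat adj (suc v) i = trans (cong (load (map toℕ (adj zero ++ rest))) (+-assoc (length (adj zero)) (sum (take (toℕ v) (tabulate (length ∘ adj ∘ suc)))) (toℕ i)))
  (trans (load-++ʳ (adj zero) rest (sum (take (toℕ v) (tabulate (length ∘ adj ∘ suc))) + toℕ i)) (load-concat (adj ∘ suc) v i))
  where
  rest : List (Fin _)
  rest = concat (tabulate (adj ∘ suc))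

module _ {n : ℕ} (G : Graph n) where

  degree≤maxDegree : ∀ v → degree G v ≤ maxDegree G
  degree≤maxDegree v = All.lookup (map⁻ (xs≤max 0 (map (degree G) (allFin n)))) (∈-allFin v)

  E⇒0<maxDegree : ∀ {u v} → E G u v → 0 < maxDegree G
  E⇒0<maxDegree {u} {v} e = ≤-trans (nonempty (∈-filter⁺ (E? G u) (∈-allFin v) e)) (degree≤maxDegree u)
    where
    nonempty : ∀ {xs : List (Fin n)} {x} → x ∈ xs → 0 < length xs
    nonempty (here _)  = s≤s z≤n
    nonempty (there _) = s≤s z≤n

  adjacency-length : ∀ {adj} → IsAdjacencyLists G adj → ∀ v → length (adj v) ≤ maxDegree G
  adjacency-length isAdj v = ≤-trans
    (unique⊆⇒length≤ (proj₁ (isAdj v)) λ {w} w∈ → ∈-filter⁺ (E? G v) (∈-allFin w) (Equivalence.to (proj₂ (isAdj v) w) w∈))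
    (degree≤maxDegree v)

  canonicalLists : Fin n → List (Fin n)
  canonicalLists v = filter (E? G v) (allFin n)

  canonicalLists-correct : IsAdjacencyLists G canonicalLists
  canonicalLists-correct v = Uniqueₚ.filter⁺ _ (Uniqueₚ.allFin⁺ n) ,
    λ w → mk⇔ (λ w∈ → proj₂ (∈-filter⁻ (E? G v) {xs = allFin n} w∈)) (∈-filter⁺ (E? G v) (∈-allFin w))

sum-tabulate-bound : ∀ {n} (g : Fin n → ℕ) {b} → (∀ v → g v ≤ b) → sum (tabulate g) ≤ n * b
sum-tabulate-bound {zero}  g le = z≤n
sum-tabulate-bound {suc n} g le = +-mono-≤ (le zero) (sum-tabulate-bound (g ∘ suc) (le ∘ suc))

module _ {n : ℕ} (G : Graph n) (tree : IsTree G) (κ : ℕ) where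

  open Separation G tree
  open LongestPaths G tree
  open Comparison G tree κ

  walkLength-diametral : ∀ {P} → IsLongestPath G P → ∃₂ λ r z → Diametral r z × walkLength G (suc κ) P ≡ n ∸ suc κ + length (offBideep r z)
  walkLength-diametral {[]}     ((P≢[] , _) , _) = contradiction refl P≢[]
  walkLength-diametral {r ∷ ys} longest          = r , lastOf r ys , longest⇒diametral longest , walkLength≡ κ {r} {ys} longest

  walkLength-minimal : ∀ {P} → IsLongestPath G P → ∀ l C → IsSpanningRestrictedWalk G (suc κ) l C → walkLength G (suc κ) P ≤ l
  walkLength-minimal longest l C walk with r , z , diam , eq ← walkLength-diametral longest =
    ≤-trans (≤-reflexive eq) (LowerBound.lower-bound G tree κ l C walk diam)

-- The running time and the final assembly

-- Kept in the shape in which the run rules assemble it: 2 assignments and a sweep, twice, then 9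
-- commands and a main loop of `N` rounds.
budget : ℕ → ℕ → ℕ → ℕ → ℕ
budget n k Δ N = 2 + ((9 + n * suc Δ * 14) + (2 + ((9 + n * suc Δ * 14) + (9 + suc (N * suc (7 + (2 + (suc (3 + (suc (k * 3) + suc (suc (k * 6) + 2))) + 1))))))))

-- With `X = 1 + n * k * Δ`, both `n` and `n * Δ` are at most `X`. As `20 ≤ 20 * k`, a round costs
-- at most `29 * k`, and all rounds together at most `(X + X) * 29`. Hence
-- `146 = 32 + 2 * 28 + 2 * 29`.
budget-bound : ∀ {n k Δ N} → n ≤ n * k → n * k ≤ 1 + n * k * Δ → N ≤ n * Δ + n → 1 ≤ k → budget n k Δ N ≤ 146 * (1 + n * k * Δ)
budget-bound {n} {k} {Δ} {N} n≤nk nk≤X N≤ 1≤k = begin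
  budget n k Δ N                                           ≡⟨ expand n k Δ N ⟩
  32 + (n + n * Δ) * 28 + N * (k * 9 + 20)                 ≤⟨ +-mono-≤ (+-mono-≤ (m≤m*n 32 X) (*-monoˡ-≤ 28 (+-mono-≤ (≤-trans n≤nk nk≤X) nΔ≤X))) main ⟩
  32 * X + (X + X) * 28 + (X + X) * 29                     ≡⟨ collect X ⟩
  146 * X                                                  ∎
  where
  open ≤-Reasoning
  X : ℕ
  X = 1 + n * k * Δ

  expand : ∀ n k Δ N → 2 + ((9 + n * suc Δ * 14) + (2 + ((9 + n * suc Δ * 14) + (9 + suc (N * suc (7 + (2 + (suc (3 + (suc (k * 3) + suc (suc (k * 6) + 2))) + 1)))))))) ≡
           32 + (n + n * Δ) * 28 + N * (k * 9 + 20)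
  expand = solve-∀

  collect : ∀ X → 32 * X + (X + X) * 28 + (X + X) * 29 ≡ 146 * X
  collect = solve-∀

  nΔ≤X : n * Δ ≤ X
  nΔ≤X = m≤n⇒m≤1+n (*-monoˡ-≤ Δ n≤nk)

  main : N * (k * 9 + 20) ≤ (X + X) * 29
  main = begin
    N * (k * 9 + 20)                    ≤⟨ *-mono-≤ N≤ (+-monoʳ-≤ (k * 9) (≤-trans (≤-reflexive (sym (*-identityˡ 20))) (*-monoˡ-≤ 20 1≤k))) ⟩
    (n * Δ + n) * (k * 9 + k * 20)      ≡⟨ regroup n k Δ ⟩
    (n * k * Δ + n * k) * 29            ≤⟨ *-monoˡ-≤ 29 (+-mono-≤ (n≤1+n (n * k * Δ)) nk≤X) ⟩
    (X + X) * 29                        ∎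
    where
    regroup : ∀ n k Δ → (n * Δ + n) * (k * 9 + k * 20) ≡ (n * k * Δ + n * k) * 29
    regroup = solve-∀

abstract
  stepFactor : ℕ
  stepFactor = 146

  budget≤ : ∀ n k Δ N → n ≤ n * k → n * k ≤ 1 + n * k * Δ → N ≤ n * Δ + n → 1 ≤ k → budget n k Δ N ≤ stepFactor * (1 + n * k * Δ)
  budget≤ n k Δ N = budget-bound {n} {k} {Δ} {N}

-- A tree with two vertices has an edge, so its maximum degree is positive. For a single vertex that
-- degree is 0 and `k ≤ 1`; the summand 1 pays for this case.
vertices*agents-bound : ∀ {n k} (G : Graph n) → IsTree G → k ≤ n → n * k ≤ 1 + n * k * maxDegree G
vertices*agents-bound {zero}        G tree k≤n = z≤n
vertices*agents-bound {suc zero}    G tree k≤n = ≤-trans (≤-reflexive (*-identityˡ _)) (≤-trans k≤n (s≤s z≤n))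
vertices*agents-bound {suc (suc n)} {k} G tree k≤n = begin
  (2 + n) * k                       ≡⟨ sym (*-identityʳ _) ⟩
  (2 + n) * k * 1                   ≤⟨ *-monoʳ-≤ ((2 + n) * k) (E⇒0<maxDegree G (Metric.E-par G tree {suc zero} {zero} λ ())) ⟩
  (2 + n) * k * maxDegree G         ≤⟨ n≤1+n _ ⟩
  1 + (2 + n) * k * maxDegree G     ∎
  where open ≤-Reasoning

module _ {ν κ : ℕ} (G : Graph (suc ν)) (tree : IsTree G) (k≤n : suc κ ≤ suc ν)
         (adj : Fin (suc ν) → List (Fin (suc ν))) (isAdj : IsAdjacencyLists G adj) where

  private
    n k Δ : ℕ
    n = suc ν
    k = suc κ
    Δ = maxDegree G

    off nbr : ℕ → ℕ
    off = arrs (input k adj) aOff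
    nbr = arrs (input k adj) aAdj

    off-at : ∀ i → i < suc n → off i ≡ sum (take i (tabulate (length ∘ adj)))
    off-at i = load-map-applyUpTo (λ v → sum (take v (tabulate (length ∘ adj)))) id (suc n) i

    off-suc : ∀ v → off (toℕ v + 1) ≡ off (toℕ v) + length (adj v)
    off-suc v = trans (cong off (+-comm (toℕ v) 1)) (trans (off-at (suc (toℕ v)) (s≤s (toℕ<n v)))
      (trans (sum-take-suc (length ∘ adj) v) (cong (_+ length (adj v)) (sym (off-at (toℕ v) (m≤n⇒m≤1+n (toℕ<n v)))))))

    nbr-at : ∀ v i → nbr (off (toℕ v) + toℕ i) ≡ toℕ (lookup (adj v) i)
    nbr-at v i = trans (cong (λ o → nbr (o + toℕ i)) (off-at (toℕ v) (m≤n⇒m≤1+n (toℕ<n v)))) (load-concat adj v i)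

    open Metric G tree
    open Separation G tree
    open Comparison G tree κ
    open Sweep G tree adj isAdj off nbr off-suc nbr-at Δ (adjacency-length G isAdj)

    Finished : State → Set
    Finished τ = ∃ λ l → ∃ λ C → IsSpanningRestrictedWalk G k l C × (∃₂ λ r z → Diametral r z × l ≤ n ∸ k + length (offBideep r z)) × Outputs τ C

    total : ℕ
    total = sum (tabulate (length ∘ adj)) + n

    run-main : ∀ {z σ} → Swept k z 2 σ → (∀ v → δ zero v ≤ δ zero z) →
      Run (rHead ≔ reg rBest ⨾ rTop ≔ reg rBest ⨾ rLen ≔ lit 0 ⨾ rBase ≔ lit 0 ⨾ rKept ≔ lit 0 ⨾ rDone ≔ lit 0 ⨾ rSize ≔ lit 1 ⨾
           aSeen [ reg rHead ]≔ lit 3 ⨾ aOut [ lit 0 ]≔ reg rHead ⨾ while (reg rHead ≠ᴱ reg rRoot) advance) σ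
          (9 + suc (total * suc (7 + (2 + (suc (3 + (suc (k * 3) + suc (suc (k * 6) + 2))) + 1))))) Finished
    run-main {z} {σ} swept far₀ =
      assign-then (assign-then (assign-then (assign-then (assign-then (assign-then (assign-then (store-then (store-then
        (run-map finish (run-while Loop run-advance total (start , inv-start , represents , ≤-refl)))))))))))
      where
      open Swept swept renaming (best to r)
      open Frame frame
      diametral : Diametral r z
      diametral = farthest-diametral far₀ farthest

      open Rooted G tree z
      open Traversal G tree z r diametral adj isAdj
      open Execution G tree z r diametral adj isAdj κ
      open Simulation G tree z r diametral adj isAdj κ off nbr off-suc nbr-at

      σ₉ : State
      σ₉ = stored aOut (lit 0) (reg rHead) (stored aSeen (reg rHead) (lit 3) (assigned rSize (lit 1) (assigned rDone (lit 0) (assigned rKept (lit 0)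
             (assigned rBase (lit 0) (assigned rLen (lit 0) (assigned rTop (reg rBest) (assigned rHead (reg rBest) σ))))))))

      represents : Rep start σ₉
      represents = record
        { base = record
          { at-k = frame-k ; at-len = refl ; at-head = at-best ; at-top = at-best ; at-kept = refl ; at-done = refl ; at-size = refl ; at-base = refl ; at-root = at-root
          ; at-off = frame-off ; at-adj = frame-adj ; at-par = parents ; at-used = λ v → frame-used (toℕ v) ; at-mark = λ v → ≤-reflexive (frame-mark (toℕ v))
          ; at-fin = λ () ; at-out = λ { z≤n (s≤s z≤n) → at-best } }
        ; seen   = λ { (here refl) → trans (cong (λ y → update (arrs σ aSeen) y 3 (toℕ r)) at-best) (update-same (arrs σ aSeen) (toℕ r) 3) }
        ; unseen = λ {v} v∉ → ≤-reflexive (cong suc (trans (cong (λ y → update (arrs σ aSeen) y 3 (toℕ v)) at-best)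
                     (trans (update-other (arrs σ aSeen) (toℕ r) 3 (λ eq → v∉ (here (toℕ-injective (sym eq))))) (seen v))))
        ; toward = λ { (here refl) r≢r → contradiction refl r≢r } }

      finish : ∀ {τ} → (∃ λ N → Loop N τ) × ⟦ reg rHead ≠ᴱ reg rRoot ⟧ τ ≡ 0 → Finished τ
      finish {τ} ((_ , m , I , R , _) , test) = Machine.T m , result I h≡z k≤n , result-walk I h≡z k≤n , (r , z , diametral , result-length I h≡z k≤n) ,
        at-len , λ t i → at-out (≤-pred (toℕ<n t)) (subst (toℕ i <_) (sym (filled I h≡z k≤n)) (toℕ<n i))
        where
        open Base (Rep.base R) using (at-head; at-len; at-out)
        h≡z : Machine.h m ≡ z
        h≡z = toℕ-injective (trans (sym at-head) (trans (∸+∸≡0⇒≡ test) (Base.at-root (Rep.base R))))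

    run-planWalk : Run planWalk (input k adj) (budget n k Δ total) Finished
    run-planWalk =
      assign-then (assign-then (run-seq (run-sweep k zero 1 initial refl refl (λ _ → s≤s z≤n)) λ S₁ →
        assign-then (assign-then (run-seq (run-sweep k (Swept.best S₁) 2 (record { Frame (Swept.frame S₁) }) (Swept.at-best S₁) refl (λ v → ≤-reflexive (cong suc (Swept.seen S₁ v)))) λ S₂ →
          run-main S₂ (Swept.farthest S₁)))))
      where
      initial : Frame k _
      initial = record { frame-k = refl ; frame-off = refl ; frame-adj = refl ; frame-used = λ _ → refl ; frame-mark = λ _ → refl }


  -- `offBideep-minimal` compares the program's own diametral pair with the ends of `P` and bounds
  -- the length of the walk by `walkLength G k P`. With the lower bound the lengths are equal, and
  -- the walk is transported to that index.
  plan : ∀ {P} → IsLongestPath G P → ∃ λ τ → ∃ λ steps → ∃ λ C →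
         ⟨ planWalk , input k adj ⟩⇓⟨ τ , steps ⟩ × steps ≤ stepFactor * (1 + n * k * Δ) × IsSpanningRestrictedWalk G k (walkLength G k P) C × Outputs τ C
  plan {P} longest = conclude run-planWalk
    where
    Walks : State → ℕ → Set
    Walks τ l = ∃ λ (C : Fin (suc l) → Fin k → Fin n) → IsSpanningRestrictedWalk G k l C × Outputs τ C

    upper : ∀ {l r z} → Diametral r z → l ≤ n ∸ k + length (offBideep r z) → l ≤ walkLength G k P
    upper {l} diam l≤ = by (walkLength-diametral G tree κ longest)
      where
      by : (∃₂ λ r z → Diametral r z × walkLength G k P ≡ n ∸ k + length (offBideep r z)) → l ≤ walkLength G k P
      by (r′ , z′ , _ , eq) = ≤-trans l≤ (≤-trans (+-monoʳ-≤ (n ∸ k) (offBideep-minimal diam r′ z′)) (≤-reflexive (sym eq)))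

    cheap : budget n k Δ total ≤ stepFactor * (1 + n * k * Δ)
    cheap = budget≤ n k Δ total (m≤m*n n k) (vertices*agents-bound G tree k≤n)
      (+-monoˡ-≤ n (sum-tabulate-bound (length ∘ adj) (adjacency-length G isAdj))) (s≤s z≤n)

    conclude : Run planWalk (input k adj) (budget n k Δ total) Finished → ∃ λ τ → ∃ λ steps → ∃ λ C →
      ⟨ planWalk , input k adj ⟩⇓⟨ τ , steps ⟩ × steps ≤ stepFactor * (1 + n * k * Δ) × IsSpanningRestrictedWalk G k (walkLength G k P) C × Outputs τ C
    conclude (τ , steps , run , steps≤ , l , C , walk , (r , z , diam , l≤) , outputs) =
      τ , steps , proj₁ reindexed , run , ≤-trans steps≤ cheap , proj₂ reindexed
      where
      reindexed : Walks τ (walkLength G k P)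
      reindexed = subst (Walks τ) (≤-antisym (upper diam l≤) (walkLength-minimal G tree κ longest l C walk)) (C , walk , outputs)

theorem3 : (∀ (n k : ℕ) → 1 ≤ k → k ≤ n →
    (G : Graph n) → IsTree G →
    (P : List (Fin n)) → IsLongestPath G P →
    h^r[ k , G ]≡ walkLength G k P)
    ×
    (∃ λ (prog : Cmd) → ∃ λ (c : ℕ) →
    ∀ (n k : ℕ) → 1 ≤ k → k ≤ n →
    (G : Graph n) → IsTree G →
    (P : List (Fin n)) → IsLongestPath G P →
    (adj : Fin n → List (Fin n)) → IsAdjacencyLists G adj →
    ∃ λ τ → ∃ λ steps → ∃ λ C →
    ⟨ prog , input k adj ⟩⇓⟨ τ , steps ⟩
    × steps ≤ c * (1 + n * k * maxDegree G)
    × IsSpanningRestrictedWalk G k (walkLength G k P) C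
    × Outputs τ C)
theorem3 = optimal , planWalk , stepFactor , λ { (suc ν) (suc κ) _ k≤n G tree P longest adj isAdj → plan G tree k≤n adj isAdj longest }
  where
  optimal : ∀ (n k : ℕ) → 1 ≤ k → k ≤ n → (G : Graph n) → IsTree G → (P : List (Fin n)) → IsLongestPath G P → h^r[ k , G ]≡ walkLength G k P
  optimal (suc ν) (suc κ) _ k≤n G tree P longest =
    -- Some optimal walk exists because the program outputs one on the canonical adjacency lists of
    -- `G`.
    exists (plan G tree k≤n (canonicalLists G) (canonicalLists-correct G) longest) , walkLength-minimal G tree κ longest
    where
    exists : ∀ {A : State → ℕ → Set} {B : ℕ → Set} {D : State → _ → Set} →
             (∃ λ τ → ∃ λ steps → ∃ λ C → A τ steps × B steps × IsSpanningRestrictedWalk G (suc κ) (walkLength G (suc κ) P) C × D τ C) →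
             ∃ λ C → IsSpanningRestrictedWalk G (suc κ) (walkLength G (suc κ) P) C
    exists (_ , _ , C , _ , _ , walk , _) = C , walk
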